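{- The dynamic problem $\mathrm{Member}(D_1)$ can be maintained in $\mathsf{DynFO}$ with $\mathcal{O}((\log n)^3)$ work.
   Context: $D_1$ is the Dyck language with one type of parentheses, that is, the set of well-balanced strings over the alphabet $\{\langle,\rangle\}$ consisting of one opening and one closing parenthesis. Member. For a fixed language $L$ over a finite alphabet $\Sigma$, $\mathrm{Member}(L)$ is the following dynamic problem. Input: a sequence $w=w_0\ldots w_{n-1}$ with $w_i\in\Sigma\cup\{\epsilon\}$ (here $\epsilon$ is the empty word), encoded as a structure with domain $[n]$, its linear order, and one unary relation $R_\sigma=\{i: w_i=\sigma\}$ for each $\sigma\in\Sigma$; initially all $w_i=\epsilon$. Change operations: $\mathrm{set}_\sigma(i)$ for $\sigma\in\Sigma$ (sets $w_i$ to $\sigma$ if $w_i=\epsilon$) and $\mathrm{reset}(i)$ (sets $w_i$ to $\epsilon$). Query operation: $\mathrm{member}$: is $w_0\circ\cdots\circ w_{n-1}\in L$? Conventions. Structures have a finite domain $D=[n]=\{0,\dots,n-1\}$ and a finite schema of relation and function symbols; functions may be partial (undefined value $\bot$). The natural linear order $\le$ and compatible $+$ and $\times$ are always available to formulas, terms and conditions. First-order terms may use if-then-else: $\mathrm{ITE}(\varphi,t_1,t_2)$ evaluates to $t_1$ if $\varphi$ holds and to $t_2$ otherwise. Dynamic problems. A dynamic problem $\Pi$ is given by a schema of input structures and a finite set of operations: change operations, which modify the input structure, and query operations, which return a truth value (relational queries) or elements (functional queries) depending on their parameters. Unless stated otherwise the initial input structure is empty. $\mathsf{DynFO}$. A dynamic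 program for $\Pi$ stores an auxiliary structure $\mathcal A$ over a schema $\tau_{aux}$ on the domain of the input; initially $\mathcal A$ is first-order definable from the initial input. For each query operation $Q(\bar p)$ it has one query rule giving the result by a first-order formula (or term) evaluated on $\mathcal A$. For each change operation $\delta(\bar p)$ and each auxiliary relation $R$ it has one update rule "on change $\delta(\bar p)$ update $R$ at $(t_1(\bar p;\bar x),\dots,t_k(\bar p;\bar x))$ as $\varphi(\bar p;\bar x)$ where $C(\bar x)$", with terms $t_i$, a first-order formula $\varphi$ and a conjunction $C$ of inequalities $x_i\le g_i(n)$ with first-order definable $g_i:\mathbb N\to\mathbb N$. After $\delta(\bar a)$, the new $R$ arises from the old one by removing all tuples $(t_1(\bar a;\bar b),\dots,t_k(\bar a;\bar b))$ with $\bar b$ satisfying $C$ and adding those for which $\mathcal A\models\varphi(\bar a;\bar b)$ (old $\mathcal A$). For auxiliary functions, a term gives the new value instead. The program must answer all queries correctly after every sequence of changes. Procedural-DynFO. Here the formula or term of an update rule is replaced by an update procedure $P=P_1;P_2$. The program may declare supplementary instances of other dynamic problems, each with its own program. The initial procedure $P_1$ does not use $\bar x$, is executed once per change and may, outside parallel branches, invoke change operations $\mathrm{instance}.\delta(\bar y)$ of supplementary instances (for each main change operation and each supplementary instance, in at most one update rule). The main procedure $P_2$ is executed for every $\bar x$ satisfying $C$, may use $\bar x$, and may use "return condition/term" outside parallel branches. Both consist of: assignments $f(\bar y)\leftarrow$ term and $R(\bar y)\leftarrow$ condition (symbols not in $\tau_{aux}$; inside a parallel branch binding $z$, $z$ occurs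 in $\bar y$); "if condition then $P'$ else $P''$"; "for $z\le g(n)$ pardo $P'$". Terms are built from local variables, variables of $\bar p,\bar x$, function symbols of $\tau_{aux}$ and previously assigned ones, if-then-else terms, functional queries $\mathrm{instance}.Q(\bar y)$, and $\mathrm{getUnique}(z\le g(n)\mid\text{condition})$ (exactly one such $z$ must exist). Conditions are built from atomic formulas over $\tau_{aux}$ and previously assigned symbols, $\mathrm{exists}(z\le g(n)\mid\text{condition})$, relational queries $\mathrm{instance}.Q(\bar y)$, and Boolean combinations. All $g$ are first-order definable, $n$ is the domain size of the main instance, and every execution path ends with a return of appropriate type. The returned value plays the role of the value of $\varphi$ (or of the term). Query procedures are analogous, with free variables $\bar p$ only and no change invocations. Work. The function $w$ is defined inductively: constants and variables have $w=1$; function applications, atomic conditions, Boolean combinations, if-then-else terms, conditional branches and sequences have the maximum of 1 and the $w$ of their parts; assignments and returns have the $w$ of their right-hand side or argument; getUnique, exists and pardo with bound $z\le g(n)$ have $g(n)$ times the $w$ of their body; a query or change invocation on a supplementary instance has the maximum of $w$ of the respective query rule or update rules and of its argument terms. For an update rule $\pi$ with constraint $x_1\le g_1(n)\wedge\dots\wedge x_\ell\le g_\ell(n)$, $w(\pi)=\max(w(P_1),\,g_1(n)\cdots g_\ell(n)\cdot \max(w(P_2),w(t_1),\dots,w(t_k)))$; for a query rule it is the $w$ of its procedure. A dynamic problem can be maintained in $\mathsf{DynFO}$ with work $\mathcal O(f(n))$ (has a $\mathsf{DynFO}$-program with that work) if it has a Procedural-DynFO program all of whose update and query rules $\pi$ satisfy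 $w(\pi)\in\mathcal O(f(n))$; bounds "per change operation" and "per query operation" refer to update and query rules, respectively. The initialization is not counted. -}

module Defs where

open import Data.Bool.Base using (Bool; true; false; T; not; _∧_; _∨_; if_then_else_)
open import Data.Bool.ListAction using (any; all)
open import Data.Empty using (⊥)
open import Data.Fin.Base using (Fin; zero; suc; toℕ; fromℕ<)
open import Data.Fin.Properties using (_≟_)
open import Data.List.Base
  using (List; []; _∷_; _++_; map; concatMap; filterᵇ; allFin; foldl)
open import Data.List.Relation.Unary.All using (All)
open import Data.Maybe.Base using (Maybe; just; nothing; maybe′; zipWith; _>>=_)
import Data.Maybe.Properties as Maybeₚ
open import Data.Nat.Base using (ℕ; zero; suc; _+_; _*_; _⊔_; _≤_; _≤ᵇ_)
open import Data.Nat.Properties using (_<?_)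
open import Data.Product.Base using (Σ; Σ-syntax; ∃-syntax; _×_; _,_; proj₁; proj₂)
open import Data.Sum.Base using (_⊎_; inj₁; inj₂)
open import Data.Vec.Base using (Vec; []; _∷_; lookup) renaming (_++_ to _++ᵛ_; map to mapᵛ)
open import Data.Vec.Membership.Propositional using () renaming (_∈_ to _∈ᵛ_)
import Data.Vec.Properties as Vecₚ
open import Function.Base using (id; _∘_)
open import Function.Bundles using (_⇔_)
open import Relation.Binary.PropositionalEquality using (_≡_; refl)
open import Relation.Nullary.Decidable using (Dec; yes; no; does)

record Schema : Set where
  field
    #rel #fun : ℕ
    relAr     : Fin #rel → ℕ
    funAr     : Fin #fun → ℕ

open Schema public

Tuple : ℕ → ℕ → Set
Tuple n k = Vec (Fin n) k

-- Functions are partial; `nothing` is the undefined value.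
record Structure (τ : Schema) (n : ℕ) : Set where
  field
    rel : (r : Fin (#rel τ)) → Tuple n (relAr τ r) → Bool
    fun : (f : Fin (#fun τ)) → Tuple n (funAr τ f) → Maybe (Fin n)

open Structure public

∅ : Schema
∅ = record { #rel = 0 ; #fun = 0 ; relAr = λ () ; funAr = λ () }

emptyStructure : ∀ {τ n} → Structure τ n
emptyStructure = record { rel = λ _ _ → false ; fun = λ _ _ → nothing }

_≟ᵗ_ : ∀ {n k} (ā b̄ : Tuple n k) → Dec (ā ≡ b̄)
_≟ᵗ_ = Vecₚ.≡-dec _≟_

setRel : ∀ {τ n} (r : Fin (#rel τ)) → Tuple n (relAr τ r) → Bool → Structure τ n → Structure τ n
setRel {τ} {n} r ā v 𝒜 = record 𝒜 { rel = new }
  where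
  new : (r′ : Fin (#rel τ)) → Tuple n (relAr τ r′) → Bool
  new r′ b̄ with r ≟ r′
  ... | yes refl = if does (ā ≟ᵗ b̄) then v else rel 𝒜 r b̄
  ... | no _     = rel 𝒜 r′ b̄

setFun : ∀ {τ n} (f : Fin (#fun τ)) → Tuple n (funAr τ f) → Maybe (Fin n) →
         Structure τ n → Structure τ n
setFun {τ} {n} f ā v 𝒜 = record 𝒜 { fun = new }
  where
  new : (f′ : Fin (#fun τ)) → Tuple n (funAr τ f′) → Maybe (Fin n)
  new f′ b̄ with f ≟ f′
  ... | yes refl = if does (ā ≟ᵗ b̄) then v else fun 𝒜 f b̄
  ... | no _     = fun 𝒜 f′ b̄

-- Sums and products outside [n] are undefined, and atoms with an undefined argument are false.

toFin? : ∀ n → ℕ → Maybe (Fin n)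
toFin? n m with m <? n
... | yes m<n = just (fromℕ< m<n)
... | no _    = nothing

plus times : ∀ {n} → Maybe (Fin n) → Maybe (Fin n) → Maybe (Fin n)
plus  {n} x y = x >>= λ a → y >>= λ b → toFin? n (toℕ a + toℕ b)
times {n} x y = x >>= λ a → y >>= λ b → toFin? n (toℕ a * toℕ b)

holds : Maybe Bool → Bool
holds = maybe′ id false

equal leq : ∀ {n} → Maybe (Fin n) → Maybe (Fin n) → Bool
equal x y = holds (zipWith (λ a b → does (a ≟ b)) x y)
leq   x y = holds (zipWith (λ a b → toℕ a ≤ᵇ toℕ b) x y)

only : ∀ {A : Set} → List A → Maybe A
only (x ∷ []) = just x
only _        = nothing

-- Variables are de Bruijn indices; a binder binds index 0.

mutual
  data FOTerm (τ : Schema) (k : ℕ) : Set where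
    var     : Fin k → FOTerm τ k
    app     : (f : Fin (#fun τ)) → Vec (FOTerm τ k) (funAr τ f) → FOTerm τ k
    _⊕_ _⊗_ : FOTerm τ k → FOTerm τ k → FOTerm τ k
    ite     : Formula τ k → FOTerm τ k → FOTerm τ k → FOTerm τ k

  data Formula (τ : Schema) (k : ℕ) : Set where
    atom      : (r : Fin (#rel τ)) → Vec (FOTerm τ k) (relAr τ r) → Formula τ k
    _≐_ _≼_   : FOTerm τ k → FOTerm τ k → Formula τ k
    ⊤′        : Formula τ k
    ¬′_       : Formula τ k → Formula τ k
    _∧′_ _∨′_ : Formula τ k → Formula τ k → Formula τ k
    ∃′_ ∀′_   : Formula τ (suc k) → Formula τ k

infixl 7 _⊗_
infixl 6 _⊕_
infix  4 _≐_ _≼_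
infix  3 ¬′_
infixr 2 _∧′_
infixr 1 _∨′_

module _ {τ : Schema} {n : ℕ} (𝒜 : Structure τ n) where
  mutual
    evalFO : ∀ {k} → Tuple n k → FOTerm τ k → Maybe (Fin n)
    evalFO e (var x)     = just (lookup e x)
    evalFO e (app f ts)  = evalsFO e ts >>= fun 𝒜 f
    evalFO e (s ⊕ t)     = plus (evalFO e s) (evalFO e t)
    evalFO e (s ⊗ t)     = times (evalFO e s) (evalFO e t)
    evalFO e (ite φ s t) = if sat e φ then evalFO e s else evalFO e t

    evalsFO : ∀ {k a} → Tuple n k → Vec (FOTerm τ k) a → Maybe (Tuple n a)
    evalsFO e []       = just []
    evalsFO e (t ∷ ts) = zipWith _∷_ (evalFO e t) (evalsFO e ts)

    sat : ∀ {k} → Tuple n k → Formula τ k → Bool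
    sat e (atom r ts) = maybe′ (rel 𝒜 r) false (evalsFO e ts)
    sat e (s ≐ t)     = equal (evalFO e s) (evalFO e t)
    sat e (s ≼ t)     = leq (evalFO e s) (evalFO e t)
    sat e ⊤′          = true
    sat e (¬′ φ)      = not (sat e φ)
    sat e (φ ∧′ ψ)    = sat e φ ∧ sat e ψ
    sat e (φ ∨′ ψ)    = sat e φ ∨ sat e ψ
    sat e (∃′ φ)      = any (λ a → sat (a ∷ e) φ) (allFin n)
    sat e (∀′ φ)      = all (λ a → sat (a ∷ e) φ) (allFin n)

-- First-order definability of g : ℕ → ℕ: one formula over ≤, + and × defines
-- the element g n of [n] in every domain [n], and no element if g n ≥ n.
record Bound : Set where
  field
    value   : ℕ → ℕ
    formula : Formula ∅ 1
    defines : ∀ n (z : Fin n) → T (sat emptyStructure (z ∷ []) formula) ⇔ (toℕ z ≡ value n)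

open Bound public

range : ∀ n → Bound → List (Fin n)
range n g = filterᵇ (λ z → toℕ z ≤ᵇ value g n) (allFin n)

tuples : ∀ n {ℓ} → Vec Bound ℓ → List (Tuple n ℓ)
tuples n []       = [] ∷ []
tuples n (g ∷ gs) = concatMap (λ x → map (x ∷_) (tuples n gs)) (range n g)

-- The schema `query` lists the relational queries as relation symbols and the
-- functional queries as function symbols.
record Signature : Set where
  field
    input    : Schema
    #change  : ℕ
    changeAr : Fin #change → ℕ
    query    : Schema

open Signature public

record Problem : Set₁ where
  field
    sig      : Signature
    change   : ∀ {n} (δ : Fin (#change sig)) → Tuple n (changeAr sig δ) →
               Structure (input sig) n → Structure (input sig) n
    relQuery : ∀ {n} → Structure (input sig) n →
               (q : Fin (#rel (query sig))) → Tuple n (relAr (query sig) q) → Set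
    funQuery : ∀ {n} → Structure (input sig) n →
               (q : Fin (#fun (query sig))) → Tuple n (funAr (query sig) q) → Maybe (Fin n)

open Problem public

-- `loc` contains the symbols that are assigned by procedures; `supp` gives the
-- signatures of the supplementary instances.
record Vocabulary : Set where
  constructor vocabulary
  field
    aux loc : Schema
    {#supp} : ℕ
    supp    : Fin #supp → Signature

open Vocabulary public

mutual
  data Term (V : Vocabulary) (k : ℕ) : Set where
    var       : Fin k → Term V k
    auxFun    : (f : Fin (#fun (aux V))) → Vec (Term V k) (funAr (aux V) f) → Term V k
    locFun    : (f : Fin (#fun (loc V))) → Vec (Term V k) (funAr (loc V) f) → Term V k
    _⊕_ _⊗_   : Term V k → Term V k → Term V k
    ite       : Cond V k → Term V k → Term V k → Term V k
    queryFun  : (i : Fin (#supp V)) (q : Fin (#fun (query (supp V i)))) →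
                Vec (Term V k) (funAr (query (supp V i)) q) → Term V k
    getUnique : Bound → Cond V (suc k) → Term V k

  data Cond (V : Vocabulary) (k : ℕ) : Set where
    auxRel    : (r : Fin (#rel (aux V))) → Vec (Term V k) (relAr (aux V) r) → Cond V k
    locRel    : (r : Fin (#rel (loc V))) → Vec (Term V k) (relAr (loc V) r) → Cond V k
    _≐_ _≼_   : Term V k → Term V k → Cond V k
    ⊤′        : Cond V k
    ¬′_       : Cond V k → Cond V k
    _∧′_ _∨′_ : Cond V k → Cond V k → Cond V k
    queryRel  : (i : Fin (#supp V)) (q : Fin (#rel (query (supp V i)))) →
                Vec (Term V k) (relAr (query (supp V i)) q) → Cond V k
    exists    : Bound → Cond V (suc k) → Cond V k

infixr 1 _⨾_

-- Changes may be invoked on the instances in `May` only.  The list `par`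
-- contains the variables bound by the enclosing parallel branches: they have to
-- occur on the left-hand side of assignments, and changes require `par` to be [].
data Stmt (V : Vocabulary) (May : Fin (#supp V) → Set) (k : ℕ) : List (Fin k) → Set where
  skip      : ∀ {par} → Stmt V May k par
  assignFun : ∀ {par} (f : Fin (#fun (loc V))) (ys : Vec (Fin k) (funAr (loc V) f)) →
              All (_∈ᵛ ys) par → Term V k → Stmt V May k par
  assignRel : ∀ {par} (r : Fin (#rel (loc V))) (ys : Vec (Fin k) (relAr (loc V) r)) →
              All (_∈ᵛ ys) par → Cond V k → Stmt V May k par
  _⨾_       : ∀ {par} → Stmt V May k par → Stmt V May k par → Stmt V May k par
  branch    : ∀ {par} → Cond V k → Stmt V May k par → Stmt V May k par → Stmt V May k par
  pardo     : ∀ {par} → Bound → Stmt V May (suc k) (zero ∷ map suc par) → Stmt V May k par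
  invoke    : (i : Fin (#supp V)) → May i → (δ : Fin (#change (supp V i))) →
              Vec (Term V k) (changeAr (supp V i) δ) → Stmt V May k []

-- Every execution path of a Proc ends with a return.  Returns occur in tail position
-- only: an early return in one branch is written by moving the rest into the other.
data Proc (V : Vocabulary) (k : ℕ) (Ret : Set) : Set where
  return : Ret → Proc V k Ret
  _⨾_    : Stmt V (λ _ → ⊥) k [] → Proc V k Ret → Proc V k Ret
  branch : Cond V k → Proc V k Ret → Proc V k Ret → Proc V k Ret

record Machines {m : ℕ} (supp : Fin m → Signature) (n : ℕ) : Set₁ where
  field
    St      : Fin m → Set
    answers : ∀ i → St i → Structure (query (supp i)) n
    step    : ∀ i (δ : Fin (#change (supp i))) → Tuple n (changeAr (supp i) δ) → St i → St i

module Semantics {V : Vocabulary} {n : ℕ} (M : Machines (supp V) n)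
                 (𝒜 : Structure (aux V) n) where
  open Machines M

  record Config : Set where
    constructor config
    field
      locals    : Structure (loc V) n
      instances : ∀ i → St i

  open Config public

  mutual
    evalTerm : ∀ {k} → Config → Tuple n k → Term V k → Maybe (Fin n)
    evalTerm s e (var x)           = just (lookup e x)
    evalTerm s e (auxFun f ts)     = evalTerms s e ts >>= fun 𝒜 f
    evalTerm s e (locFun f ts)     = evalTerms s e ts >>= fun (locals s) f
    evalTerm s e (t ⊕ u)           = plus (evalTerm s e t) (evalTerm s e u)
    evalTerm s e (t ⊗ u)           = times (evalTerm s e t) (evalTerm s e u)
    evalTerm s e (ite c t u)       = if evalCond s e c then evalTerm s e t else evalTerm s e u
    evalTerm s e (queryFun i q ts) = evalTerms s e ts >>= fun (answers i (instances s i)) q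
    evalTerm s e (getUnique g c)   = only (filterᵇ (λ z → evalCond s (z ∷ e) c) (range n g))

    evalTerms : ∀ {k a} → Config → Tuple n k → Vec (Term V k) a → Maybe (Tuple n a)
    evalTerms s e []       = just []
    evalTerms s e (t ∷ ts) = zipWith _∷_ (evalTerm s e t) (evalTerms s e ts)

    evalCond : ∀ {k} → Config → Tuple n k → Cond V k → Bool
    evalCond s e (auxRel r ts)     = maybe′ (rel 𝒜 r) false (evalTerms s e ts)
    evalCond s e (locRel r ts)     = maybe′ (rel (locals s) r) false (evalTerms s e ts)
    evalCond s e (t ≐ u)           = equal (evalTerm s e t) (evalTerm s e u)
    evalCond s e (t ≼ u)           = leq (evalTerm s e t) (evalTerm s e u)
    evalCond s e ⊤′                = true
    evalCond s e (¬′ c)            = not (evalCond s e c)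
    evalCond s e (c ∧′ d)          = evalCond s e c ∧ evalCond s e d
    evalCond s e (c ∨′ d)          = evalCond s e c ∨ evalCond s e d
    evalCond s e (queryRel i q ts) =
      maybe′ (rel (answers i (instances s i)) q) false (evalTerms s e ts)
    evalCond s e (exists g c)      = any (λ z → evalCond s (z ∷ e) c) (range n g)

  data Effect : Set where
    writeFun : (f : Fin (#fun (loc V))) → Tuple n (funAr (loc V) f) → Maybe (Fin n) → Effect
    writeRel : (r : Fin (#rel (loc V))) → Tuple n (relAr (loc V) r) → Bool → Effect
    callStep : (i : Fin (#supp V)) (δ : Fin (#change (supp V i))) →
               Tuple n (changeAr (supp V i) δ) → Effect

  perform : Config → Effect → Config
  perform s (writeFun f ā v) = record s { locals = setFun f ā v (locals s) }
  perform s (writeRel r ā v) = record s { locals = setRel r ā v (locals s) }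
  perform s (callStep i δ ā) = record s { instances = new }
    where
    new : ∀ j → St j
    new j with i ≟ j
    ... | yes refl = step i δ ā (instances s i)
    ... | no _     = instances s j

  performAll : Config → List Effect → Config
  performAll = foldl perform

  -- All parallel branches start from the same configuration and do not see each
  -- other's assignments; these take effect once all branches have finished.
  effects : ∀ {k May par} → Config → Tuple n k → Stmt V May k par → List Effect
  effects s e skip                 = []
  effects s e (assignFun f ys _ t) = writeFun f (mapᵛ (lookup e) ys) (evalTerm s e t) ∷ []
  effects s e (assignRel r ys _ c) = writeRel r (mapᵛ (lookup e) ys) (evalCond s e c) ∷ []
  effects s e (P ⨾ Q)              = effects s e P ++ effects (performAll s (effects s e P)) e Q
  effects s e (branch c P Q)       = if evalCond s e c then effects s e P else effects s e Q
  effects s e (pardo g P)          = concatMap (λ z → effects s (z ∷ e) P) (range n g)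
  effects s e (invoke i _ δ ts)    =
    maybe′ (λ ā → callStep i δ ā ∷ []) [] (evalTerms s e ts)

  exec : ∀ {k May par} → Config → Tuple n k → Stmt V May k par → Config
  exec s e P = performAll s (effects s e P)

  run : ∀ {k} {Ret A : Set} → (Config → Ret → A) → Config → Tuple n k → Proc V k Ret → A
  run eval s e (return r)     = eval s r
  run eval s e (P ⨾ Q)        = run eval (exec s e P) e Q
  run eval s e (branch c P Q) = if evalCond s e c then run eval s e P else run eval s e Q

-- A rule "on change δ(p̄) update S at (t₁(p̄;x̄),…,tₐ(p̄;x̄)) … where x₁ ≤ g₁(n) ∧ …"
-- for an auxiliary symbol S of arity a.
record UpdateRule {m} (auxS : Schema) (suppS : Fin m → Signature) (May : Fin m → Set)
                  (p a : ℕ) (Ret : Vocabulary → ℕ → Set) : Set where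
  field
    #x : ℕ
    constraint : Vec Bound #x
    at         : Vec (Term (vocabulary auxS ∅ suppS) (p + #x)) a
    locals     : Schema
    initial    : Stmt (vocabulary auxS locals suppS) May p []
    main       : Proc (vocabulary auxS locals suppS) (p + #x)
                      (Ret (vocabulary auxS locals suppS) (p + #x))

record QueryRule {m} (auxS : Schema) (suppS : Fin m → Signature)
                 (p : ℕ) (Ret : Vocabulary → ℕ → Set) : Set where
  field
    locals : Schema
    proc   : Proc (vocabulary auxS locals suppS) p (Ret (vocabulary auxS locals suppS) p)

AuxSymbol : Schema → Set
AuxSymbol τ = Fin (#rel τ) ⊎ Fin (#fun τ)

record Rules (S : Signature) {m} (auxS : Schema) (suppS : Fin m → Signature) : Set where
  field
    -- The auxiliary function f is initially defined at x̄, with value y, if y is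
    -- the only element satisfying initFun f at (y , x̄).
    initRel : ∀ r → Formula (input S) (relAr auxS r)
    initFun : ∀ f → Formula (input S) (suc (funAr auxS f))
    -- The only update rule that may change instance i when δ is applied.
    owner   : Fin (#change S) → Fin m → Maybe (AuxSymbol auxS)
    updRel  : ∀ δ r → UpdateRule auxS suppS (λ i → owner δ i ≡ just (inj₁ r))
                                 (changeAr S δ) (relAr auxS r) Cond
    updFun  : ∀ δ f → UpdateRule auxS suppS (λ i → owner δ i ≡ just (inj₂ f))
                                 (changeAr S δ) (funAr auxS f) Term
    ansRel  : ∀ q → QueryRule auxS suppS (relAr (query S) q) Cond
    ansFun  : ∀ q → QueryRule auxS suppS (funAr (query S) q) Term

data Program : Problem → Set₁ where
  program : ∀ {Π m} (auxS : Schema) (Πs : Fin m → Problem) → (∀ i → Program (Πs i)) →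
            Rules (sig Π) auxS (sig ∘ Πs) → Program Π

-- Result of writing a list of values to one cell of an auxiliary function:
-- conflicting values make the cell undefined.
agreed : ∀ {n} → List (Maybe (Fin n)) → Maybe (Fin n)
agreed []       = nothing
agreed (v ∷ vs) = if all (λ u → does (Maybeₚ.≡-dec _≟_ u v)) vs then v else nothing

module _ {S : Signature} {m} {auxS : Schema} {suppS : Fin m → Signature}
         (R : Rules S auxS suppS) {n : ℕ} where
  open Rules R

  initialAux : Structure (input S) n → Structure auxS n
  initialAux ℐ = record
    { rel = λ r ā → sat ℐ ā (initRel r)
    ; fun = λ f ā → only (filterᵇ (λ y → sat ℐ (y ∷ ā) (initFun f)) (allFin n))
    }

  module _ (M : Machines suppS n) (𝒜 : Structure auxS n) (I : ∀ i → Machines.St M i) where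

    module Sem (L : Schema) = Semantics {V = vocabulary auxS L suppS} M 𝒜

    start : ∀ L → Sem.Config L
    start L = Sem.config emptyStructure I

    module _ {May : Fin m → Set} {p a : ℕ} {Ret : Vocabulary → ℕ → Set}
             (ρ : UpdateRule auxS suppS May p a Ret) (p̄ : Tuple n p) where
      open UpdateRule ρ

      afterInitial : Sem.Config locals
      afterInitial = Sem.exec locals (start locals) p̄ initial

      target : Tuple n #x → Maybe (Tuple n a)
      target b̄ = Sem.evalTerms ∅ (start ∅) (p̄ ++ᵛ b̄) at

      writers : Tuple n a → List (Tuple n #x)
      writers c̄ = filterᵇ (λ b̄ → does (Maybeₚ.≡-dec _≟ᵗ_ (target b̄) (just c̄)))
                          (tuples n constraint)

    updatedRel : ∀ {May p a} → UpdateRule auxS suppS May p a Cond →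
                 Tuple n p → (Tuple n a → Bool) → Tuple n a → Bool
    updatedRel ρ p̄ old c̄ with writers ρ p̄ c̄
    ... | []         = old c̄
    ... | bs@(_ ∷ _) = any (λ b̄ → Sem.run locals
                                    (λ s → Sem.evalCond locals s (p̄ ++ᵛ b̄))
                                    (afterInitial ρ p̄) (p̄ ++ᵛ b̄) main) bs
      where open UpdateRule ρ

    updatedFun : ∀ {May p a} → UpdateRule auxS suppS May p a Term →
                 Tuple n p → (Tuple n a → Maybe (Fin n)) → Tuple n a → Maybe (Fin n)
    updatedFun ρ p̄ old c̄ with writers ρ p̄ c̄
    ... | []         = old c̄
    ... | bs@(_ ∷ _) = agreed (map (λ b̄ → Sem.run locals
                                            (λ s → Sem.evalTerm locals s (p̄ ++ᵛ b̄))
                                            (afterInitial ρ p̄) (p̄ ++ᵛ b̄) main) bs)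
      where open UpdateRule ρ

    -- All update rules start from the old auxiliary structure and the old
    -- supplementary instances.
    updatedAux : (δ : Fin (#change S)) → Tuple n (changeAr S δ) → Structure auxS n
    updatedAux δ p̄ = record
      { rel = λ r → updatedRel (updRel δ r) p̄ (rel 𝒜 r)
      ; fun = λ f → updatedFun (updFun δ f) p̄ (fun 𝒜 f)
      }

    updatedInstances : (δ : Fin (#change S)) → Tuple n (changeAr S δ) →
                       ∀ i → Machines.St M i
    updatedInstances δ p̄ i with owner δ i
    ... | nothing       = I i
    ... | just (inj₁ r) = Sem.instances (afterInitial (updRel δ r) p̄) i
    ... | just (inj₂ f) = Sem.instances (afterInitial (updFun δ f) p̄) i

    queryAnswers : Structure (query S) n
    queryAnswers = record
      { rel = λ q p̄ → let open QueryRule (ansRel q) in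
          Sem.run locals (λ s → Sem.evalCond locals s p̄) (start locals) p̄ proc
      ; fun = λ q p̄ → let open QueryRule (ansFun q) in
          Sem.run locals (λ s → Sem.evalTerm locals s p̄) (start locals) p̄ proc
      }

State : ∀ {Π} → Program Π → ℕ → Set
State (program auxS _ Ps _) n = Structure auxS n × (∀ i → State (Ps i) n)

mutual
  machines : ∀ {m} {Πs : Fin m → Problem} (Ps : ∀ i → Program (Πs i)) (n : ℕ) →
             Machines (sig ∘ Πs) n
  machines Ps n = record
    { St      = λ i → State (Ps i) n
    ; answers = λ i → answer (Ps i)
    ; step    = λ i → update (Ps i)
    }

  answer : ∀ {Π} (P : Program Π) {n} → State P n → Structure (query (sig Π)) n
  answer (program _ _ Ps R) {n} (𝒜 , I) = queryAnswers R (machines Ps n) 𝒜 I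

  update : ∀ {Π} (P : Program Π) {n} (δ : Fin (#change (sig Π))) →
           Tuple n (changeAr (sig Π) δ) → State P n → State P n
  update (program _ _ Ps R) {n} δ p̄ (𝒜 , I) =
    updatedAux R (machines Ps n) 𝒜 I δ p̄ , updatedInstances R (machines Ps n) 𝒜 I δ p̄

initialState : ∀ {Π} (P : Program Π) {n} → State P n
initialState (program _ _ Ps R) = initialAux R emptyStructure , λ i → initialState (Ps i)

Changes : Problem → ℕ → Set
Changes Π n = List (Σ[ δ ∈ Fin (#change (sig Π)) ] Tuple n (changeAr (sig Π) δ))

inputAfter : ∀ Π {n} → Changes Π n → Structure (input (sig Π)) n
inputAfter Π = foldl (λ ℐ (δ , p̄) → change Π δ p̄ ℐ) emptyStructure

stateAfter : ∀ {Π} (P : Program Π) {n} → Changes Π n → State P n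
stateAfter P = foldl (λ s (δ , p̄) → update P δ p̄ s) (initialState P)

AnswersCorrectly : ∀ {Π} → Program Π → Set
AnswersCorrectly {Π} P = ∀ {n} (α : Changes Π n) →
  (∀ q ā → T (rel (answer P (stateAfter P α)) q ā) ⇔ relQuery Π (inputAfter Π α) q ā) ×
  (∀ q ā → fun (answer P (stateAfter P α)) q ā ≡ funQuery Π (inputAfter Π α) q ā)

-- The programs of the supplementary instances have to be correct as well.
Maintains : ∀ {Π} → Program Π → Set
Maintains P@(program _ _ Ps _) = AnswersCorrectly P × (∀ i → Maintains (Ps i))

record Costs (S : Signature) : Set where
  field
    relCost    : Fin (#rel (query S)) → ℕ
    funCost    : Fin (#fun (query S)) → ℕ
    changeCost : Fin (#change S) → ℕ

-- The factor for z ≤ g(n) is g(n).  If g(n) = 0 then z still ranges over {0}, so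
-- the factor has to be 1: otherwise vacuous binders would hide any amount of work.
factor : ℕ → Bound → ℕ
factor n g = 1 ⊔ value g n

factors : ℕ → ∀ {ℓ} → Vec Bound ℓ → ℕ
factors n []       = 1
factors n (g ∷ gs) = factor n g * factors n gs

maxFin : ∀ {m} → (Fin m → ℕ) → ℕ
maxFin {zero}  h = 0
maxFin {suc m} h = h zero ⊔ maxFin (λ i → h (suc i))

module Work {V : Vocabulary} (costs : ∀ i → Costs (supp V i)) (n : ℕ) where
  mutual
    workTerm : ∀ {k} → Term V k → ℕ
    workTerm (var x)           = 1
    workTerm (auxFun f ts)     = 1 ⊔ workTerms ts
    workTerm (locFun f ts)     = 1 ⊔ workTerms ts
    workTerm (t ⊕ u)           = 1 ⊔ (workTerm t ⊔ workTerm u)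
    workTerm (t ⊗ u)           = 1 ⊔ (workTerm t ⊔ workTerm u)
    workTerm (ite c t u)       = 1 ⊔ (workCond c ⊔ (workTerm t ⊔ workTerm u))
    workTerm (queryFun i q ts) = Costs.funCost (costs i) q ⊔ workTerms ts
    workTerm (getUnique g c)   = factor n g * workCond c

    workTerms : ∀ {k a} → Vec (Term V k) a → ℕ
    workTerms []       = 0
    workTerms (t ∷ ts) = workTerm t ⊔ workTerms ts

    workCond : ∀ {k} → Cond V k → ℕ
    workCond (auxRel r ts)     = 1 ⊔ workTerms ts
    workCond (locRel r ts)     = 1 ⊔ workTerms ts
    workCond (t ≐ u)           = 1 ⊔ (workTerm t ⊔ workTerm u)
    workCond (t ≼ u)           = 1 ⊔ (workTerm t ⊔ workTerm u)
    workCond ⊤′                = 1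
    workCond (¬′ c)            = 1 ⊔ workCond c
    workCond (c ∧′ d)          = 1 ⊔ (workCond c ⊔ workCond d)
    workCond (c ∨′ d)          = 1 ⊔ (workCond c ⊔ workCond d)
    workCond (queryRel i q ts) = Costs.relCost (costs i) q ⊔ workTerms ts
    workCond (exists g c)      = factor n g * workCond c

  workStmt : ∀ {k May par} → Stmt V May k par → ℕ
  workStmt skip                = 1
  workStmt (assignFun _ _ _ t) = workTerm t
  workStmt (assignRel _ _ _ c) = workCond c
  workStmt (P ⨾ Q)             = 1 ⊔ (workStmt P ⊔ workStmt Q)
  workStmt (branch c P Q)      = 1 ⊔ (workCond c ⊔ (workStmt P ⊔ workStmt Q))
  workStmt (pardo g P)         = factor n g * workStmt P
  workStmt (invoke i _ δ ts)   = Costs.changeCost (costs i) δ ⊔ workTerms ts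

  workProc : ∀ {k} {Ret : Set} → (Ret → ℕ) → Proc V k Ret → ℕ
  workProc w (return r)     = w r
  workProc w (P ⨾ Q)        = 1 ⊔ (workStmt P ⊔ workProc w Q)
  workProc w (branch c P Q) = 1 ⊔ (workCond c ⊔ (workProc w P ⊔ workProc w Q))

module _ {S : Signature} {m} {auxS : Schema} {suppS : Fin m → Signature}
         (R : Rules S auxS suppS) (costs : ∀ i → Costs (suppS i)) (n : ℕ) where
  open Rules R

  private
    module W (L : Schema) = Work {V = vocabulary auxS L suppS} costs n

  workUpdate : ∀ {May p a} {Ret : Vocabulary → ℕ → Set} →
               (∀ L {k} → Ret (vocabulary auxS L suppS) k → ℕ) →
               UpdateRule auxS suppS May p a Ret → ℕ
  workUpdate w ρ =
    W.workStmt locals initial ⊔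
    factors n constraint * (W.workProc locals (w locals) main ⊔ W.workTerms ∅ at)
    where open UpdateRule ρ

  workUpdRel : ∀ δ (r : Fin (#rel auxS)) → ℕ
  workUpdRel δ r = workUpdate W.workCond (updRel δ r)

  workUpdFun : ∀ δ (f : Fin (#fun auxS)) → ℕ
  workUpdFun δ f = workUpdate W.workTerm (updFun δ f)

  workAnsRel : Fin (#rel (query S)) → ℕ
  workAnsRel q = W.workProc locals (W.workCond locals) proc
    where open QueryRule (ansRel q)

  workAnsFun : Fin (#fun (query S)) → ℕ
  workAnsFun q = W.workProc locals (W.workTerm locals) proc
    where open QueryRule (ansFun q)

  rulesCosts : Costs S
  rulesCosts = record
    { relCost    = workAnsRel
    ; funCost    = workAnsFun
    ; changeCost = λ δ → maxFin (workUpdRel δ) ⊔ maxFin (workUpdFun δ)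
    }

programCosts : ∀ {Π} → Program Π → ℕ → Costs (sig Π)
programCosts (program _ _ Ps R) n = rulesCosts R (λ i → programCosts (Ps i) n) n

_∈𝒪_ : (ℕ → ℕ) → (ℕ → ℕ) → Set
h ∈𝒪 f = ∃[ c ] ∃[ n₀ ] ∀ n → n₀ ≤ n → h n ≤ c * f n

HasWork : ∀ {Π} → Program Π → (ℕ → ℕ) → Set
HasWork (program _ _ Ps R) f =
  (∀ δ r → (λ n → workUpdRel R (suppCosts n) n δ r) ∈𝒪 f) ×
  (∀ δ g → (λ n → workUpdFun R (suppCosts n) n δ g) ∈𝒪 f) ×
  (∀ q → (λ n → workAnsRel R (suppCosts n) n q) ∈𝒪 f) ×
  (∀ q → (λ n → workAnsFun R (suppCosts n) n q) ∈𝒪 f)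
  where
  suppCosts : ∀ n i → Costs _
  suppCosts n i = programCosts (Ps i) n

DynFO-with-work-𝒪 : Problem → (ℕ → ℕ) → Set₁
DynFO-with-work-𝒪 Π f = Σ[ P ∈ Program Π ] (Maintains P × HasWork P f)

Language : ℕ → Set₁
Language s = List (Fin s) → Set

wordSchema : ℕ → Schema
wordSchema s = record { #rel = s ; #fun = 0 ; relAr = λ _ → 1 ; funAr = λ () }

-- At most one relation contains i, in every structure reachable by changes.
letters : ∀ {s n} → Structure (wordSchema s) n → Fin n → List (Fin s)
letters {s} 𝓌 i = filterᵇ (λ σ → rel 𝓌 σ (i ∷ [])) (allFin s)

word : ∀ {s n} → Structure (wordSchema s) n → List (Fin s)
word {n = n} 𝓌 = concatMap (letters 𝓌) (allFin n)

setLetter : ∀ {s n} → Fin s → Fin n → Structure (wordSchema s) n → Structure (wordSchema s) n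
setLetter σ i 𝓌 with letters 𝓌 i
... | []    = setRel σ (i ∷ []) true 𝓌
... | _ ∷ _ = 𝓌

resetLetter : ∀ {s n} → Fin n → Structure (wordSchema s) n → Structure (wordSchema s) n
resetLetter i 𝓌 = record 𝓌 { rel = λ σ ā → not (does (ā ≟ᵗ (i ∷ []))) ∧ rel 𝓌 σ ā }

memberSignature : ℕ → Signature
memberSignature s = record
  { input    = wordSchema s
  ; #change  = suc s
  ; changeAr = λ _ → 1
  ; query    = record { #rel = 1 ; #fun = 0 ; relAr = λ _ → 0 ; funAr = λ () }
  }

-- Change 0 is reset, change suc σ is set_σ.
Member : ∀ {s} → Language s → Problem
Member {s} L = record
  { sig      = memberSignature s
  ; change   = λ { zero (i ∷ []) → resetLetter i ; (suc σ) (i ∷ []) → setLetter σ i }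
  ; relQuery = λ 𝓌 _ _ → L (word 𝓌)
  ; funQuery = λ _ ()
  }

opening closing : Fin 2
opening = zero
closing = suc zero

data D₁ : Language 2 where
  empty  : D₁ []
  wrap   : ∀ {u} → D₁ u → D₁ (opening ∷ u ++ closing ∷ [])
  concat : ∀ {u v} → D₁ u → D₁ v → D₁ (u ++ v)

{-# OPTIONS --safe #-}

-- The positions are the leaves of a tree whose blocks of level j have length lcm(1, …, j + 1).
-- The start of the block of level j around x is the greatest y ≤ x divisible by 1, …, j + 1, so
-- the tree is first-order definable without exponentiation.  A block of level j has at most
-- j + 1 children, and lcm(1, …, 2x + 1) ≥ 2ˣ bounds the height k of the tree by O(log n).
--
-- For each block, store by how much the height of the word drops below its value at the start
-- of the block, and the numbers of ⟨ and ⟩ between the start of the parent block and its own.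
-- A change at i shifts all heights after i by one.  So the counts change for the right siblings
-- of the blocks around i only, and the minimum over a block around i moves with the shift iff the
-- block has no minimum at a position ≤ i (upward shift) or has one at a position > i (downward
-- shift).  Such a minimum exists iff it lies in a child beside the path of some block of level
-- l ≤ j around i, and every block around i between the levels l and j attains the minimum of its
-- parent.  For each j this is a search over l and, for each l, over siblings and levels: k³ work.

module Submission where

open import Data.Bool.Base using (Bool; true; false; T; not; _∧_; _∨_; if_then_else_)
open import Data.Bool.ListAction using (any; all)
open import Data.Bool.Properties using (T-∧; T-∨; T-≡; T?; ∨-identityʳ; ∨-zeroʳ)
open import Data.Empty using (⊥; ⊥-elim)
open import Data.Fin.Base using (Fin; zero; suc; toℕ; fromℕ<)
open import Data.Fin.Properties using (toℕ-injective; toℕ<n; toℕ-fromℕ<; fromℕ<-toℕ; _≟_)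
open import Data.List.Base using (List; []; _∷_; _++_; map; concatMap; filterᵇ; allFin; foldl; tabulate)
open import Data.List.Membership.Propositional using (_∈_; find; lose)
open import Data.List.Membership.Propositional.Properties using (∈-filter⁺; ∈-filter⁻; ∈-allFin; ∈-concatMap⁺; ∈-map⁺)
open import Data.List.Properties using (++-assoc; ++-identityʳ)
open import Data.List.Relation.Unary.All as All using (All; []; _∷_)
open import Data.List.Relation.Unary.All.Properties as Allₚ using (all⁺; all⁻)
open import Data.List.Relation.Unary.AllPairs.Core using (_∷_)
open import Data.List.Relation.Unary.Any using (here; there)
open import Data.List.Relation.Unary.Any.Properties using (any⁺; any⁻)
open import Data.List.Relation.Unary.Unique.Propositional using (Unique)
open import Data.List.Relation.Unary.Unique.Propositional.Properties using (filter⁺; allFin⁺)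
open import Data.Maybe.Base using (Maybe; just; nothing; zipWith)
import Data.Maybe.Properties as Maybeₚ
open import Data.Nat.Base
  using (ℕ; zero; suc; _+_; _*_; _∸_; _^_; _⊔_; _≤_; _<_; _≤ᵇ_; z≤n; s≤s; ⌊_/2⌋; NonZero; ≢-nonZero; ≢-nonZero⁻¹)
open import Data.Nat.Divisibility
  using (_∣_; divides; ∣-refl; ∣-trans; ∣⇒≤; 1∣_; m∣m*n; n∣m*n; 0∣⇒≡0; ∣m+n∣m⇒∣n; ∣m∣n⇒∣m+n)
open import Data.Nat.DivMod using (_/_; _%_; m≡m%n+[m/n]*n; m%n<n; m/n*n≤m; m/n*n≡m; /-monoˡ-≤; m<n⇒m/n≡0)
open import Data.Nat.LCM using (lcm; m∣lcm[m,n]; n∣lcm[m,n]; lcm-least)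
open import Data.Nat.Logarithm using (⌊log₂_⌋; ⌊log₂⌋-mono-≤; ⌊log₂[2^n]⌋≡n)
open import Data.Nat.Properties as Nat hiding (_≟_)
open import Data.Nat.Tactic.RingSolver using (solve-∀)
open import Data.Product.Base using (∃-syntax; _×_; _,_; proj₁; proj₂)
open import Data.Sum.Base as Sum using (_⊎_; inj₁; inj₂)
open import Data.Unit.Base using (⊤; tt)
open import Data.Vec.Base using (Vec; []; _∷_; lookup) renaming (_++_ to _++ᵛ_)
open import Function.Base using (_∘_; id; case_of_)
open import Function.Bundles using (_⇔_; mk⇔; Equivalence)
open import Relation.Binary.PropositionalEquality
  using (_≡_; _≢_; refl; sym; trans; cong; cong₂; subst; subst₂; module ≡-Reasoning)
open import Relation.Nullary.Decidable using (dec-true; dec-false)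
open import Relation.Nullary.Decidable.Core using (Dec; yes; no; does)
open import Relation.Nullary.Negation.Core using (¬_; contradiction)
open import Defs

-- Every stored or intermediate number has to be an element of the domain: sums and products outside
-- it are undefined and make atoms false. This shapes the arithmetic. Minima are kept relative to
-- the starts of blocks. Whether a child attains the minimum of its parent is tested by an equation
-- between two sums without subtraction, and both sums are shown to stay below `n`. The global
-- letter counts leave out position 0, since a count over all positions could be `n`. The length of
-- a procedure does not depend on `n`, and no result can be handed from level to level. So the
-- recursion along the path around `i` is unrolled into a search for the level at which it stops.
-- One bound, `height n`, serves for levels and for indices of children, because the children of a
-- block of level `q` have indices at most `q`. Blocks contain the heights of the prefixes shorter
-- than `n` only; the height of the whole word is checked through the letter counts. The lower bound
-- on the lcm is Nair's argument.

-- Block lengths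

-- C⁺ x i is the binomial coefficient x + i over x.
C⁺ : ℕ → ℕ → ℕ
C⁺ zero    i       = 1
C⁺ (suc x) zero    = 1
C⁺ (suc x) (suc i) = C⁺ x (suc i) + C⁺ (suc x) i

mutual
  -- The absorption identities of binomial coefficients, here and in `C⁺-absorbˡ`, are mirror
  -- images. Pascal's rule proves the one from smaller instances of both, hence the mutual
  -- induction.
  C⁺-absorbʳ : ∀ x i → suc i * C⁺ x (suc i) ≡ suc (x + i) * C⁺ x i
  C⁺-absorbʳ zero    i    = refl
  C⁺-absorbʳ (suc x) zero = begin
    1 * (C⁺ x 1 + 1)          ≡⟨ *-identityˡ _ ⟩
    C⁺ x 1 + 1                ≡⟨ cong (_+ 1) (sym (*-identityˡ _)) ⟩
    1 * C⁺ x 1 + 1            ≡⟨ cong (_+ 1) (C⁺-absorbʳ x 0) ⟩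
    suc (x + 0) * C⁺ x 0 + 1  ≡⟨ cong (λ z → suc (x + 0) * z + 1) (C⁺-zero x) ⟩
    suc (x + 0) * 1 + 1       ≡⟨ cong (_+ 1) (*-identityʳ (suc (x + 0))) ⟩
    suc (x + 0) + 1           ≡⟨ +-comm (suc (x + 0)) 1 ⟩
    suc (suc x + 0)           ≡⟨ sym (*-identityʳ _) ⟩
    suc (suc x + 0) * 1       ∎
    where open ≡-Reasoning
  C⁺-absorbʳ (suc x) (suc i) = begin
    suc (suc i) * (C⁺ x (suc (suc i)) + C⁺ (suc x) (suc i))
      ≡⟨ *-distribˡ-+ (suc (suc i)) (C⁺ x (suc (suc i))) _ ⟩
    suc (suc i) * C⁺ x (suc (suc i)) + suc (suc i) * C⁺ (suc x) (suc i)
      ≡⟨ cong (_+ suc (suc i) * C⁺ (suc x) (suc i)) (C⁺-absorbʳ x (suc i)) ⟩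
    suc (x + suc i) * C⁺ x (suc i) + suc (suc i) * C⁺ (suc x) (suc i)
      ≡⟨ cong (_+ suc (suc i) * C⁺ (suc x) (suc i)) (sym (C⁺-absorbˡ x (suc i))) ⟩
    suc x * C⁺ (suc x) (suc i) + suc (suc i) * C⁺ (suc x) (suc i)
      ≡⟨ sym (*-distribʳ-+ (C⁺ (suc x) (suc i)) (suc x) (suc (suc i))) ⟩
    (suc x + suc (suc i)) * C⁺ (suc x) (suc i)
      ≡⟨ cong (_* C⁺ (suc x) (suc i)) (cong suc (+-suc x (suc i))) ⟩
    suc (suc x + suc i) * C⁺ (suc x) (suc i) ∎
    where open ≡-Reasoning

  C⁺-absorbˡ : ∀ x i → suc x * C⁺ (suc x) i ≡ suc (x + i) * C⁺ x i
  C⁺-absorbˡ x zero = cong₂ _*_ (cong suc (sym (+-identityʳ x))) (sym (C⁺-zero x))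
  C⁺-absorbˡ x (suc i) = begin
    suc x * (C⁺ x (suc i) + C⁺ (suc x) i)
      ≡⟨ *-distribˡ-+ (suc x) (C⁺ x (suc i)) _ ⟩
    suc x * C⁺ x (suc i) + suc x * C⁺ (suc x) i
      ≡⟨ cong (suc x * C⁺ x (suc i) +_) (trans (C⁺-absorbˡ x i) (sym (C⁺-absorbʳ x i))) ⟩
    suc x * C⁺ x (suc i) + suc i * C⁺ x (suc i)
      ≡⟨ sym (*-distribʳ-+ (C⁺ x (suc i)) (suc x) (suc i)) ⟩
    suc (x + suc i) * C⁺ x (suc i) ∎
    where open ≡-Reasoning

  C⁺-zero : ∀ x → C⁺ x 0 ≡ 1
  C⁺-zero zero    = refl
  C⁺-zero (suc x) = refl

-- Pascal's rule splits a central coefficient into two terms, each at least the previous central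
-- coefficient.
2^x≤C⁺ : ∀ x → 2 ^ x ≤ C⁺ x x
2^x≤C⁺ zero    = ≤-refl
2^x≤C⁺ (suc x) = begin
  2 * 2 ^ x                      ≤⟨ *-monoʳ-≤ 2 (2^x≤C⁺ x) ⟩
  2 * C⁺ x x                     ≡⟨ cong (C⁺ x x +_) (+-identityʳ _) ⟩
  C⁺ x x + C⁺ x x                ≤⟨ +-mono-≤ (C⁺-step₂ x x) (C⁺-step₁ x x) ⟩
  C⁺ x (suc x) + C⁺ (suc x) x    ∎
  where
  open ≤-Reasoning
  C⁺-step₁ : ∀ x i → C⁺ x i ≤ C⁺ (suc x) i
  C⁺-step₁ x zero    = ≤-reflexive (C⁺-zero x)
  C⁺-step₁ x (suc i) = m≤m+n _ _
  C⁺-step₂ : ∀ x i → C⁺ x i ≤ C⁺ x (suc i)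
  C⁺-step₂ zero    i = ≤-refl
  C⁺-step₂ (suc x) i = m≤n+m _ _

-- 1 / (s C⁺ x i) with s = x + i + 1 is the beta integral ∫ tˣ (1 - t)ⁱ dt, and
-- t + (1 - t) = 1 gives 1 / G x i = 1 / G (x + 1) i + 1 / G x (i + 1).
G : ℕ → ℕ → ℕ
G x i = suc (x + i) * C⁺ x i

G∣common-multiple : ∀ x i {M} → (∀ t → t ≤ x + i → suc t ∣ M) → G x i ∣ M
G∣common-multiple zero    i {M} div = subst (_∣ M) (sym (*-identityʳ (suc i))) (div i ≤-refl)
G∣common-multiple (suc x) i {M} div
  with divides a M≡ag ← G∣common-multiple x i (λ t t≤ → div t (m≤n⇒m≤1+n t≤))
  with divides b M≡bg′ ← G∣common-multiple x (suc i) (λ t t≤ → div t (≤-trans t≤ (≤-reflexive (+-suc x i))))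
  -- `a` and `b` are the quotients of `M` by `G x i` and `G x (suc i)`, so the identity for
  -- reciprocals, multiplied by `M`, makes `a ∸ b` the quotient by `G (suc x) i`. The extra factor
  -- `suc x` lets the absorption identities apply without division.
  = divides (a ∸ b) (*-cancelˡ-≡ M _ (suc x) (sym (begin
    suc x * ((a ∸ b) * G (suc x) i)        ≡⟨ shuffle (suc x) (a ∸ b) (suc (suc x + i)) (C⁺ (suc x) i) ⟩
    (a ∸ b) * (s * (suc x * C⁺ (suc x) i)) ≡⟨ cong (λ z → (a ∸ b) * (s * z)) (C⁺-absorbˡ x i) ⟩
    (a ∸ b) * (s * g)                      ≡⟨ *-distribʳ-∸ (s * g) a b ⟩
    a * (s * g) ∸ b * (s * g)              ≡⟨ cong₂ _∸_ ag bg ⟩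
    s * M ∸ suc i * M                      ≡⟨ sym (*-distribʳ-∸ M s (suc i)) ⟩
    (s ∸ suc i) * M                        ≡⟨ cong (_* M) (trans (cong (_∸ suc i) (sym (+-suc (suc x) i))) (m+n∸n≡m (suc x) (suc i))) ⟩
    suc x * M                              ∎)))
  where
  open ≡-Reasoning
  s = suc (suc x + i)
  g = G x i
  shuffle : ∀ p q r t → p * (q * (r * t)) ≡ q * (r * (p * t))
  shuffle = solve-∀
  swap : ∀ p q r → p * (q * r) ≡ q * (p * r)
  swap = solve-∀
  ag : a * (s * g) ≡ s * M
  ag = trans (swap a s g) (cong (s *_) (sym M≡ag))
  bg : b * (s * g) ≡ suc i * M
  bg = begin
    b * (s * g)                                   ≡⟨ cong (λ z → b * (s * z)) (sym (C⁺-absorbʳ x i)) ⟩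
    b * (s * (suc i * C⁺ x (suc i)))              ≡⟨ sym (shuffle (suc i) b s (C⁺ x (suc i))) ⟩
    suc i * (b * (s * C⁺ x (suc i)))              ≡⟨ cong (λ z → suc i * (b * (z * C⁺ x (suc i)))) (cong suc (sym (+-suc x i))) ⟩
    suc i * (b * G x (suc i))                     ≡⟨ cong (suc i *_) (sym M≡bg′) ⟩
    suc i * M                                     ∎

2^x≤common-multiple : ∀ x {M} .{{_ : NonZero M}} → (∀ t → t ≤ x + x → suc t ∣ M) → 2 ^ x ≤ M
2^x≤common-multiple x {M} div = begin
  2 ^ x                ≤⟨ 2^x≤C⁺ x ⟩
  C⁺ x x               ≤⟨ m≤m+n _ _ ⟩
  G x x                ≤⟨ ∣⇒≤ (G∣common-multiple x x div) ⟩
  M                    ∎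
  where open ≤-Reasoning

-- len j is the least common multiple of 1, …, j + 1.
opaque
  len : ℕ → ℕ
  len zero    = 1
  len (suc j) = lcm (len j) (2 + j)

  len-zero : len 0 ≡ 1
  len-zero = refl

  len∣len-suc : ∀ j → len j ∣ len (suc j)
  len∣len-suc j = m∣lcm[m,n] (len j) (2 + j)

  suc∣len : ∀ j t → t ≤ j → suc t ∣ len j
  suc∣len zero    zero z≤n = ∣-refl
  suc∣len (suc j) t t≤j with m≤n⇒m<n∨m≡n t≤j
  ... | inj₁ (s≤s t≤j′) = ∣-trans (suc∣len j t t≤j′) (len∣len-suc j)
  ... | inj₂ refl       = n∣lcm[m,n] (len j) (2 + j)

  len-least : ∀ j {y} → (∀ t → t ≤ j → suc t ∣ y) → len j ∣ y
  len-least zero    div = 1∣ _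
  len-least (suc j) div = lcm-least (len-least j (λ t t≤j → div t (m≤n⇒m≤1+n t≤j))) (div (suc j) ≤-refl)

  -- Bounds the branching: a block of level `suc j` splits into at most `j + 2` blocks of level `j`.
  len-suc∣ : ∀ j → len (suc j) ∣ len j * (2 + j)
  len-suc∣ j = lcm-least {len j} {2 + j} (m∣m*n {len j} (2 + j)) (n∣m*n (len j) {2 + j})

  len≢0 : ∀ j → NonZero (len j)
  len≢0 zero    = _
  len≢0 (suc j) = ≢-nonZero λ eq →
    ≢-nonZero⁻¹ (len j * (2 + j)) {{m*n≢0 (len j) (2 + j) {{len≢0 j}}}} (0∣⇒≡0 (subst (_∣ len j * (2 + j)) eq (len-suc∣ j)))

instance
  len-nonZero : ∀ {j} → NonZero (len j)
  len-nonZero {j} = len≢0 j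

len-suc≤ : ∀ j → len (suc j) ≤ len j * (2 + j)
len-suc≤ j = ∣⇒≤ {{m*n≢0 (len j) (2 + j) {{len-nonZero {j}}}}} (len-suc∣ j)

-- Crude, but enough for the search for the height to succeed within `n` steps and for the height to
-- lie in the domain.
j<len : ∀ j → j < len j
j<len j = ∣⇒≤ (suc∣len j j ≤-refl)

-- Starts of blocks and their children

opaque
  -- Division is confined to this opaque block. Nesting and convexity of blocks follow from
  -- `st-greatest`, which is also the property that a first-order formula can state.
  st : ℕ → ℕ → ℕ
  st j x = x / len j * len j

  len∣st : ∀ j x → len j ∣ st j x
  len∣st j x = n∣m*n (x / len j)

  st≤ : ∀ j x → st j x ≤ x
  st≤ j x = m/n*n≤m x (len j)

  <st+len : ∀ j x → x < st j x + len j
  <st+len j x = begin-strict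
    x                       ≡⟨ m≡m%n+[m/n]*n x (len j) ⟩
    x % len j + st j x      <⟨ +-monoˡ-< (st j x) (m%n<n x (len j)) ⟩
    len j + st j x          ≡⟨ +-comm (len j) _ ⟩
    st j x + len j          ∎
    where open ≤-Reasoning

  st-greatest : ∀ j {x y} → len j ∣ y → y ≤ x → y ≤ st j x
  st-greatest j {x} {y} d y≤x = begin
    y                    ≡⟨ sym (m/n*n≡m d) ⟩
    y / len j * len j    ≤⟨ *-monoˡ-≤ (len j) (/-monoˡ-≤ (len j) y≤x) ⟩
    st j x               ∎
    where open ≤-Reasoning

  st-small : ∀ j {x} → x < len j → st j x ≡ 0
  st-small j x<len = cong (_* len j) (m<n⇒m/n≡0 x<len)

st-mono : ∀ j {x y} → x ≤ y → st j x ≤ st j y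
st-mono j x≤y = st-greatest j (len∣st j _) (≤-trans (st≤ j _) x≤y)

st-fixed : ∀ j {y} → len j ∣ y → st j y ≡ y
st-fixed j {y} d = ≤-antisym (st≤ j y) (st-greatest j d ≤-refl)

st-idem : ∀ j x → st j (st j x) ≡ st j x
st-idem j x = st-fixed j (len∣st j x)

-- Blocks are nested: `len r` divides `len (suc r)`, so no parent starts strictly inside a child.
st-st : ∀ r x → st (suc r) (st r x) ≡ st (suc r) x
st-st r x = ≤-antisym (st-mono (suc r) (st≤ r x))
  (st-greatest (suc r) (len∣st (suc r) x) (st-greatest r (∣-trans (len∣len-suc r) (len∣st (suc r) x)) (st≤ (suc r) x)))

st-zero : ∀ x → st 0 x ≡ x
st-zero x = st-fixed 0 (subst (_∣ x) (sym len-zero) (1∣ x))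

st-squeeze : ∀ j {s x y} → st j y ≡ s → s ≤ x → x ≤ y → st j x ≡ s
st-squeeze j {s} {x} {y} refl s≤x x≤y =
  ≤-antisym (st-mono j x≤y) (st-greatest j (len∣st j y) s≤x)

-- This is how a program names siblings: by their index `c` in the parent. As `c ≤ suc r`, the bound
-- on the levels also bounds the indices.
child-offset : ∀ r {u} → st r u ≡ u → ∃[ c ] c ≤ suc r × st (suc r) u + c * len r ≡ u
child-offset r {u} fix = c , ≤-pred (*-cancelʳ-< (len r) c (2 + r) c*len<) , v+c*len≡u
  where
  v = st (suc r) u
  len∣u∸v : len r ∣ u ∸ v
  len∣u∸v = ∣-∸ (st≤ (suc r) u) (subst (len r ∣_) fix (len∣st r u))
                        (∣-trans (len∣len-suc r) (len∣st (suc r) u))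
    where
    ∣-∸ : ∀ {d m n} → n ≤ m → d ∣ m → d ∣ n → d ∣ m ∸ n
    ∣-∸ {d} n≤m d∣m d∣n = ∣m+n∣m⇒∣n (subst (d ∣_) (sym (m+[n∸m]≡n n≤m)) d∣m) d∣n
  c = _∣_.quotient len∣u∸v
  v+c*len≡u : v + c * len r ≡ u
  v+c*len≡u = trans (cong (v +_) (sym (_∣_.equality len∣u∸v))) (m+[n∸m]≡n (st≤ (suc r) u))
  open ≤-Reasoning
  c*len< : c * len r < (2 + r) * len r
  c*len< = begin-strict
    c * len r          <⟨ +-cancelˡ-< v _ _ (subst (_< v + len (suc r)) (sym v+c*len≡u) (<st+len (suc r) u)) ⟩
    len (suc r)        ≤⟨ len-suc≤ r ⟩
    len r * (2 + r)    ≡⟨ *-comm (len r) _ ⟩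
    (2 + r) * len r    ∎

-- Height of the tree

leastFrom : ℕ → ℕ → ℕ → ℕ
leastFrom n zero       j = j
leastFrom n (suc fuel) j with n ≤? len j
... | yes _ = j
... | no  _ = leastFrom n fuel (suc j)

leastFrom-bound : ∀ n fuel j → n ≤ len (fuel + j) → n ≤ len (leastFrom n fuel j)
leastFrom-bound n zero       j n≤ = n≤
leastFrom-bound n (suc fuel) j n≤ with n ≤? len j
... | yes p = p
... | no  _ = leastFrom-bound n fuel (suc j) (subst (λ z → n ≤ len z) (sym (+-suc fuel j)) n≤)

leastFrom-minimal : ∀ n fuel j → (∀ {i} → i < j → len i < n) → ∀ {i} → i < leastFrom n fuel j → len i < n
leastFrom-minimal n zero       j below = below
leastFrom-minimal n (suc fuel) j below with n ≤? len j
... | yes p = below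
... | no  ¬p = leastFrom-minimal n fuel (suc j) below′
  where
  below′ : ∀ {i} → i < suc j → len i < n
  below′ (s≤s i≤j) with m≤n⇒m<n∨m≡n i≤j
  ... | inj₁ i<j  = below i<j
  ... | inj₂ refl = ≰⇒> ¬p

-- The least level whose blocks contain all positions.
height : ℕ → ℕ
height n = leastFrom n n 0

n≤len-height : ∀ n → n ≤ len (height n)
n≤len-height n = leastFrom-bound n n 0 (subst (λ z → n ≤ len z) (sym (+-identityʳ n)) (<⇒≤ (j<len n)))

len<n : ∀ {n i} → i < height n → len i < n
len<n {n} = leastFrom-minimal n n 0 (λ ())

-- Makes the top level an element of the domain, so that the query can name the root.
height<n : ∀ {n} → 0 < n → height n < n
height<n {n} 0<n with height n in eq
... | zero  = 0<n
... | suc h = ≤-<-trans (j<len h) (len<n {n} (subst (h <_) (sym eq) ≤-refl))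

-- For the level `h` below the top, minimality gives `len h < n`, and `len h` is a common multiple
-- of `1, …, 2⌊h/2⌋ + 1`.
height≤log : ∀ n → height n ≤ 2 * ⌊log₂ n ⌋ + 2
height≤log n with height n in eq
... | zero  = z≤n
... | suc h = begin
    suc h                       ≤⟨ s≤s (h≤ h) ⟩
    2 + (⌊ h /2⌋ + ⌊ h /2⌋)     ≡⟨ +-comm 2 _ ⟩
    ⌊ h /2⌋ + ⌊ h /2⌋ + 2       ≡⟨ cong (λ z → ⌊ h /2⌋ + z + 2) (sym (+-identityʳ ⌊ h /2⌋)) ⟩
    2 * ⌊ h /2⌋ + 2             ≤⟨ +-monoˡ-≤ 2 (*-monoʳ-≤ 2 ⌊h/2⌋≤) ⟩
    2 * ⌊log₂ n ⌋ + 2           ∎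
  where
  open ≤-Reasoning
  h≤ : ∀ h → h ≤ suc (⌊ h /2⌋ + ⌊ h /2⌋)
  h≤ zero          = z≤n
  h≤ (suc zero)    = s≤s z≤n
  h≤ (suc (suc h)) = s≤s (s≤s (≤-trans (h≤ h) (≤-reflexive (sym (+-suc _ _)))))
  half+half≤ : ∀ h → ⌊ h /2⌋ + ⌊ h /2⌋ ≤ h
  half+half≤ h = ≤-trans (+-monoʳ-≤ ⌊ h /2⌋ (⌊n/2⌋≤⌈n/2⌉ h)) (≤-reflexive (⌊n/2⌋+⌈n/2⌉≡n h))
  2^≤ : 2 ^ ⌊ h /2⌋ ≤ len h
  2^≤ = 2^x≤common-multiple ⌊ h /2⌋ (λ t t≤ → suc∣len h t (≤-trans t≤ (half+half≤ h)))
  ⌊h/2⌋≤ : ⌊ h /2⌋ ≤ ⌊log₂ n ⌋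
  ⌊h/2⌋≤ = subst (_≤ ⌊log₂ n ⌋) (⌊log₂[2^n]⌋≡n ⌊ h /2⌋)
    (⌊log₂⌋-mono-≤ (≤-trans 2^≤ (<⇒≤ (len<n {n} (subst (h <_) (sym eq) ≤-refl)))))

-- First-order formulas

infix 4 _↦_

-- Definedness and value in one statement; the value is a natural number, so that arithmetic happens
-- in ℕ.
_↦_ : ∀ {n} → Maybe (Fin n) → ℕ → Set
x ↦ m = ∃[ v ] x ≡ just v × toℕ v ≡ m

to : ∀ {A B : Set} → A ⇔ B → A → B
to = Equivalence.to

from : ∀ {A B : Set} → A ⇔ B → B → A
from = Equivalence.from

infixr 2 _∧-⇔_
infixr 1 _∨-⇔_

_∧-⇔_ : ∀ {b c P Q} → T b ⇔ P → T c ⇔ Q → T (b ∧ c) ⇔ (P × Q)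
p ∧-⇔ q = mk⇔ (λ t → let (x , y) = to T-∧ t in to p x , to q y)
              (λ (x , y) → from T-∧ (from p x , from q y))

_∨-⇔_ : ∀ {b c P Q} → T b ⇔ P → T c ⇔ Q → T (b ∨ c) ⇔ (P ⊎ Q)
p ∨-⇔ q = mk⇔ (λ t → Sum.map (to p) (to q) (to T-∨ t))
              (λ s → from T-∨ (Sum.map (from p) (from q) s))

T-not : ∀ {b} → T (not b) ⇔ (¬ T b)
T-not {true}  = mk⇔ (λ ()) (λ ¬t → ¬t _)
T-not {false} = mk⇔ (λ _ ()) (λ _ → tt)

¬-⇔ : ∀ {b P} → T b ⇔ P → T (not b) ⇔ (¬ P)
¬-⇔ p = mk⇔ (λ t x → to T-not t (from p x)) (λ ¬x → from T-not (¬x ∘ to p))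

decide : ∀ {b} {P : Set} → T b ⇔ P → Dec P
decide {true}  p = yes (to p _)
decide {false} p = no (from p)

if-⇔ : ∀ {b} {P A : Set} {x y : A} (Q : A → Set) → T b ⇔ P →
       (P → Q x) → (¬ P → Q y) → Q (if b then x else y)
if-⇔ {true}  Q p f g = f (to p _)
if-⇔ {false} Q p f g = g (from p)

any-⇔ : ∀ {A : Set} {f : A → Bool} {xs : List A} {R P : A → Set} →
        (∀ z → z ∈ xs ⇔ R z) → (∀ z → R z → T (f z) ⇔ P z) →
        T (any f xs) ⇔ (∃[ z ] R z × P z)
any-⇔ {f = f} {xs} r p = mk⇔
  (λ t → let (z , z∈ , fz) = find (any⁻ f xs t); rz = to (r z) z∈ in z , rz , to (p z rz) fz)
  (λ (z , rz , pz) → any⁺ f (lose (from (r z) rz) (from (p z rz) pz)))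

∃-⇔ : ∀ {n} {f : Fin n → Bool} {P : Fin n → Set} →
      (∀ z → T (f z) ⇔ P z) → T (any f (allFin n)) ⇔ (∃[ z ] P z)
∃-⇔ p = mk⇔ (λ t → let (z , _ , pz) = to e t in z , pz) (λ (z , pz) → from e (z , tt , pz))
  where e = any-⇔ {R = λ _ → ⊤} (λ z → mk⇔ (λ _ → tt) (λ _ → ∈-allFin z)) (λ z _ → p z)

∀-⇔ : ∀ {n} {f : Fin n → Bool} {P : Fin n → Set} →
      (∀ z → T (f z) ⇔ P z) → T (all f (allFin n)) ⇔ (∀ z → P z)
∀-⇔ {n} {f} p = mk⇔ (λ t z → to (p z) (All.lookup (all⁺ f (allFin n) t) (∈-allFin z)))
                    (λ q → all⁻ f (All.universal (λ z → from (p z) (q z)) (allFin n)))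

range-⇔ : ∀ {n} g (z : Fin n) → z ∈ range n g ⇔ (toℕ z ≤ value g n)
range-⇔ {n} g z = mk⇔
  (λ z∈ → ≤ᵇ⇒≤ _ _ (proj₂ (∈-filter⁻ (λ y → T? (toℕ y ≤ᵇ value g n)) {xs = allFin n} z∈)))
  (λ z≤ → ∈-filter⁺ (λ y → T? (toℕ y ≤ᵇ value g n)) (∈-allFin z) (≤⇒≤ᵇ z≤))

only-unique : ∀ {A : Set} {xs : List A} {y} → Unique xs → y ∈ xs → (∀ {z} → z ∈ xs → z ≡ y) → only xs ≡ just y
only-unique {xs = x ∷ []} u (here refl) same = refl
only-unique {xs = x ∷ z ∷ xs} ((x≢z ∷ _) ∷ _) y∈ same =
  contradiction (trans (same (here refl)) (sym (same (there (here refl))))) x≢z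

only-↦ : ∀ {n} {P : Fin n → Bool} {m} → (∀ y → T (P y) ⇔ (toℕ y ≡ m)) → m < n →
         only (filterᵇ P (allFin n)) ↦ m
only-↦ {n} {P} {m} p m<n = y , only-unique
    (filter⁺ (T? ∘ P) (allFin⁺ n))
    (∈-filter⁺ (T? ∘ P) (∈-allFin y) (from (p y) y≡m))
    (λ {z} z∈ → toℕ-injective (trans (to (p z) (proj₂ (∈-filter⁻ (T? ∘ P) {xs = allFin n} z∈))) (sym y≡m)))
  , y≡m
  where
  y = fromℕ< m<n
  y≡m = toℕ-fromℕ< m<n

fin : ∀ {n} (v : Fin n) → just v ↦ toℕ v
fin v = v , refl , refl

↦< : ∀ {n m} {x : Maybe (Fin n)} → x ↦ m → m < n
↦< (v , _ , refl) = toℕ<n v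

↦-unique : ∀ {n a b} {x : Maybe (Fin n)} → x ↦ a → x ↦ b → a ≡ b
↦-unique (_ , refl , refl) (_ , refl , refl) = refl

toFin?-just : ∀ {n m} → m < n → toFin? n m ↦ m
toFin?-just {n} {m} m<n with m <? n
... | yes p = fromℕ< p , refl , toℕ-fromℕ< p
... | no ¬p = contradiction m<n ¬p

toFin?-inv : ∀ {n m v} → toFin? n m ≡ just v → toℕ v ≡ m
toFin?-inv {n} {m} eq with m <? n
toFin?-inv refl | yes p = toℕ-fromℕ< p

plus-↦ : ∀ {n a b} {x y : Maybe (Fin n)} → x ↦ a → y ↦ b → a + b < n → plus x y ↦ a + b
plus-↦ (_ , refl , refl) (_ , refl , refl) = toFin?-just

times-↦ : ∀ {n a b} {x y : Maybe (Fin n)} → x ↦ a → y ↦ b → a * b < n → times x y ↦ a * b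
times-↦ (_ , refl , refl) (_ , refl , refl) = toFin?-just

plus-inv : ∀ {n} {x y : Maybe (Fin n)} {v} → plus x y ≡ just v →
           ∃[ a ] ∃[ b ] x ↦ a × y ↦ b × toℕ v ≡ a + b
plus-inv {x = just a} {just b} eq = toℕ a , toℕ b , fin a , fin b , toFin?-inv eq

times-inv : ∀ {n} {x y : Maybe (Fin n)} {v} → times x y ≡ just v →
            ∃[ a ] ∃[ b ] x ↦ a × y ↦ b × toℕ v ≡ a * b
times-inv {x = just a} {just b} eq = toℕ a , toℕ b , fin a , fin b , toFin?-inv eq

equal-inv : ∀ {n} {x y : Maybe (Fin n)} → T (equal x y) → ∃[ v ] x ≡ just v × y ≡ just v
equal-inv {x = just a} {just b} t with a ≟ b
... | yes refl = a , refl , refl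

equal-⇔ : ∀ {n a b} {x y : Maybe (Fin n)} → x ↦ a → y ↦ b → T (equal x y) ⇔ (a ≡ b)
equal-⇔ {x = x} {y} (v , refl , refl) (w , refl , refl) = mk⇔
  (λ t → case equal-inv {x = x} {y} t of λ { (_ , refl , refl) → refl })
  (λ eq → subst (λ w → T (equal (just v) (just w))) (toℕ-injective eq) (refl-equal v))
  where
  refl-equal : ∀ {n} (v : Fin n) → T (equal (just v) (just v))
  refl-equal v with v ≟ v
  ... | yes _ = _
  ... | no ¬p = ¬p refl

leq-⇔ : ∀ {n a b} {x y : Maybe (Fin n)} → x ↦ a → y ↦ b → T (leq x y) ⇔ (a ≤ b)
leq-⇔ (_ , refl , refl) (_ , refl , refl) = mk⇔ (≤ᵇ⇒≤ _ _) ≤⇒≤ᵇ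

-- The syntax has no constants, and 0 is the only solution of `x + x = x`. If `x + x` leaves the
-- domain, the atom is false, in agreement with `x ≠ 0`.
zero-⇔ : ∀ {n a} {x : Maybe (Fin n)} → x ↦ a → T (equal (plus x x) x) ⇔ (a ≡ 0)
zero-⇔ {n} {a} {x} x↦a = mk⇔ sound complete
  where
  sound : T (equal (plus x x) x) → a ≡ 0
  sound t with equal-inv {x = plus x x} t
  ... | v , x+x≡v , x≡v with plus-inv {x = x} x+x≡v
  ... | b , c , x↦b , x↦c , v≡b+c with ↦-unique x↦a x↦b | ↦-unique x↦a x↦c | ↦-unique x↦a (v , x≡v , refl)
  ... | refl | refl | a≡v = m+n≡n⇒m≡0 a (sym (trans a≡v v≡b+c))
    where
    m+n≡n⇒m≡0 : ∀ m → m + m ≡ m → m ≡ 0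
    m+n≡n⇒m≡0 m eq = +-cancelʳ-≡ m m 0 eq
  complete : a ≡ 0 → T (equal (plus x x) x)
  complete refl = from (equal-⇔ (plus-↦ x↦a x↦a (↦< x↦a)) x↦a) refl

-- Formulas for lengths, starts and the height

module Formulas {τ : Schema} where
  isZero : ∀ {k} → FOTerm τ k → Formula τ k
  isZero t = t ⊕ t ≐ t

  -- Divisibility by the lcm is divisibility by each of `1, …, j + 1`, so the lcm does not have to
  -- be an element. That `t + 1` divides `y` is written `t * q + q = y`, because `t + 1` may fall
  -- outside the domain.
  lenDivides : ∀ {k} → Fin k → Fin k → Formula τ k
  lenDivides j y = ∀′ (¬′ (var zero ≼ var (suc j)) ∨′
    ∃′ (var (suc zero) ⊗ var zero ⊕ var zero ≐ var (suc (suc y))))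

  covers : ∀ {k} → Fin k → Fin k → Formula τ k
  covers x y = ¬′ (var y ≼ var x) ∧′ ∀′ (var zero ≼ var (suc x) ∨′ var (suc y) ≼ var zero)

  isStart : ∀ {k} → Fin k → Fin k → Fin k → Formula τ k
  isStart j x y = (var y ≼ var x ∧′ lenDivides j y) ∧′
    ∀′ (¬′ (var zero ≼ var (suc x) ∧′ lenDivides (suc j) zero) ∨′ var zero ≼ var (suc y))

  posMultiple : ∀ {k} → Fin k → Fin k → Formula τ k
  posMultiple j y = ¬′ isZero (var y) ∧′ lenDivides j y

  isLen : ∀ {k} → Fin k → Fin k → Formula τ k
  isLen j y = posMultiple j y ∧′ ∀′ (¬′ posMultiple (suc j) zero ∨′ var (suc y) ≼ var zero)

  -- Recognises `n ≤ len j` although `len j` is then no element: the domain contains no positive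
  -- multiple of it.
  exceeds : ∀ {k} → Fin k → Formula τ k
  exceeds j = ¬′ ∃′ (posMultiple (suc j) zero)

  isHeight : ∀ {k} → Fin k → Formula τ k
  isHeight z = exceeds z ∧′ ∀′ (¬′ exceeds zero ∨′ var (suc z) ≼ var zero)

  module _ {n} (𝒜 : Structure τ n) where
    private
      implies : ∀ {b c} {P Q : Set} → T b ⇔ P → T c ⇔ Q → T (not b ∨ c) ⇔ (P → Q)
      implies {true}  p q = mk⇔ (λ t _ → to q t) (λ f → from q (f (to p _)))
      implies {false} p q = mk⇔ (λ _ x → ⊥-elim (from p x)) (λ _ → tt)

    lenDivides-⇔ : ∀ {k} (e : Tuple n k) j y →
      T (sat 𝒜 e (lenDivides j y)) ⇔ (len (toℕ (lookup e j)) ∣ toℕ (lookup e y))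
    lenDivides-⇔ e j y = mk⇔
      (λ t → len-least (toℕ (lookup e j)) λ i i≤j →
         let i<n = ≤-<-trans i≤j (toℕ<n (lookup e j)) in
         subst (λ i → suc i ∣ toℕ (lookup e y)) (toℕ-fromℕ< i<n)
           (to all-⇔ t (fromℕ< i<n) (subst (_≤ toℕ (lookup e j)) (sym (toℕ-fromℕ< i<n)) i≤j)))
      (λ d → from all-⇔ (λ t t≤j → ∣-trans (suc∣len (toℕ (lookup e j)) (toℕ t) t≤j) d))
      where
      product : ∀ {t q : Fin n} {y} → T (equal (plus (times (just t) (just q)) (just q)) (just y)) ⇔ (toℕ y ≡ toℕ q * suc (toℕ t))
      product {t} {q} {y} = mk⇔ sound complete
        where
        rearrange : toℕ t * toℕ q + toℕ q ≡ toℕ q * suc (toℕ t)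
        rearrange = trans (+-comm (toℕ t * toℕ q) (toℕ q)) (*-comm (suc (toℕ t)) (toℕ q))
        sound : _ → _
        sound p with equal-inv {x = plus (times (just t) (just q)) (just q)} {just y} p
        ... | _ , tq+q≡y , refl with plus-inv {x = times (just t) (just q)} tq+q≡y
        ... | _ , _ , (_ , tq≡ , refl) , (_ , refl , refl) , y≡ =
              trans y≡ (trans (cong (_+ toℕ q) (toFin?-inv tq≡)) rearrange)
        complete : _ → _
        complete y≡ = from (equal-⇔ (plus-↦ (times-↦ (fin t) (fin q) (≤-<-trans (m≤m+n _ (toℕ q)) tq+q<n)) (fin q) tq+q<n) (fin y))
                           (trans rearrange (sym y≡))
          where
          tq+q<n : toℕ t * toℕ q + toℕ q < n
          tq+q<n = subst (_< n) (trans y≡ (sym rearrange)) (toℕ<n y)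
      divides-⇔ : ∀ (t : Fin n) → _ ⇔ (suc (toℕ t) ∣ toℕ (lookup e y))
      divides-⇔ t = mk⇔ (λ s → let (q , eq) = to ex s in divides (toℕ q) eq) complete
        where
        ex = ∃-⇔ {n} {P = λ q → toℕ (lookup e y) ≡ toℕ q * suc (toℕ t)} (λ q → product {t} {q} {lookup e y})
        complete : suc (toℕ t) ∣ toℕ (lookup e y) → _
        -- The quotient is at most the dividend and therefore an element.
        complete (divides q eq) = from ex (fromℕ< q<n , trans eq (cong (_* suc (toℕ t)) (sym (toℕ-fromℕ< q<n))))
          where
          q<n : q < n
          q<n = ≤-<-trans (≤-trans (m≤m*n q (suc (toℕ t))) (≤-reflexive (sym eq))) (toℕ<n (lookup e y))
      all-⇔ = ∀-⇔ {n} (λ t → implies (leq-⇔ (fin t) (fin (lookup e j))) (divides-⇔ t))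

    covers-⇔ : ∀ {k} (e : Tuple n k) x y →
      T (sat 𝒜 e (covers x y)) ⇔ (toℕ (lookup e y) ≡ suc (toℕ (lookup e x)))
    covers-⇔ e x y = mk⇔
      (λ t → let (y≰x , gap) = to both t in ≤-antisym (y≤ (≰⇒> y≰x) gap) (≰⇒> y≰x))
      (λ eq → from both ((λ y≤x → 1+n≰n (subst (_≤ _) eq y≤x)) , λ z → split eq (toℕ z ≤? toℕ (lookup e x))))
      where
      both = ¬-⇔ (leq-⇔ (fin (lookup e y)) (fin (lookup e x))) ∧-⇔
             ∀-⇔ (λ z → leq-⇔ (fin z) (fin (lookup e x)) ∨-⇔ leq-⇔ (fin (lookup e y)) (fin z))
      y≤ : suc (toℕ (lookup e x)) ≤ toℕ (lookup e y) →
           (∀ z → toℕ z ≤ toℕ (lookup e x) ⊎ toℕ (lookup e y) ≤ toℕ z) →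
           toℕ (lookup e y) ≤ suc (toℕ (lookup e x))
      y≤ x<y gap with gap (fromℕ< (≤-<-trans x<y (toℕ<n (lookup e y))))
      ... | inj₁ le = contradiction (subst (_≤ toℕ (lookup e x)) (toℕ-fromℕ< _) le) 1+n≰n
      ... | inj₂ le = subst (toℕ (lookup e y) ≤_) (toℕ-fromℕ< _) le
      split : ∀ {z x y} → y ≡ suc x → Dec (z ≤ x) → z ≤ x ⊎ y ≤ z
      split eq (yes z≤x) = inj₁ z≤x
      split refl (no z≰x) = inj₂ (≰⇒> z≰x)

    isStart-⇔ : ∀ {k} (e : Tuple n k) j x y →
      T (sat 𝒜 e (isStart j x y)) ⇔ (toℕ (lookup e y) ≡ st (toℕ (lookup e j)) (toℕ (lookup e x)))
    isStart-⇔ e j x y = mk⇔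
      (λ t → let ((y≤x , d) , greatest) = to conj t in
         ≤-antisym (st-greatest J d y≤x)
           (subst (_≤ _) (toℕ-fromℕ< s<n) (greatest (fromℕ< s<n)
             (subst (_≤ X) (sym (toℕ-fromℕ< s<n)) (st≤ J X) , subst (len J ∣_) (sym (toℕ-fromℕ< s<n)) (len∣st J X)))))
      (λ eq → from conj ((subst (_≤ X) (sym eq) (st≤ J X) , subst (len J ∣_) (sym eq) (len∣st J X)) ,
         λ z (z≤x , d) → subst (toℕ z ≤_) (sym eq) (st-greatest J d z≤x)))
      where
      J = toℕ (lookup e j)
      X = toℕ (lookup e x)
      s<n : st J X < n
      s<n = ≤-<-trans (st≤ J X) (toℕ<n (lookup e x))
      conj = (leq-⇔ (fin (lookup e y)) (fin (lookup e x)) ∧-⇔ lenDivides-⇔ e j y) ∧-⇔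
        ∀-⇔ (λ z → implies (leq-⇔ (fin z) (fin (lookup e x)) ∧-⇔ lenDivides-⇔ (z ∷ e) (suc j) zero)
                           (leq-⇔ (fin z) (fin (lookup e y))))

    posMultiple-⇔ : ∀ {k} (e : Tuple n k) j y →
      T (sat 𝒜 e (posMultiple j y)) ⇔ (toℕ (lookup e y) ≢ 0 × len (toℕ (lookup e j)) ∣ toℕ (lookup e y))
    posMultiple-⇔ e j y = ¬-⇔ (zero-⇔ (fin (lookup e y))) ∧-⇔ lenDivides-⇔ e j y

    private
      len≤multiple : ∀ {j y} → y ≢ 0 × len j ∣ y → len j ≤ y
      len≤multiple (y≢0 , d) = ∣⇒≤ {{≢-nonZero y≢0}} d
      lenFin : ∀ {j} (l<n : len j < n) → toℕ (fromℕ< l<n) ≢ 0 × len j ∣ toℕ (fromℕ< l<n)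
      lenFin {j} l<n rewrite toℕ-fromℕ< l<n = ≢-nonZero⁻¹ (len j) , ∣-refl

    isLen-⇔ : ∀ {k} (e : Tuple n k) j y →
      T (sat 𝒜 e (isLen j y)) ⇔ (toℕ (lookup e y) ≡ len (toℕ (lookup e j)))
    isLen-⇔ e j y = mk⇔
      (λ t → let (pm , least) = to conj t; l<n = ≤-<-trans (len≤multiple pm) (toℕ<n (lookup e y)) in
         ≤-antisym (subst (_ ≤_) (toℕ-fromℕ< l<n) (least (fromℕ< l<n) (lenFin l<n))) (len≤multiple pm))
      (λ eq → from conj (((λ y≡0 → ≢-nonZero⁻¹ (len J) (trans (sym eq) y≡0)) , subst (len J ∣_) (sym eq) ∣-refl) ,
                         λ z pm → subst (_≤ toℕ z) (sym eq) (len≤multiple pm)))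
      where
      J = toℕ (lookup e j)
      conj = posMultiple-⇔ e j y ∧-⇔
        ∀-⇔ (λ z → implies (posMultiple-⇔ (z ∷ e) (suc j) zero) (leq-⇔ (fin (lookup e y)) (fin z)))

    exceeds-⇔ : ∀ {k} (e : Tuple n k) j →
      T (sat 𝒜 e (exceeds j)) ⇔ (n ≤ len (toℕ (lookup e j)))
    exceeds-⇔ e j = mk⇔
      (λ t → ≮⇒≥ λ l<n → to none t (fromℕ< l<n , lenFin l<n))
      (λ n≤ → from none λ (z , pm) → <-irrefl refl (<-≤-trans (toℕ<n z) (≤-trans n≤ (len≤multiple pm))))
      where none = ¬-⇔ (∃-⇔ (λ z → posMultiple-⇔ (z ∷ e) (suc j) zero))

    isHeight-⇔ : ∀ {k} (e : Tuple n k) z →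
      T (sat 𝒜 e (isHeight z)) ⇔ (toℕ (lookup e z) ≡ height n)
    isHeight-⇔ e z = mk⇔
      (λ t → let (n≤ , least) = to conj t in
         ≤-antisym (subst (toℕ (lookup e z) ≤_) (toℕ-fromℕ< h<n) (least (fromℕ< h<n) (subst (λ h → n ≤ len h) (sym (toℕ-fromℕ< h<n)) (n≤len-height n))))
                   (height-least n≤))
      (λ eq → from conj (subst (λ h → n ≤ len h) (sym eq) (n≤len-height n) ,
                         λ y n≤ → subst (_≤ toℕ y) (sym eq) (height-least n≤)))
      where
      h<n : height n < n
      h<n = height<n (≤-<-trans z≤n (toℕ<n (lookup e z)))
      height-least : ∀ {y} → n ≤ len y → height n ≤ y
      height-least n≤ = ≮⇒≥ λ y<h → <-irrefl refl (<-≤-trans (len<n y<h) n≤)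
      conj = exceeds-⇔ e z ∧-⇔
        ∀-⇔ (λ y → implies (exceeds-⇔ (y ∷ e) zero) (leq-⇔ (fin (lookup e z)) (fin y)))

open Formulas

-- The only bound of the program. It limits levels, indices of children and the searches along the
-- path.
levels : Bound
levels = record
  { value   = height
  ; formula = isHeight zero
  ; defines = λ n z → isHeight-⇔ {∅} emptyStructure (z ∷ []) zero
  }

-- Minima of heights over blocks

bit : Bool → ℕ
bit b = if b then 1 else 0

count : (ℕ → Bool) → ℕ → ℕ
count ρ zero    = 0
count ρ (suc y) = bit (ρ y) + count ρ y

count-mono : ∀ ρ {x y} → x ≤ y → count ρ x ≤ count ρ y
count-mono ρ {x} {y} x≤y with m≤n⇒∃[o]m+o≡n x≤y
... | d , refl = grow d
  where
  grow : ∀ d → count ρ x ≤ count ρ (x + d)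
  grow zero    rewrite +-identityʳ x = ≤-refl
  grow (suc d) rewrite +-suc x d = ≤-trans (grow d) (m≤n+m _ (bit (ρ (x + d))))

-- A Lipschitz bound with both differences moved across, so that no subtraction is truncated.
count-lipschitz : ∀ ρ {x y} → x ≤ y → count ρ y + x ≤ count ρ x + y
count-lipschitz ρ {x} {y} x≤y with m≤n⇒∃[o]m+o≡n x≤y
... | d , refl = grow d
  where
  bit≤1 : ∀ b → bit b ≤ 1
  bit≤1 true  = ≤-refl
  bit≤1 false = z≤n
  grow : ∀ d → count ρ (x + d) + x ≤ count ρ x + (x + d)
  grow zero    rewrite +-identityʳ x = ≤-refl
  grow (suc d) rewrite +-suc x d | +-suc (count ρ x) (x + d) =
    ≤-trans (≤-reflexive (+-assoc (bit (ρ (x + d))) _ x)) (+-mono-≤ (bit≤1 (ρ (x + d))) (grow d))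

-- The height of w₀ … w_{y-1}, shifted by n to make it nonnegative.
level : ℕ → (Fin 2 → ℕ → Bool) → ℕ → ℕ
level n ρ y = (n + count (ρ opening) y) ∸ count (ρ closing) y

level-eq : ∀ {n} ρ {y} → y ≤ n → level n ρ y + count (ρ closing) y ≡ n + count (ρ opening) y
level-eq {n} ρ {y} y≤n = m∸n+n≡m (begin
  count (ρ closing) y      ≡⟨ sym (+-identityʳ _) ⟩
  count (ρ closing) y + 0  ≤⟨ count-lipschitz (ρ closing) z≤n ⟩
  y                        ≤⟨ y≤n ⟩
  n                        ≤⟨ m≤m+n n _ ⟩
  n + count (ρ opening) y  ∎)
  where open ≤-Reasoning

Argmin : (ℕ → Set) → (ℕ → ℕ) → ℕ → Set
Argmin Q H y = Q y × ∀ z → Q z → H y ≤ H z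

Block : ℕ → ℕ → ℕ → ℕ → Set
Block n j s y = y < n × st j y ≡ s

Drop : ℕ → (ℕ → ℕ) → ℕ → ℕ → ℕ → Set
Drop n H j s m = ∃[ y ] Argmin (Block n j s) H y × H y + m ≡ H s

Attains : ℕ → (ℕ → ℕ) → ℕ → ℕ → ℕ → ℕ → Set
Attains n H q v r u = ∃[ y ] Block n r u y × Argmin (Block n q v) H y

data Shift : Set where
  same inc dec : Shift

Shifted : Shift → ℕ → ℕ → Set
Shifted same a b = b ≡ a
Shifted inc  a b = b ≡ suc a
Shifted dec  a b = a ≡ suc b

-- The height at `y` counts the positions below `y`, so a change at `i` is first felt at `i + 1`.
ShiftedAfter : Shift → ℕ → (H H′ : ℕ → ℕ) → Set
ShiftedAfter d i H H′ = (∀ y → y ≤ i → H′ y ≡ H y) × (∀ y → i < y → Shifted d (H y) (H′ y))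

data Side : Set where
  left right : Side

OnSide : Side → ℕ → ℕ → Set
OnSide left  i y = y ≤ i
OnSide right i y = i < y

BlockOnSide : Side → ℕ → ℕ → Set
BlockOnSide left  s u = u < s
BlockOnSide right s u = s < u

module _ {n : ℕ} where

  Block⇒≤ : ∀ {j s y} → Block n j s y → s ≤ y
  Block⇒≤ {j} {y = y} (_ , refl) = st≤ j y

  Block-start : ∀ {j s} → s < n → st j s ≡ s → Block n j s s
  Block-start s<n fix = s<n , fix

  attains-block : ∀ {q v r u y} → q ≡ suc r → st q u ≡ v → Block n r u y → Block n q v y
  attains-block {r = r} {y = y} refl refl (y<n , refl) = y<n , sym (st-st r y)

module _ {n : ℕ} {H : ℕ → ℕ} where

  MinOn : Side → ℕ → ℕ → Set
  MinOn σ i j = ∃[ y ] OnSide σ i y × Argmin (Block n j (st j i)) H y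

  ChildMinOn : Side → ℕ → ℕ → ℕ → Set
  ChildMinOn σ i q r = ∃[ u ] (u < n × st r u ≡ u × st q u ≡ st q i) × BlockOnSide σ (st r i) u × Attains n H q (st q i) r u

  -- A child without `i` lies wholly on one side of `i`. So a minimum on that side lies in such a
  -- child or in the child around `i`, which then attains the minimum of its parent.
  MinOn-suc : ∀ σ i r → MinOn σ i (suc r) ⇔
    (ChildMinOn σ i (suc r) r ⊎ (Attains n H (suc r) (st (suc r) i) r (st r i) × MinOn σ i r))
  MinOn-suc σ i r = mk⇔ split join
    where
    q = suc r
    side : ∀ σ {y} → OnSide σ i y → st r y ≢ st r i → BlockOnSide σ (st r i) (st r y)
    side left  y≤i ≢ = ≤∧≢⇒< (st-mono r y≤i) ≢
    side right i<y ≢ = ≤∧≢⇒< (st-mono r (<⇒≤ i<y)) (≢ ∘ sym)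
    unside : ∀ σ {y} → BlockOnSide σ (st r i) (st r y) → OnSide σ i y
    unside left  lt = ≮⇒≥ λ i<y → <⇒≱ lt (st-mono r (<⇒≤ i<y))
    unside right lt = ≰⇒> λ y≤i → <⇒≱ lt (st-mono r y≤i)
    split : MinOn σ i q → _
    split (y , on , am@((y<n , sty) , min)) with st r y Nat.≟ st r i
    ... | yes eq = inj₂ ((y , (y<n , eq) , am) , y , on , (y<n , eq) , λ z blk →
                     min z (attains-block {r = r} refl (st-st r i) blk))
    ... | no  ≢  = inj₁ (st r y , (≤-<-trans (st≤ r y) y<n , st-idem r y , trans (st-st r y) sty) ,
                     side σ on ≢ , y , (y<n , refl) , am)
    join : _ → MinOn σ i q
    join (inj₁ (_ , _ , lt , y , (y<n , refl) , am)) = y , unside σ lt , am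
    -- `y₀` witnesses that the child reaches the minimum of the parent, so every minimum of the
    -- child is one of the parent.
    join (inj₂ ((y₀ , blk₀ , (_ , min₀)) , y , on , (blk , min))) =
      y , on , attains-block {r = r} refl (st-st r i) blk , λ z blkz → ≤-trans (min y₀ blk₀) (min₀ z blkz)

  -- How a shift changes the drop of a block

  module _ {H′ : ℕ → ℕ} {i : ℕ} where

    drop-same : ∀ {j s m} → ShiftedAfter same i H H′ → Drop n H j s m → Drop n H′ j s m
    drop-same {s = s} (before , after) (y , (blk , min) , eq) =
      y , (blk , λ z blkz → subst₂ _≤_ (sym (eqv y)) (sym (eqv z)) (min z blkz)) ,
      trans (cong (_+ _) (eqv y)) (trans eq (sym (eqv s)))
      where
      eqv : ∀ z → H′ z ≡ H z
      eqv z with z ≤? i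
      ... | yes z≤i = before z z≤i
      ... | no  z≰i = after z (≰⇒> z≰i)

    -- A block is an interval. If it misses `i`, either all of it lies before `i` and no height in
    -- it moves, or all of it lies after `i` and its start moves together with its minimum.
    drop-off-path : ∀ {d j s m} → ShiftedAfter d i H H′ → st j s ≡ s → st j i ≢ s →
                    Drop n H j s m → Drop n H′ j s m
    drop-off-path {d} {j} {s} {m} (before , after) fix off (y , (blk , min) , eq) with s ≤? i
    ... | yes s≤i = y , (blk , λ z blkz → subst₂ _≤_ (sym (eqv blk)) (sym (eqv blkz)) (min z blkz)) ,
                    trans (cong (_+ m) (eqv blk)) (trans eq (sym (before s s≤i)))
      where
      eqv : ∀ {z} → Block n j s z → H′ z ≡ H z
      eqv {z} (_ , stz) = before z (≮⇒≥ λ i<z → off (st-squeeze j stz s≤i (<⇒≤ i<z)))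
    ... | no s≰i = y , (blk , λ z blkz → shift-≤ d (eqv blk) (eqv blkz) (min z blkz)) ,
                   shift-+ d (eqv blk) (after s (≰⇒> s≰i)) eq
      where
      eqv : ∀ {z} → Block n j s z → Shifted d (H z) (H′ z)
      eqv {z} blkz = after z (<-≤-trans (≰⇒> s≰i) (Block⇒≤ blkz))
      shift-≤ : ∀ d {a a′ b b′} → Shifted d a a′ → Shifted d b b′ → a ≤ b → a′ ≤ b′
      shift-≤ same refl refl a≤b       = a≤b
      shift-≤ inc  refl refl a≤b       = s≤s a≤b
      shift-≤ dec  refl refl (s≤s a≤b) = a≤b
      shift-+ : ∀ d {a a′ b b′} → Shifted d a a′ → Shifted d b b′ → a + m ≡ b → a′ + m ≡ b′
      shift-+ same refl refl eq = eq
      shift-+ inc  refl refl eq = cong suc eq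
      shift-+ dec  refl refl eq = suc-injective eq

    module _ {j m : ℕ} where
      private
        s : ℕ
        s = st j i

      -- A minimum that stays put remains one when the other heights stay or grow.
      drop-inc-left : ShiftedAfter inc i H H′ → MinOn left i j → Drop n H j s m → Drop n H′ j s m
      drop-inc-left (before , after) (y , y≤i , blk , min) (x , (blkx , minx) , eq) =
        y , (blk , λ z blkz → ≤-trans (≤-reflexive (before y y≤i)) (≤-trans (min z blkz) (grow z))) ,
        trans (cong (_+ m) (trans (before y y≤i) (≤-antisym (min x blkx) (minx y blk))))
              (trans eq (sym (before s (st≤ j i))))
        where
        grow : ∀ z → H z ≤ H′ z
        grow z with z ≤? i
        ... | yes z≤i = ≤-reflexive (sym (before z z≤i))
        ... | no  z≰i = ≤-trans (n≤1+n _) (≤-reflexive (sym (after z (≰⇒> z≰i))))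

      -- The heights up to `i` exceed the minimum by at least 1, so the minimum rises with the shift
      -- while the start of the block stays. The start is itself at most `i` and hence no minimum,
      -- so the old drop was positive.
      drop-inc-right : i < n → ShiftedAfter inc i H H′ → ¬ MinOn left i j → Drop n H j s m →
                       ∃[ m′ ] m ≡ suc m′ × Drop n H′ j s m′
      drop-inc-right i<n (before , after) none (x , (blkx , minx) , eq) = go m eq
        where
        x>i : i < x
        x>i = ≰⇒> λ x≤i → none (x , x≤i , blkx , minx)
        above : ∀ z → Block n j s z → z ≤ i → suc (H x) ≤ H z
        above z blkz z≤i = ≰⇒> λ Hz≤Hx → none (z , z≤i , blkz , λ w blkw → ≤-trans Hz≤Hx (minx w blkw))
        min′ : ∀ z → Block n j s z → H′ x ≤ H′ z
        min′ z blkz with z ≤? i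
        ... | yes z≤i = ≤-trans (≤-reflexive (after x x>i)) (≤-trans (above z blkz z≤i) (≤-reflexive (sym (before z z≤i))))
        ... | no  z≰i = ≤-trans (≤-reflexive (after x x>i)) (≤-trans (s≤s (minx z blkz)) (≤-reflexive (sym (after z (≰⇒> z≰i)))))
        go : ∀ m → H x + m ≡ H s → ∃[ m′ ] m ≡ suc m′ × Drop n H′ j s m′
        go zero    eq = contradiction (above s (Block-start (≤-<-trans (st≤ j i) i<n) (st-idem j i)) (st≤ j i))
                                      (<⇒≱ (s≤s (≤-reflexive (trans (sym eq) (+-identityʳ _)))))
        go (suc m) eq = m , refl , x , (blkx , min′) ,
          trans (cong (_+ m) (after x x>i)) (trans (sym (+-suc (H x) m)) (trans eq (sym (before s (st≤ j i)))))

      -- The minimum after `i` falls by 1, and no other height falls by more.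
      drop-dec-right : ShiftedAfter dec i H H′ → MinOn right i j → Drop n H j s m → Drop n H′ j s (suc m)
      drop-dec-right (before , after) (y , i<y , blk , min) (x , (blkx , minx) , eq) =
        y , (blk , min′) ,
        trans (+-suc (H′ y) m) (trans (cong (_+ m) (sym (after y i<y)))
          (trans (cong (_+ m) (≤-antisym (min x blkx) (minx y blk))) (trans eq (sym (before s (st≤ j i))))))
        where
        min′ : ∀ z → Block n j s z → H′ y ≤ H′ z
        min′ z blkz with z ≤? i
        ... | yes z≤i = ≤-trans (n≤1+n _) (≤-trans (≤-reflexive (sym (after y i<y))) (≤-trans (min z blkz) (≤-reflexive (sym (before z z≤i)))))
        ... | no  z≰i = ≤-pred (≤-trans (≤-reflexive (sym (after y i<y))) (≤-trans (min z blkz) (≤-reflexive (after z (≰⇒> z≰i)))))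

      -- The heights after `i` exceed the minimum by at least 1, so falling by 1 does not take them
      -- below it.
      drop-dec-left : ShiftedAfter dec i H H′ → ¬ MinOn right i j → Drop n H j s m → Drop n H′ j s m
      drop-dec-left (before , after) none (x , (blkx , minx) , eq) =
        x , (blkx , min′) , trans (cong (_+ m) (before x x≤i)) (trans eq (sym (before s (st≤ j i))))
        where
        x≤i : x ≤ i
        x≤i = ≮⇒≥ λ i<x → none (x , i<x , blkx , minx)
        min′ : ∀ z → Block n j s z → H′ x ≤ H′ z
        min′ z blkz with z ≤? i
        ... | yes z≤i = ≤-trans (≤-reflexive (before x x≤i)) (≤-trans (minx z blkz) (≤-reflexive (sym (before z z≤i))))
        ... | no  z≰i = ≤-trans (≤-reflexive (before x x≤i)) (≤-pred (≤-trans Hx<Hz (≤-reflexive (after z (≰⇒> z≰i)))))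
          where
          Hx<Hz : H x < H z
          Hx<Hz = ≰⇒> λ Hz≤Hx → none (z , ≰⇒> z≰i , blkz , λ w blkw → ≤-trans Hz≤Hx (minx w blkw))

-- Turns a recursion over levels into quantifiers, since conditions cannot recurse. `l` is the level
-- at which the recursion ends through `E`.
unroll : ∀ {X E a : ℕ → Set} → X 0 ⇔ E 0 → (∀ r → X (suc r) ⇔ (E (suc r) ⊎ (a (suc r) × X r))) →
         ∀ j → X j ⇔ (∃[ l ] l ≤ j × E l × (∀ q → l < q → q ≤ j → a q))
unroll {X} {E} {a} base step j = mk⇔ (there′ j) λ (l , l≤j , El , as) → back j l l≤j El as
  where
  there′ : ∀ j → X j → ∃[ l ] l ≤ j × E l × (∀ q → l < q → q ≤ j → a q)
  there′ zero x = 0 , z≤n , to base x , λ q 0<q q≤0 → contradiction (<-≤-trans 0<q q≤0) (<-irrefl refl)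
  there′ (suc r) x with to (step r) x
  ... | inj₁ e = suc r , ≤-refl , e , λ q l<q q≤l → contradiction (<-≤-trans l<q q≤l) (<-irrefl refl)
  ... | inj₂ (ar , xr) with there′ r xr
  ... | l , l≤r , El , as = l , m≤n⇒m≤1+n l≤r , El , as′
    where
    as′ : ∀ q → l < q → q ≤ suc r → a q
    as′ q l<q q≤ with m≤n⇒m<n∨m≡n q≤
    ... | inj₁ (s≤s q≤r) = as q l<q q≤r
    ... | inj₂ refl      = ar
  back : ∀ j l → l ≤ j → E l → (∀ q → l < q → q ≤ j → a q) → X j
  back zero    zero    z≤n El as = from base El
  back (suc r) l       l≤  El as with m≤n⇒m<n∨m≡n l≤
  ... | inj₂ refl      = from (step r) (inj₁ El)
  ... | inj₁ (s≤s l≤r) = from (step r) (inj₂ (as (suc r) (s≤s l≤r) ≤-refl ,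
                           back r l l≤r El λ q l<q q≤r → as q l<q (m≤n⇒m≤1+n q≤r)))

-- Comparing minima through letter counts

module _ {n : ℕ} (ρ : Fin 2 → ℕ → Bool) where
  private
    H = level n ρ
    o = count (ρ opening)
    c = count (ρ closing)

  -- Writes a drop as ⟩ minus ⟨ between `v` and `y`, which removes the offset `n` of the heights
  -- from the size estimates below.
  drop-count : ∀ {v y m} → v < n → y < n → H y + m ≡ H v → m + (o y + c v) ≡ o v + c y
  drop-count {v} {y} {m} v<n y<n eq = +-cancelˡ-≡ n _ _ (begin
    n + (m + (o y + c v))      ≡⟨ solve₁ n m (o y) (c v) ⟩
    (n + o y) + (m + c v)      ≡⟨ cong (_+ (m + c v)) (sym (level-eq ρ (<⇒≤ y<n))) ⟩
    (H y + c y) + (m + c v)    ≡⟨ solve₂ (H y) (c y) m (c v) ⟩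
    (H y + m + c v) + c y      ≡⟨ cong (λ h → (h + c v) + c y) eq ⟩
    (H v + c v) + c y          ≡⟨ cong (_+ c y) (level-eq ρ (<⇒≤ v<n)) ⟩
    (n + o v) + c y            ≡⟨ +-assoc n (o v) (c y) ⟩
    n + (o v + c y)            ∎)
    where
    open ≡-Reasoning
    solve₁ : ∀ n m a b → n + (m + (a + b)) ≡ (n + a) + (m + b)
    solve₁ = solve-∀
    solve₂ : ∀ h a m b → (h + a) + (m + b) ≡ (h + m + b) + a
    solve₂ = solve-∀

  module _ {r v u μv μu p k} (u<n : u < n) (stqu : st (suc r) u ≡ v)
           (p-eq : p + o v ≡ o u) (k-eq : k + c v ≡ c u)
           (dropv : Drop n H (suc r) v μv) (dropu : Drop n H r u μu) where
    private
      v≤u : v ≤ u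
      v≤u = subst (_≤ u) stqu (st≤ (suc r) u)
      v<n : v < n
      v<n = ≤-<-trans v≤u u<n
      x = proj₁ dropv
      blkx = proj₁ (proj₁ (proj₂ dropv))
      minx = proj₂ (proj₁ (proj₂ dropv))
      eqx = proj₂ (proj₂ dropv)
      y = proj₁ dropu
      blky = proj₁ (proj₁ (proj₂ dropu))
      miny = proj₂ (proj₁ (proj₂ dropu))
      eqy = proj₂ (proj₂ dropu)

    -- With `p` letters ⟨ and `k` letters ⟩ between `v` and `u`, the minima of parent and child are
    -- `H v - μv` and `H v + p - k - μu`. The equation compares them with all terms moved to the
    -- side where they are positive.
    attains-⇔ : p + μv ≡ k + μu ⇔ Attains n H (suc r) v r u
    attains-⇔ = mk⇔
      (λ eq → y , blky , attains-block refl stqu blky ,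
         λ z blkz → ≤-trans (≤-reflexive (sym (+-cancelʳ-≡ (p + μv) (H x) (H y) (trans balance (cong (H y +_) (sym eq)))))) (minx z blkz))
      (λ (z , blkz , (blkz′ , minz)) →
         +-cancelˡ-≡ (H x) _ _ (trans balance (cong (_+ (k + μu)) (≤-antisym (≤-trans (miny z blkz) (minz x blkx)) (minx y (attains-block refl stqu blky))))))
      where
      open ≡-Reasoning
      solve₁ : ∀ a p m b → (a + (p + m)) + b ≡ (a + m + b) + p
      solve₁ = solve-∀
      solve₂ : ∀ a k m b → (a + m) + (k + b) ≡ (a + (k + m)) + b
      solve₂ = solve-∀
      balance : H x + (p + μv) ≡ H y + (k + μu)
      balance = +-cancelʳ-≡ (c v) _ _ (begin
        H x + (p + μv) + c v    ≡⟨ solve₁ (H x) p μv (c v) ⟩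
        (H x + μv + c v) + p    ≡⟨ cong (λ h → h + c v + p) eqx ⟩
        H v + c v + p           ≡⟨ cong (_+ p) (level-eq ρ (<⇒≤ v<n)) ⟩
        n + o v + p             ≡⟨ +-assoc n (o v) p ⟩
        n + (o v + p)           ≡⟨ cong (n +_) (trans (+-comm (o v) p) p-eq) ⟩
        n + o u                 ≡⟨ sym (level-eq ρ (<⇒≤ u<n)) ⟩
        H u + c u               ≡⟨ cong₂ _+_ (sym eqy) (sym k-eq) ⟩
        (H y + μu) + (k + c v)  ≡⟨ solve₂ (H y) k μu (c v) ⟩
        H y + (k + μu) + c v    ∎)

    -- The test of attainment needs this sum to be defined. `μv` is the number of ⟩ minus that of ⟨
    -- between `v` and the minimum at `x`. If `u ≤ x`, the `p` letters ⟨ are cancelled and at most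
    -- `x - v` letters ⟩ remain. Otherwise the remaining ⟨ lie in `[x, u)` and the ⟩ in `[v, x)`, at
    -- most `u - v` in all.
    opened+drop<n : p + μv < n
    opened+drop<n with u ≤? x
    ... | yes u≤x = ≤-<-trans (+-cancelʳ-≤ (o u + c v + v) _ _ (begin
            (p + μv) + (o u + c v + v)          ≡⟨ solve₁ p μv (o u) (c v) v ⟩
            p + (μv + (o u + c v)) + v          ≤⟨ +-monoˡ-≤ v (+-monoʳ-≤ p (+-monoʳ-≤ μv (+-monoˡ-≤ (c v) (count-mono (ρ opening) u≤x)))) ⟩
            p + (μv + (o x + c v)) + v          ≡⟨ cong (λ h → p + h + v) (drop-count v<n (proj₁ blkx) eqx) ⟩
            p + (o v + c x) + v                 ≡⟨ solve₂ p (o v) (c x) v ⟩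
            (p + o v) + (c x + v)               ≤⟨ +-mono-≤ (≤-reflexive p-eq) (count-lipschitz (ρ closing) (Block⇒≤ blkx)) ⟩
            o u + (c v + x)                     ≤⟨ m≤m+n _ v ⟩
            o u + (c v + x) + v                 ≡⟨ solve₃ (o u) (c v) x v ⟩
            x + (o u + c v + v)                 ∎)) (proj₁ blkx)
      where
      open ≤-Reasoning
      solve₁ : ∀ p m a b v → (p + m) + (a + b + v) ≡ p + (m + (a + b)) + v
      solve₁ = solve-∀
      solve₂ : ∀ p a b v → p + (a + b) + v ≡ (p + a) + (b + v)
      solve₂ = solve-∀
      solve₃ : ∀ a b y v → a + (b + y) + v ≡ y + (a + b + v)
      solve₃ = solve-∀
    ... | no u≰x = ≤-<-trans (+-cancelʳ-≤ (o x + c v + (v + x)) _ _ (begin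
            (p + μv) + (o x + c v + (v + x))    ≡⟨ solve₁ p μv (o x) (c v) v x ⟩
            p + (μv + (o x + c v)) + (v + x)    ≡⟨ cong (λ h → p + h + (v + x)) (drop-count v<n (proj₁ blkx) eqx) ⟩
            p + (o v + c x) + (v + x)           ≡⟨ solve₂ p (o v) (c x) v x ⟩
            ((p + o v) + x) + (c x + v)         ≤⟨ +-mono-≤ (≤-trans (≤-reflexive (cong (_+ x) p-eq)) (count-lipschitz (ρ opening) (<⇒≤ (≰⇒> u≰x)))) (count-lipschitz (ρ closing) (Block⇒≤ blkx)) ⟩
            (o x + u) + (c v + x)               ≤⟨ m≤m+n _ v ⟩
            (o x + u) + (c v + x) + v           ≡⟨ solve₃ (o x) u (c v) x v ⟩
            u + (o x + c v + (v + x))           ∎)) u<n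
      where
      open ≤-Reasoning
      solve₁ : ∀ p m a b v y → (p + m) + (a + b + (v + y)) ≡ p + (m + (a + b)) + (v + y)
      solve₁ = solve-∀
      solve₂ : ∀ p a b v y → p + (a + b) + (v + y) ≡ ((p + a) + y) + (b + v)
      solve₂ = solve-∀
      solve₃ : ∀ a u b y v → (a + u) + (b + y) + v ≡ u + (a + b + (v + y))
      solve₃ = solve-∀

    -- The letters ⟩ counted by `k` and by `μu` lie in the disjoint intervals `[v, u)` and `[u, y)`,
    -- which gives the bound `y - v`.
    closed+drop<n : k + μu < n
    closed+drop<n = ≤-<-trans (+-cancelʳ-≤ (o y + c v + v) _ _ (begin
            (k + μu) + (o y + c v + v)          ≡⟨ solve₁ k μu (o y) (c v) v ⟩
            (μu + (o y + (k + c v))) + v        ≡⟨ cong (λ h → (μu + (o y + h)) + v) k-eq ⟩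
            (μu + (o y + c u)) + v              ≡⟨ cong (_+ v) (drop-count u<n (proj₁ blky) eqy) ⟩
            (o u + c y) + v                     ≡⟨ +-assoc (o u) (c y) v ⟩
            o u + (c y + v)                     ≤⟨ +-mono-≤ (count-mono (ρ opening) u≤y) (count-lipschitz (ρ closing) (≤-trans v≤u u≤y)) ⟩
            o y + (c v + y)                     ≤⟨ m≤m+n _ v ⟩
            o y + (c v + y) + v                 ≡⟨ solve₃ (o y) (c v) y v ⟩
            y + (o y + c v + v)                 ∎)) (proj₁ blky)
      where
      open ≤-Reasoning
      u≤y : u ≤ y
      u≤y = Block⇒≤ blky
      solve₁ : ∀ k m a b v → (k + m) + (a + b + v) ≡ (m + (a + (k + b))) + v
      solve₁ = solve-∀
      solve₃ : ∀ a b y v → a + (b + y) + v ≡ y + (a + b + v)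
      solve₃ = solve-∀

-- Dyck words

-- The one-counter automaton of the Dyck language, started with counter value `d`.
Balanced : ℕ → List (Fin 2) → Set
Balanced d       (zero ∷ w)       = Balanced (suc d) w
Balanced zero    []               = ⊤
Balanced (suc d) []               = ⊥
Balanced zero    (suc zero ∷ w)   = ⊥
Balanced (suc d) (suc zero ∷ w)   = Balanced d w

-- w closes d open parentheses: w = u₁ ⟩ u₂ ⟩ … ⟩ u_{d+1} with all uᵢ in D₁.
Closes : ℕ → List (Fin 2) → Set
Closes zero    w = D₁ w
Closes (suc d) w = ∃[ u ] ∃[ v ] w ≡ u ++ closing ∷ v × D₁ u × Closes d v

-- A Dyck word returns the counter to its old value. Quantifying over the continuation `v` makes
-- this an induction on the derivation of `u`.
Balanced-++ : ∀ {u} → D₁ u → ∀ d v → Balanced d v → Balanced d (u ++ v)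
Balanced-++ empty d v b = b
Balanced-++ (wrap {u} p) d v b =
  subst (Balanced (suc d)) (sym (++-assoc u (closing ∷ []) v)) (Balanced-++ p (suc d) (closing ∷ v) b)
Balanced-++ (concat {u} {u′} p q) d v b =
  subst (Balanced d) (sym (++-assoc u u′ v)) (Balanced-++ p d (u′ ++ v) (Balanced-++ q d v b))

Closes-++ : ∀ d {x w} → D₁ x → Closes d w → Closes d (x ++ w)
Closes-++ zero    p q = concat p q
Closes-++ (suc d) {x} p (u , v , refl , q , c) = x ++ u , v , sym (++-assoc x u (closing ∷ v)) , concat p q , c

Balanced⇒Closes : ∀ d w → Balanced d w → Closes d w
Balanced⇒Closes zero    []             b = empty
Balanced⇒Closes d       (zero ∷ w)     b with Balanced⇒Closes (suc d) w b
-- The new ⟨ is matched with the first unmatched ⟩ of the rest.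
... | u , v , refl , p , c = subst (Closes d) (cong (opening ∷_) (++-assoc u (closing ∷ []) v)) (Closes-++ d (wrap p) c)
Balanced⇒Closes zero    (suc zero ∷ w) ()
Balanced⇒Closes (suc d) (suc zero ∷ w) b = [] , w , refl , empty , Balanced⇒Closes d w b

D₁⇔Balanced : ∀ w → D₁ w ⇔ Balanced 0 w
D₁⇔Balanced w = mk⇔ (λ p → subst (Balanced 0) (++-identityʳ w) (Balanced-++ p 0 [] _)) (Balanced⇒Closes 0 w)

data Spells : List (Fin 2) → Bool → Bool → Set where
  nought : Spells [] false false
  single-opening : Spells (opening ∷ []) true false
  single-closing : Spells (closing ∷ []) false true

NonNegative : ℕ → (Fin 2 → ℕ → Bool) → ℕ → Set
NonNegative d ρ n = (∀ y → y ≤ n → count (ρ closing) y ≤ d + count (ρ opening) y) ×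
                    count (ρ closing) n ≡ d + count (ρ opening) n

count-suc : ∀ ρ y → count ρ (suc y) ≡ bit (ρ 0) + count (ρ ∘ suc) y
count-suc ρ zero    = refl
count-suc ρ (suc y) = trans (cong (bit (ρ (suc y)) +_) (count-suc ρ y)) (swap (bit (ρ (suc y))) (bit (ρ 0)) _)
  where
  swap : ∀ a b c → a + (b + c) ≡ b + (a + c)
  swap = solve-∀

-- The hypothesis is one step of the counter, from `d` to `d′`, written additively.
NonNegative-suc : ∀ {d d′ ρ n} → bit (ρ closing 0) + d′ ≡ d + bit (ρ opening 0) →
                  NonNegative d′ (λ σ → ρ σ ∘ suc) n ⇔ NonNegative d ρ (suc n)
NonNegative-suc {d} {d′} {ρ} {n} eq = mk⇔
  (λ (p , e) → (λ { zero _ → z≤n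
                  ; (suc y) (s≤s y≤n) → subst₂ _≤_ (sym (closed y)) (sym (opened y)) (+-monoʳ-≤ k (p y y≤n)) }) ,
               trans (closed n) (trans (cong (k +_) e) (sym (opened n))))
  (λ (p , e) → (λ y y≤n → +-cancelˡ-≤ k _ _ (subst₂ _≤_ (closed y) (opened y) (p (suc y) (s≤s y≤n)))) ,
               +-cancelˡ-≡ k _ _ (trans (sym (closed n)) (trans e (opened n))))
  where
  k = bit (ρ closing 0)
  closed : ∀ y → count (ρ closing) (suc y) ≡ k + count (ρ closing ∘ suc) y
  closed = count-suc (ρ closing)
  opened : ∀ y → d + count (ρ opening) (suc y) ≡ k + (d′ + count (ρ opening ∘ suc) y)
  opened y = begin
    d + count (ρ opening) (suc y)                            ≡⟨ cong (d +_) (count-suc (ρ opening) y) ⟩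
    d + (bit (ρ opening 0) + count (ρ opening ∘ suc) y)      ≡⟨ sym (+-assoc d _ _) ⟩
    d + bit (ρ opening 0) + count (ρ opening ∘ suc) y        ≡⟨ cong (_+ count (ρ opening ∘ suc) y) (sym eq) ⟩
    k + d′ + count (ρ opening ∘ suc) y                       ≡⟨ +-assoc k d′ _ ⟩
    k + (d′ + count (ρ opening ∘ suc) y)                     ∎
    where open ≡-Reasoning

-- General in `f` and `d` because the induction strips the first position, which shifts the
-- enumeration and changes the counter.
Balanced-⇔ : ∀ {A : Set} {n} (f : Fin n → A) (ls : A → List (Fin 2)) (ρ : Fin 2 → ℕ → Bool) →
             (∀ i → Spells (ls (f i)) (ρ opening (toℕ i)) (ρ closing (toℕ i))) →
             ∀ d → Balanced d (concatMap ls (tabulate f)) ⇔ NonNegative d ρ n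
Balanced-⇔ {n = zero} f ls ρ spells zero    = mk⇔ (λ _ → (λ { zero z≤n → z≤n }) , refl) _
Balanced-⇔ {n = zero} f ls ρ spells (suc d) = mk⇔ (λ ()) (λ { (_ , ()) })
Balanced-⇔ {n = suc n} f ls ρ spells d
  with ls (f zero) | ρ opening 0 in eo | ρ closing 0 in ec | spells zero
... | _ | _ | _ | nought =
  mk⇔ (to step ∘ to rec) (from rec ∘ from step)
  where
  rec = Balanced-⇔ (f ∘ suc) ls (λ σ → ρ σ ∘ suc) (spells ∘ suc) d
  step = NonNegative-suc {d} {d} {ρ} (trans (cong (λ b → bit b + d) ec) (sym (trans (cong (λ b → d + bit b) eo) (+-identityʳ d))))
... | _ | _ | _ | single-opening =
  mk⇔ (to step ∘ to rec) (from rec ∘ from step)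
  where
  rec = Balanced-⇔ (f ∘ suc) ls (λ σ → ρ σ ∘ suc) (spells ∘ suc) (suc d)
  step = NonNegative-suc {d} {suc d} {ρ} (trans (cong (λ b → bit b + suc d) ec) (sym (trans (cong (λ b → d + bit b) eo) (+-comm d 1))))
Balanced-⇔ {n = suc n} f ls ρ spells zero | _ | _ | _ | single-closing =
  mk⇔ (λ ()) (λ (p , _) → contradiction (subst₂ _≤_ (cong (λ b → bit b + 0) ec) (cong (λ b → bit b + 0) eo) (p 1 (s≤s z≤n))) 1+n≰n)
Balanced-⇔ {n = suc n} f ls ρ spells (suc d) | _ | _ | _ | single-closing =
  mk⇔ (to step ∘ to rec) (from rec ∘ from step)
  where
  rec = Balanced-⇔ (f ∘ suc) ls (λ σ → ρ σ ∘ suc) (spells ∘ suc) d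
  step = NonNegative-suc {suc d} {d} {ρ} (trans (cong (λ b → bit b + d) ec) (sym (trans (cong (λ b → suc d + bit b) eo) (+-identityʳ (suc d)))))

-- The program

auxSchema : Schema
auxSchema = record { #rel = 2 ; #fun = 7 ; relAr = λ _ → 1 ; funAr = λ _ → 2 }

noProblems : Fin 0 → Problem
noProblems ()

noSignatures : Fin 0 → Signature
noSignatures = sig ∘ noProblems

V : Vocabulary
V = vocabulary auxSchema ∅ noSignatures

-- Every auxiliary function has arity 2; the second argument of ˡ, ⁺ and ⁻ is a dummy.
--   s x j    start of the block of level j that contains x
--   ˡ j      length of the blocks of level j
--   ⁺ , ⁻    successor and predecessor
--   μ j s    level at s minus the minimal level in the block of level j that starts at s
--   κ σ q u  number of letters σ between the start of the parent block, of level q, and u;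
--            the unused cell (0 , 0) holds the number of letters σ at positions ≥ 1
pattern s# = zero
pattern ˡ# = suc zero
pattern ⁺# = suc (suc zero)
pattern ⁻# = suc (suc (suc zero))
pattern μ# = suc (suc (suc (suc zero)))
pattern κ# σ = suc (suc (suc (suc (suc σ))))

module _ {k : ℕ} where

  apply : Fin 7 → Term V k → Term V k → Term V k
  apply f t u = auxFun f (t ∷ u ∷ [])

  letter : Fin 2 → Term V k → Cond V k
  letter σ t = auxRel σ (t ∷ [])

  isZeroᶜ : Term V k → Cond V k
  isZeroᶜ t = t ⊕ t ≐ t

  pre post lenᵗ : Term V k → Term V k
  pre  t = apply ⁻# t t
  post t = apply ⁺# t t
  lenᵗ t = apply ˡ# t t

  child : (i q c : Term V k) → Term V k
  child i q c = apply s# i q ⊕ c ⊗ lenᵗ (pre q)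

  sameParent : (i q u : Term V k) → Cond V k
  sameParent i q u = apply s# u q ≐ apply s# i q

  attains : (q u : Term V k) → Cond V k
  attains q u = apply (κ# opening) q u ⊕ apply μ# q (apply s# u q) ≐
                apply (κ# closing) q u ⊕ apply μ# (pre q) u

  beside : Side → (i q u : Term V k) → Cond V k
  beside left  i q u = ¬′ (apply s# i (pre q) ≼ u)
  beside right i q u = ¬′ (u ≼ apply s# i (pre q))

childAt : ∀ {k} → (i q : Fin k) → Term V (suc k)
childAt i q = child (var (suc i)) (var (suc q)) (var zero)

-- `sameParent` discards indices beyond the last child. Being a positive atom, it also fails for
-- children outside the domain, on which the negated atom in `beside` would hold.
childHasMin : ∀ {k} → Side → (i q : Fin k) → Cond V (suc k)
childHasMin σ i q = sameParent (var (suc i)) (var (suc q)) (childAt i q) ∧′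
  beside σ (var (suc i)) (var (suc q)) (childAt i q) ∧′ attains (var (suc q)) (childAt i q)

childMinOn : ∀ {k} → Side → (i q : Fin k) → Cond V k
childMinOn σ i q = exists levels (childHasMin σ i q)

-- The search may end at level 0, where the block is `i` alone: its minimum is at a position `≤ i`,
-- and there is none after `i`.
entry : ∀ {k} → Side → (i q : Fin k) → Cond V k
entry left  i q = isZeroᶜ (var q) ∨′ childMinOn left i q
entry right i q = ¬′ isZeroᶜ (var q) ∧′ childMinOn right i q

-- The block of level q - 1 around i misses the minimum of the block of level q, for some l < q ≤ j.
broken : ∀ {k} → (i j l : Fin k) → Cond V (suc k)
broken i j l = (¬′ (var zero ≼ var (suc l)) ∧′ var zero ≼ var (suc j)) ∧′
               ¬′ attains (var zero) (apply s# (var (suc i)) (pre (var zero)))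

chain : ∀ {k} → Side → (i j : Fin k) → Cond V (suc k)
chain σ i j = (var zero ≼ var (suc j) ∧′ entry σ (suc i) zero) ∧′
              ¬′ exists levels (broken (suc i) (suc j) zero)

minOn : ∀ {k} → Side → (i j : Fin k) → Cond V k
minOn σ i j = exists levels (chain σ i j)

module _ {k : ℕ} where

  -- The letter of the change is known when the rule is formed, so it is compared by an `if` outside
  -- the syntax. Setting a letter acts on empty positions only.
  inserts deletes : Fin 3 → Fin 2 → Term V k → Cond V k
  inserts zero    σ p = ¬′ ⊤′
  inserts (suc τ) σ p = if does (τ ≟ σ) then ¬′ letter opening p ∧′ ¬′ letter closing p else ¬′ ⊤′
  deletes zero    σ p = letter σ p
  deletes (suc τ) σ p = ¬′ ⊤′

  raises lowers : Fin 3 → Term V k → Cond V k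
  raises δ p = inserts δ opening p ∨′ deletes δ closing p
  lowers δ p = inserts δ closing p ∨′ deletes δ opening p

  adjust : (up down : Cond V k) → Term V k → Term V k
  adjust up down t = ite up (post t) (ite down (pre t) t)

dropTerm : Fin 3 → Term V 2
dropTerm δ = ite (raises δ i) (ite (minOn left zero (suc zero)) m (pre m))
               (ite (lowers δ i) (ite (minOn right zero (suc zero)) (post m) m) m)
  where
  i = var zero
  m = apply μ# (var (suc zero)) (apply s# i (var (suc zero)))

-- Level 0 has no children, so `q = 0` stands for the cell of the totals, for every `c`.
cell : Term V 3
cell = ite (isZeroᶜ (var (suc zero))) (var (suc zero)) (child (var zero) (var (suc zero)) (var (suc (suc zero))))

-- States that `i` lies in the interval counted by the cell. The index `c` may run past the last
-- child; the cell then belongs to another parent and receives its old value.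
affected : Term V 3 → Cond V 3
affected u = (isZeroᶜ q ∧′ ¬′ isZeroᶜ i) ∨′ (¬′ isZeroᶜ q ∧′ (sameParent i q u ∧′ ¬′ (u ≼ i)))
  where
  i = var zero
  q = var (suc zero)

countTerm : Fin 3 → Fin 2 → Term V 3 → Term V 3
countTerm δ σ u = ite (affected u) (adjust (inserts δ σ (var zero)) (deletes δ σ (var zero)) old) old
  where old = apply (κ# σ) (var (suc zero)) u

module _ {May : Fin 0 → Set} where

  letterRule : Fin 3 → Fin 2 → UpdateRule auxSchema noSignatures May 1 1 Cond
  letterRule δ σ = record
    { #x = 0 ; constraint = [] ; at = var zero ∷ [] ; locals = ∅ ; initial = skip
    ; main = return ((letter σ (var zero) ∨′ inserts δ σ (var zero)) ∧′ ¬′ deletes δ σ (var zero)) }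

  -- Every auxiliary symbol must have an update rule; this one overwrites a single cell with the
  -- value already there.
  staticRule : Fin 7 → UpdateRule auxSchema noSignatures May 1 2 Term
  staticRule f = record
    { #x = 0 ; constraint = [] ; at = var zero ∷ var zero ∷ [] ; locals = ∅ ; initial = skip
    ; main = return (apply f (var zero) (var zero)) }

  dropRule : Fin 3 → UpdateRule auxSchema noSignatures May 1 2 Term
  dropRule δ = record
    { #x = 1 ; constraint = levels ∷ []
    ; at = var (suc zero) ∷ apply s# (var zero) (var (suc zero)) ∷ []
    ; locals = ∅ ; initial = skip ; main = return (dropTerm δ) }

  countRule : Fin 3 → Fin 2 → UpdateRule auxSchema noSignatures May 1 2 Term
  countRule δ σ = record
    { #x = 2 ; constraint = levels ∷ levels ∷ []
    ; at = var (suc zero) ∷ cell ∷ []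
    ; locals = ∅ ; initial = skip ; main = return (countTerm δ σ cell) }

-- z = 0 and t is the top level.
good : ∀ {k} → (z t : Fin k) → Cond V k
good z t = apply μ# (var t) (var z) ≐ var z ∧′ (¬′ letter closing (var z) ∧′
  -- The totals cover the positions from 1 on, so the letter at position 0 is added by cases.
  ((letter opening (var z) ∧′ (¬′ isZeroᶜ (total closing) ∧′ total opening ≐ pre (total closing))) ∨′
   (¬′ letter opening (var z) ∧′ total opening ≐ total closing)))
  where
  total : Fin 2 → Term V _
  total σ = apply (κ# σ) (var z) (var z)

-- Phrased as the absence of a failure, so that the empty domain accepts.
accepts : Cond V 0
accepts = ¬′ exists levels (isZeroᶜ (var zero) ∧′
  -- The top level is recognised as the largest element within the bound `levels`.
  exists levels (¬′ exists levels (¬′ (var zero ≼ var (suc zero))) ∧′ ¬′ good (suc zero) zero))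

initialFun : Fin 7 → Formula (wordSchema 2) 3
initialFun s#     = isStart (suc (suc zero)) (suc zero) zero
initialFun ˡ#     = isLen (suc zero) zero
initialFun ⁺#     = covers (suc zero) zero
initialFun ⁻#     = covers zero (suc zero)
initialFun μ#     = isZero (var zero)
initialFun (κ# σ) = isZero (var zero)

rules : Rules (memberSignature 2) auxSchema noSignatures
rules = record
  { initRel = λ _ → ¬′ ⊤′
  ; initFun = initialFun
  ; owner   = λ _ ()
  ; updRel  = λ δ σ → letterRule δ σ
  ; updFun  = λ { δ s# → staticRule s# ; δ ˡ# → staticRule ˡ# ; δ ⁺# → staticRule ⁺# ; δ ⁻# → staticRule ⁻#
                ; δ μ# → dropRule δ ; δ (κ# σ) → countRule δ σ }
  ; ansRel  = λ _ → record { locals = ∅ ; proc = return accepts }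
  ; ansFun  = λ ()
  }

noPrograms : ∀ i → Program (noProblems i)
noPrograms ()

member-D₁ : Program (Member D₁)
member-D₁ = program {Π = Member D₁} auxSchema noProblems noPrograms rules

-- Work

module _ (costs : ∀ i → Costs (noSignatures i)) (n : ℕ) where
  open Work {V = V} costs n

  F : ℕ
  F = factor n levels

  1≤F^ : ∀ d → 1 ≤ F ^ d
  1≤F^ zero    = ≤-refl
  1≤F^ (suc d) = *-mono-≤ (m≤m⊔n 1 (height n)) (1≤F^ d)

  -- A record instead of a bare inequality keeps the term visible as an index, so that costs compose
  -- along the syntax without naming the subterms.
  record TermCost (d : ℕ) {k} (t : Term V k) : Set where
    constructor term-cost
    field term≤ : workTerm t ≤ F ^ d

  record CondCost (d : ℕ) {k} (c : Cond V k) : Set where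
    constructor cond-cost
    field cond≤ : workCond c ≤ F ^ d

  open TermCost
  open CondCost

  module _ {d : ℕ} where
    private
      1⊔ : ∀ {m} → m ≤ F ^ d → 1 ⊔ m ≤ F ^ d
      1⊔ = ⊔-lub (1≤F^ d)

    module _ {k : ℕ} where

      var-cost : ∀ {x : Fin k} → TermCost d (Term.var x)
      var-cost = term-cost (1≤F^ d)

      apply-cost : ∀ {f} {t u : Term V k} → TermCost d t → TermCost d u → TermCost d (apply f t u)
      apply-cost (term-cost t) (term-cost u) = term-cost (1⊔ (⊔-lub t (⊔-lub u z≤n)))

      ⊕-cost : ∀ {t u : Term V k} → TermCost d t → TermCost d u → TermCost d (t ⊕ u)
      ⊕-cost (term-cost t) (term-cost u) = term-cost (1⊔ (⊔-lub t u))

      ⊗-cost : ∀ {t u : Term V k} → TermCost d t → TermCost d u → TermCost d (t ⊗ u)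
      ⊗-cost (term-cost t) (term-cost u) = term-cost (1⊔ (⊔-lub t u))

      ite-cost : ∀ {c} {t u : Term V k} → CondCost d c → TermCost d t → TermCost d u → TermCost d (ite c t u)
      ite-cost (cond-cost c) (term-cost t) (term-cost u) = term-cost (1⊔ (⊔-lub c (⊔-lub t u)))

      letter-cost : ∀ {σ} {t : Term V k} → TermCost d t → CondCost d (letter σ t)
      letter-cost (term-cost t) = cond-cost (1⊔ (⊔-lub t z≤n))

      ≐-cost : ∀ {t u : Term V k} → TermCost d t → TermCost d u → CondCost d (t ≐ u)
      ≐-cost (term-cost t) (term-cost u) = cond-cost (1⊔ (⊔-lub t u))

      ≼-cost : ∀ {t u : Term V k} → TermCost d t → TermCost d u → CondCost d (t ≼ u)
      ≼-cost (term-cost t) (term-cost u) = cond-cost (1⊔ (⊔-lub t u))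

      ⊤-cost : CondCost d {k} ⊤′
      ⊤-cost = cond-cost (1≤F^ d)

      ¬-cost : ∀ {c : Cond V k} → CondCost d c → CondCost d (¬′ c)
      ¬-cost (cond-cost c) = cond-cost (1⊔ c)

      ∧-cost : ∀ {c c′ : Cond V k} → CondCost d c → CondCost d c′ → CondCost d (c ∧′ c′)
      ∧-cost (cond-cost c) (cond-cost c′) = cond-cost (1⊔ (⊔-lub c c′))

      ∨-cost : ∀ {c c′ : Cond V k} → CondCost d c → CondCost d c′ → CondCost d (c ∨′ c′)
      ∨-cost (cond-cost c) (cond-cost c′) = cond-cost (1⊔ (⊔-lub c c′))

      exists-cost : ∀ {c : Cond V (suc k)} → CondCost d c → CondCost (suc d) (exists levels c)
      exists-cost (cond-cost c) = cond-cost (*-monoʳ-≤ F c)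

  module _ {d k : ℕ} where

    isZero-cost : {t : Term V k} → TermCost d t → CondCost d (isZeroᶜ t)
    isZero-cost t = ≐-cost (⊕-cost t t) t

    child-cost : {i q c : Term V k} → TermCost d i → TermCost d q → TermCost d c → TermCost d (child i q c)
    child-cost i q c = ⊕-cost (apply-cost i q) (⊗-cost c (apply-cost (apply-cost q q) (apply-cost q q)))

    attains-cost : {q u : Term V k} → TermCost d q → TermCost d u → CondCost d (attains q u)
    attains-cost q u = ≐-cost (⊕-cost (apply-cost q u) (apply-cost q (apply-cost u q)))
                              (⊕-cost (apply-cost q u) (apply-cost (apply-cost q q) u))

    beside-cost : ∀ σ {i q u : Term V k} → TermCost d i → TermCost d q → TermCost d u → CondCost d (beside σ i q u)
    beside-cost left  i q u = ¬-cost (≼-cost (apply-cost i (apply-cost q q)) u)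
    beside-cost right i q u = ¬-cost (≼-cost u (apply-cost i (apply-cost q q)))

    inserts-cost : ∀ δ σ {p : Term V k} → TermCost d p → CondCost d (inserts δ σ p)
    inserts-cost zero    σ p = ¬-cost ⊤-cost
    inserts-cost (suc τ) σ p with does (τ ≟ σ)
    ... | true  = ∧-cost (¬-cost (letter-cost p)) (¬-cost (letter-cost p))
    ... | false = ¬-cost ⊤-cost

    deletes-cost : ∀ δ σ {p : Term V k} → TermCost d p → CondCost d (deletes δ σ p)
    deletes-cost zero    σ p = letter-cost p
    deletes-cost (suc τ) σ p = ¬-cost ⊤-cost

  childMinOn-cost : ∀ {d k} σ (i q : Fin k) → CondCost (suc d) (childMinOn σ i q)
  childMinOn-cost σ i q = exists-cost (∧-cost (≐-cost (apply-cost u var-cost) (apply-cost var-cost var-cost))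
    (∧-cost (beside-cost σ var-cost var-cost u) (attains-cost var-cost u)))
    where u = child-cost var-cost var-cost var-cost

  entry-cost : ∀ {d k} σ (i q : Fin k) → CondCost (suc d) (entry σ i q)
  entry-cost left  i q = ∨-cost (isZero-cost var-cost) (childMinOn-cost left i q)
  entry-cost right i q = ∧-cost (¬-cost (isZero-cost var-cost)) (childMinOn-cost right i q)

  -- The search over children and the search for a broken level stand side by side under the search
  -- for `l`, so only two bounds multiply.
  minOn-cost : ∀ {d k} σ (i j : Fin k) → CondCost (2 + d) (minOn σ i j)
  minOn-cost σ i j = exists-cost (∧-cost (∧-cost (≼-cost var-cost var-cost) (entry-cost σ (suc i) zero))
    (¬-cost (exists-cost (∧-cost (∧-cost (¬-cost (≼-cost var-cost var-cost)) (≼-cost var-cost var-cost))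
      (¬-cost (attains-cost var-cost (apply-cost var-cost (apply-cost var-cost var-cost))))))))

  letterRule-cost : ∀ {d} δ σ → CondCost d ((letter σ (Term.var {k = 1} zero) ∨′ inserts δ σ (var zero)) ∧′ ¬′ deletes δ σ (var zero))
  letterRule-cost δ σ = ∧-cost (∨-cost (letter-cost var-cost) (inserts-cost δ σ var-cost)) (¬-cost (deletes-cost δ σ var-cost))

  dropTerm-cost : ∀ δ → TermCost 2 (dropTerm δ)
  dropTerm-cost δ = ite-cost (∨-cost (inserts-cost δ opening var-cost) (deletes-cost δ closing var-cost))
      (ite-cost (minOn-cost left zero (suc zero)) m (apply-cost m m))
      (ite-cost (∨-cost (inserts-cost δ closing var-cost) (deletes-cost δ opening var-cost))
        (ite-cost (minOn-cost right zero (suc zero)) (apply-cost m m) m) m)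
    where m = apply-cost var-cost (apply-cost var-cost var-cost)

  cell-cost : ∀ {d} → TermCost d cell
  cell-cost = ite-cost (isZero-cost var-cost) var-cost (child-cost var-cost var-cost var-cost)

  countTerm-cost : ∀ {d} δ σ → TermCost d (countTerm δ σ cell)
  countTerm-cost δ σ = ite-cost
      (∨-cost (∧-cost (isZero-cost var-cost) (¬-cost (isZero-cost var-cost)))
              (∧-cost (¬-cost (isZero-cost var-cost))
                (∧-cost (≐-cost (apply-cost cell-cost var-cost) (apply-cost var-cost var-cost)) (¬-cost (≼-cost cell-cost var-cost)))))
      (ite-cost (inserts-cost δ σ var-cost) (apply-cost old old) (ite-cost (deletes-cost δ σ var-cost) (apply-cost old old) old))
      old
    where old = apply-cost var-cost cell-cost

  accepts-cost : CondCost 3 accepts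
  accepts-cost = ¬-cost (exists-cost (∧-cost (isZero-cost var-cost)
    (exists-cost (∧-cost (¬-cost (exists-cost (¬-cost (≼-cost var-cost var-cost))))
      (¬-cost (∧-cost (≐-cost (apply-cost var-cost var-cost) var-cost)
        (∧-cost (¬-cost (letter-cost var-cost))
          (∨-cost (∧-cost (letter-cost var-cost) (∧-cost (¬-cost (isZero-cost total)) (≐-cost total (apply-cost total total))))
                  (∧-cost (¬-cost (letter-cost var-cost)) (≐-cost total total))))))))))
    where
    total : ∀ {σ} → TermCost 1 (apply (κ# σ) (Term.var {k = 2} (suc zero)) (var (suc zero)))
    total = apply-cost var-cost var-cost

  private
    scale₁ : ∀ {a} → a ≤ F ^ 2 → (F * 1) * a ≤ F ^ 3
    scale₁ a≤ = ≤-trans (≤-reflexive (cong (_* _) (*-identityʳ F))) (*-monoʳ-≤ F a≤)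

    scale₂ : ∀ {a} → a ≤ F ^ 1 → (F * (F * 1)) * a ≤ F ^ 3
    scale₂ {a} a≤ = ≤-trans (≤-reflexive (*-assoc F (F * 1) a)) (*-monoʳ-≤ F (≤-trans (≤-reflexive (cong (_* a) (*-identityʳ F))) (*-monoʳ-≤ F a≤)))

    scale₀ : ∀ {a} → a ≤ F ^ 3 → 1 * a ≤ F ^ 3
    scale₀ a≤ = ≤-trans (≤-reflexive (*-identityˡ _)) a≤

    args≤ : ∀ {d k} {t u : Term V k} → TermCost d t → TermCost d u → workTerms (t ∷ u ∷ []) ≤ F ^ d
    args≤ (term-cost t) (term-cost u) = ⊔-lub t (⊔-lub u z≤n)

    distribute : ∀ c {w a} → c * w ≤ F ^ 3 → c * a ≤ F ^ 3 → 1 ⊔ c * (w ⊔ a) ≤ F ^ 3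
    distribute c {w} {a} cw ca = ⊔-lub (1≤F^ 3) (≤-trans (≤-reflexive (*-distribˡ-⊔ c w a)) (⊔-lub cw ca))

    static≤ : ∀ f → 1 ⊔ 1 * (workTerm (apply {1} f (var zero) (var zero)) ⊔ workTerms {1} (var zero ∷ var zero ∷ [])) ≤ F ^ 3
    static≤ f = distribute 1 (scale₀ (term≤ {3} {t = apply {1} f (var zero) (var zero)} (apply-cost var-cost var-cost)))
                             (scale₀ (args≤ {3} {1} {var zero} {var zero} var-cost var-cost))

  updRel≤ : ∀ δ σ → workUpdRel rules costs n δ σ ≤ F ^ 3
  updRel≤ δ σ = distribute 1 (scale₀ (cond≤ (letterRule-cost {3} δ σ))) (scale₀ {1} (1≤F^ 3))

  updFun≤ : ∀ δ f → workUpdFun rules costs n δ f ≤ F ^ 3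
  updFun≤ δ s# = static≤ s#
  updFun≤ δ ˡ# = static≤ ˡ#
  updFun≤ δ ⁺# = static≤ ⁺#
  updFun≤ δ ⁻# = static≤ ⁻#
  updFun≤ δ μ# = distribute (F * 1) (scale₁ (term≤ (dropTerm-cost δ)))
    (scale₁ (args≤ {2} {2} {var (suc zero)} {apply s# (var zero) (var (suc zero))} var-cost (apply-cost var-cost var-cost)))
  updFun≤ δ (κ# σ) = distribute (F * (F * 1)) (scale₂ (term≤ (countTerm-cost {1} δ σ)))
    (scale₂ (args≤ {1} {3} {var (suc zero)} {cell} var-cost cell-cost))

  ansRel≤ : ∀ q → workAnsRel rules costs n q ≤ F ^ 3
  ansRel≤ q = cond≤ accepts-cost

F≤log : ∀ {n} → 2 ≤ n → factor n levels ≤ 4 * ⌊log₂ n ⌋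
F≤log {n} 2≤n = ⊔-lub (≤-trans 1≤log (m≤n*m ⌊log₂ n ⌋ 4)) (begin
  height n                            ≤⟨ height≤log n ⟩
  2 * ⌊log₂ n ⌋ + 2                   ≤⟨ +-monoʳ-≤ (2 * ⌊log₂ n ⌋) (*-monoʳ-≤ 2 1≤log) ⟩
  2 * ⌊log₂ n ⌋ + 2 * ⌊log₂ n ⌋       ≡⟨ sym (*-distribʳ-+ ⌊log₂ n ⌋ 2 2) ⟩
  4 * ⌊log₂ n ⌋                       ∎)
  where
  open ≤-Reasoning
  1≤log : 1 ≤ ⌊log₂ n ⌋
  1≤log = ⌊log₂⌋-mono-≤ 2≤n

cubic : ∀ {h : ℕ → ℕ} → (∀ n → h n ≤ factor n levels ^ 3) → h ∈𝒪 (λ n → ⌊log₂ n ⌋ ^ 3)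
-- 64 is `4 ^ 3` from `F≤log`; from `n = 2` on the logarithm is positive and absorbs the additive
-- constant in the bound on the height.
cubic h≤ = 64 , 2 , λ n 2≤n → ≤-trans (h≤ n) (≤-trans (^-monoˡ-≤ 3 (F≤log 2≤n)) (≤-reflexive (cube ⌊log₂ n ⌋)))
  where
  cube : ∀ a → 4 * a * (4 * a * (4 * a * 1)) ≡ 64 * (a * (a * (a * 1)))
  cube = solve-∀

member-D₁-work : HasWork member-D₁ (λ n → ⌊log₂ n ⌋ ^ 3)
member-D₁-work = (λ δ σ → cubic λ n → updRel≤ _ n δ σ) , (λ δ f → cubic λ n → updFun≤ _ n δ f) ,
                 (λ q → cubic λ n → ansRel≤ (λ ()) n q) , λ ()

-- Evaluation of the conditions

record Static {n} (𝒜 : Structure auxSchema n) : Set where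
  field
    start-spec : ∀ x j → fun 𝒜 s# (x ∷ j ∷ []) ↦ st (toℕ j) (toℕ x)
    len-spec   : ∀ j d → len (toℕ j) < n → fun 𝒜 ˡ# (j ∷ d ∷ []) ↦ len (toℕ j)
    post-spec  : ∀ x d → suc (toℕ x) < n → fun 𝒜 ⁺# (x ∷ d ∷ []) ↦ suc (toℕ x)
    pre-spec   : ∀ x d {m} → toℕ x ≡ suc m → fun 𝒜 ⁻# (x ∷ d ∷ []) ↦ m

Between : (ℕ → ℕ) → ℕ → ℕ → ℕ → Set
Between C a b m = m + C a ≡ C b

-- The letters are total predicates on ℕ, so that counts and heights need no membership in the
-- domain. Drops and counts are specified at starts of blocks only; what other cells contain is left
-- open.
record Invariant {n} (𝒜 : Structure auxSchema n) (ρ : Fin 2 → ℕ → Bool) : Set where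
  field
    static      : Static 𝒜
    letter-spec : ∀ σ x → rel 𝒜 σ (x ∷ []) ≡ ρ σ (toℕ x)
    drop-spec   : ∀ j s → toℕ j ≤ height n → st (toℕ j) (toℕ s) ≡ toℕ s →
                  ∃[ m ] fun 𝒜 μ# (j ∷ s ∷ []) ↦ m × Drop n (level n ρ) (toℕ j) (toℕ s) m
    count-spec  : ∀ σ q u {r} → toℕ q ≡ suc r → toℕ q ≤ height n → st r (toℕ u) ≡ toℕ u →
                  ∃[ m ] fun 𝒜 (κ# σ) (q ∷ u ∷ []) ↦ m × Between (count (ρ σ)) (st (toℕ q) (toℕ u)) (toℕ u) m
    -- The count starts at 1 because a count over all positions may be `n`, which is no element.
    total-spec  : ∀ σ z → toℕ z ≡ 0 →
                  ∃[ m ] fun 𝒜 (κ# σ) (z ∷ z ∷ []) ↦ m × Between (count (ρ σ)) 1 n m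

↦-fin : ∀ {n m} {x : Maybe (Fin n)} {v} → x ↦ m → toℕ v ≡ m → x ≡ just v
↦-fin (w , eq , w≡m) v≡m = trans eq (cong just (toℕ-injective (trans w≡m (sym v≡m))))

module Evaluation {n} {𝒜 : Structure auxSchema n} (M : Machines noSignatures n) (I : ∀ i → Machines.St M i) where
  open Semantics {V = V} M 𝒜 public

  s₀ : Config
  s₀ = config emptyStructure I

  term : ∀ {k} → Tuple n k → Term V k → Maybe (Fin n)
  term = evalTerm s₀

  cond : ∀ {k} → Tuple n k → Cond V k → Bool
  cond = evalCond s₀

  exists-⇔ : ∀ {k} {e : Tuple n k} {c} {P : Fin n → Set} →
             (∀ z → toℕ z ≤ height n → T (cond (z ∷ e) c) ⇔ P z) →
             T (cond e (exists levels c)) ⇔ (∃[ z ] toℕ z ≤ height n × P z)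
  exists-⇔ p = any-⇔ (range-⇔ levels) p

  ite-elim : ∀ {k} {e : Tuple n k} {P} c t u (Q : Maybe (Fin n) → Set) → T (cond e c) ⇔ P →
             (P → Q (term e t)) → (¬ P → Q (term e u)) → Q (term e (ite c t u))
  ite-elim {e = e} c t u Q = if-⇔ {cond e c} {x = term e t} {term e u} Q

  module _ {k} {e : Tuple n k} where

    apply≡ : ∀ {f t u} {a b : Fin n} → term e t ≡ just a → term e u ≡ just b → term e (apply f t u) ≡ fun 𝒜 f (a ∷ b ∷ [])
    apply≡ t≡ u≡ rewrite t≡ | u≡ = refl

    apply-nothing : ∀ {f t u} → term e t ≡ nothing → term e (apply f t u) ≡ nothing
    apply-nothing t≡ rewrite t≡ = refl

  module _ (static : Static 𝒜) {k} {e : Tuple n k} where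
    open Static static

    start-↦ : ∀ {t u x j} → term e t ↦ x → term e u ↦ j → term e (apply s# t u) ↦ st j x
    start-↦ {t} {u} (a , t≡ , refl) (b , u≡ , refl) = subst (_↦ _) (sym (apply≡ {f = s#} {t} {u} t≡ u≡)) (start-spec a b)

    len-↦ : ∀ {t j} → term e t ↦ j → len j < n → term e (lenᵗ t) ↦ len j
    len-↦ {t} (b , t≡ , refl) l<n = subst (_↦ _) (sym (apply≡ {f = ˡ#} {t} {t} t≡ t≡)) (len-spec b b l<n)

    post-↦ : ∀ {t m} → term e t ↦ m → suc m < n → term e (post t) ↦ suc m
    post-↦ {t} (b , t≡ , refl) m<n = subst (_↦ _) (sym (apply≡ {f = ⁺#} {t} {t} t≡ t≡)) (post-spec b b m<n)

    pre-↦ : ∀ {t m} → term e t ↦ suc m → term e (pre t) ↦ m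
    pre-↦ {t} (b , t≡ , b≡) = subst (_↦ _) (sym (apply≡ {f = ⁻#} {t} {t} t≡ t≡)) (pre-spec b b b≡)

    -- An undefined candidate must be shown to lie outside the domain, so that no real child is
    -- missed. The length `len r` is always available, as `r` is below the top level.
    child-↦ : ∀ {i q c x r d} → term e i ↦ x → term e q ↦ suc r → suc r ≤ height n → term e c ↦ d →
              (term e (child i q c) ↦ st (suc r) x + d * len r) ⊎
              (term e (child i q c) ≡ nothing × ¬ (st (suc r) x + d * len r < n))
    child-↦ {i} {q} {c} {x} {r} {d} i↦ q↦ q≤h c↦ with st (suc r) x + d * len r <? n
    ... | yes u<n = inj₁ (plus-↦ (start-↦ {i} {q} i↦ q↦) (times-↦ c↦ l↦ (≤-<-trans (m≤n+m _ (st (suc r) x)) u<n)) u<n)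
      where l↦ = len-↦ {pre q} (pre-↦ {q} q↦) (len<n q≤h)
    ... | no ¬u<n with term e (child i q c) in eq
    ... | nothing = inj₂ (refl , ¬u<n)
    ... | just u with plus-inv {x = term e (apply s# i q)} eq
    ... | a , b , a↦ , b↦@(_ , times≡ , _) , u≡ with times-inv {x = term e c} times≡
    ... | d′ , l′ , d′↦ , l′↦ , b≡ = contradiction (subst (_< n) sum≡ (toℕ<n u)) ¬u<n
      where
      l↦ = len-↦ {pre q} (pre-↦ {q} q↦) (len<n q≤h)
      sum≡ : toℕ u ≡ st (suc r) x + d * len r
      sum≡ = trans u≡ (cong₂ _+_ (↦-unique a↦ (start-↦ {i} {q} i↦ q↦))
               (trans (↦-unique b↦ (_ , times≡ , b≡)) (cong₂ _*_ (↦-unique d′↦ c↦) (↦-unique l′↦ l↦))))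

  module _ {ρ} (inv : Invariant 𝒜 ρ) where
    open Invariant inv
    private
      H = level n ρ

    module _ {k} {e : Tuple n k} where

      letter-eval : ∀ {σ t x} → term e t ↦ x → cond e (letter σ t) ≡ ρ σ x
      letter-eval {σ} {t} (a , t≡ , refl) rewrite t≡ = letter-spec σ a

      drop-↦ : ∀ {t u j s} → term e t ↦ j → term e u ↦ s → j ≤ height n → st j s ≡ s →
               ∃[ m ] term e (apply μ# t u) ↦ m × Drop n H j s m
      drop-↦ {t} {u} (a , t≡ , refl) (b , u≡ , refl) j≤h fix with drop-spec a b j≤h fix
      ... | m , ↦m , d = m , subst (_↦ m) (sym (apply≡ {f = μ#} {t} {u} t≡ u≡)) ↦m , d

      count-↦ : ∀ σ {t u r x} → term e t ↦ suc r → term e u ↦ x → suc r ≤ height n → st r x ≡ x →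
                ∃[ m ] term e (apply (κ# σ) t u) ↦ m × Between (count (ρ σ)) (st (suc r) x) x m
      count-↦ σ {t} {u} {r} (a , t≡ , a≡) (b , u≡ , refl) q≤h fix with count-spec σ a b a≡ (subst (_≤ height n) (sym a≡) q≤h) fix
      ... | m , ↦m , d = m , subst (_↦ m) (sym (apply≡ {f = κ# σ} {t} {u} t≡ u≡)) ↦m ,
                         subst (λ q → Between (count (ρ σ)) (st q (toℕ b)) (toℕ b) m) a≡ d

      attains-eval : ∀ {t u r x} → term e t ↦ suc r → term e u ↦ x → suc r ≤ height n → st r x ≡ x →
                     T (cond e (attains t u)) ⇔ Attains n H (suc r) (st (suc r) x) r x
      attains-eval {t} {u} {r} {x} t↦ u↦ q≤h fix
        with count-↦ opening {t} {u} t↦ u↦ q≤h fix | count-↦ closing {t} {u} t↦ u↦ q≤h fix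
           | drop-↦ {t} {apply s# u t} t↦ (start-↦ static {t = u} {t} u↦ t↦) q≤h (st-idem (suc r) x)
           | drop-↦ {pre t} {u} (pre-↦ static {t = t} t↦) u↦ (≤-trans (n≤1+n r) q≤h) fix
      ... | o , o↦ , o≡ | c , c↦ , c≡ | μv , μv↦ , dv | μu , μu↦ , du =
        mk⇔ (to (attains-⇔ {n} ρ x<n refl o≡ c≡ dv du) ∘ to eq⇔)
            (from eq⇔ ∘ from (attains-⇔ {n} ρ x<n refl o≡ c≡ dv du))
        where
        x<n = ↦< u↦
        eq⇔ = equal-⇔ (plus-↦ o↦ μv↦ (opened+drop<n {n} ρ x<n refl o≡ c≡ dv du))
                      (plus-↦ c↦ μu↦ (closed+drop<n {n} ρ x<n refl o≡ c≡ dv du))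

      beside-eval : ∀ σ {i q u x r y} → term e i ↦ x → term e q ↦ suc r → term e u ↦ y →
                    T (cond e (beside σ i q u)) ⇔ BlockOnSide σ (st r x) y
      beside-eval left {i} {q} i↦ q↦ u↦ = mk⇔ (≰⇒> ∘ to le) (from le ∘ <⇒≱)
        where le = ¬-⇔ (leq-⇔ (start-↦ static {t = i} {pre q} i↦ (pre-↦ static {t = q} q↦)) u↦)
      beside-eval right {i} {q} i↦ q↦ u↦ = mk⇔ (≰⇒> ∘ to le) (from le ∘ <⇒≱)
        where le = ¬-⇔ (leq-⇔ u↦ (start-↦ static {t = i} {pre q} i↦ (pre-↦ static {t = q} q↦)))

    childMinOn-eval : ∀ {k} {e : Tuple n k} σ {i q r} (let x = toℕ (lookup e i)) → toℕ (lookup e q) ≡ suc r → suc r ≤ height n →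
                      T (cond e (childMinOn σ i q)) ⇔ ChildMinOn {n} {H} σ x (suc r) r
    childMinOn-eval {e = e} σ {i} {q} {r} q≡ q≤h = mk⇔
      (λ t → let (z , _ , (u<n , st≡ , bes , att)) = to ex t in
             st (suc r) x + toℕ z * len r , (u<n , st-fixed r (aligned z) , st≡) , bes ,
             subst (λ v → Attains n H (suc r) v r (st (suc r) x + toℕ z * len r)) st≡ att)
      complete
      where
      x = toℕ (lookup e i)
      Candidate : Fin n → Set
      Candidate z = let u = st (suc r) x + toℕ z * len r in
        u < n × st (suc r) u ≡ st (suc r) x × BlockOnSide σ (st r x) u × Attains n H (suc r) (st (suc r) u) r u
      aligned : ∀ (z : Fin n) → len r ∣ st (suc r) x + toℕ z * len r
      aligned z = ∣m∣n⇒∣m+n (∣-trans (len∣len-suc r) (len∣st (suc r) x)) (n∣m*n (toℕ z))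
      candidate : ∀ z → toℕ z ≤ height n → T (cond (z ∷ e) (childHasMin σ i q)) ⇔ Candidate z
      candidate z z≤h with child-↦ static {e = z ∷ e} {i = var (suc i)} {var (suc q)} {var zero}
                             (fin (lookup e i)) (lookup e q , refl , q≡) q≤h (fin z)
      ... | inj₁ u↦ = mk⇔ (λ t → ↦< u↦ , to conj t) (λ (_ , p) → from conj p)
        where
        u = childAt i q
        q↦ : term (z ∷ e) (var (suc q)) ↦ suc r
        q↦ = lookup e q , refl , q≡
        conj = equal-⇔ (start-↦ static {e = z ∷ e} {t = u} {var (suc q)} u↦ q↦)
                       (start-↦ static {e = z ∷ e} {t = var (suc i)} {var (suc q)} (fin (lookup e i)) q↦) ∧-⇔
               beside-eval {e = z ∷ e} σ {var (suc i)} {var (suc q)} {u} (fin (lookup e i)) q↦ u↦ ∧-⇔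
               attains-eval {e = z ∷ e} {var (suc q)} {u} q↦ u↦ q≤h (st-fixed r (aligned z))
      ... | inj₂ (u≡ , u≮n) = mk⇔ (λ t → ⊥-elim (undefined t)) (λ (u<n , _) → contradiction u<n u≮n)
        where
        u = childAt i q
        undefined : ¬ T (cond (z ∷ e) (childHasMin σ i q))
        undefined t with equal-inv {x = term (z ∷ e) (apply s# u (var (suc q)))} (proj₁ (to T-∧ t))
        ... | v , ≡just , _ = case trans (sym ≡just) (apply-nothing {e = z ∷ e} {s#} {u} {var (suc q)} u≡) of λ ()
      ex = exists-⇔ {e = e} {childHasMin σ i q} candidate
      complete : ChildMinOn {n} {H} σ x (suc r) r → T (cond e (childMinOn σ i q))
      complete (u , (u<n , fix , st≡) , bes , att) with child-offset r fix
      ... | d , d≤q , v+d≡u = from ex (z , subst (_≤ height n) (sym z≡) d≤h ,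
            subst (_< n) (sym u≡) u<n , trans (cong (st (suc r)) u≡) st≡ ,
            subst (BlockOnSide σ (st r x)) (sym u≡) bes ,
            subst₂ (λ v u → Attains n H (suc r) v r u) (sym (trans (cong (st (suc r)) u≡) st≡)) (sym u≡) att)
        where
        d≤h = ≤-trans d≤q q≤h
        d<n : d < n
        d<n = ≤-<-trans d≤h (height<n (≤-<-trans z≤n u<n))
        z = fromℕ< d<n
        z≡ = toℕ-fromℕ< d<n
        u≡ : st (suc r) x + toℕ z * len r ≡ u
        u≡ = trans (cong₂ (λ v d → v + d * len r) (sym st≡) z≡) v+d≡u

    isZero-eval : ∀ {k} {e : Tuple n k} {i x} → toℕ (lookup e i) ≡ x → T (cond e (isZeroᶜ (var i))) ⇔ (x ≡ 0)
    isZero-eval {e = e} {i} refl = zero-⇔ (fin (lookup e i))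

    Entry : Side → ℕ → ℕ → Set
    Entry left  x zero    = ⊤
    Entry right x zero    = ⊥
    Entry σ     x (suc r) = ChildMinOn {n} {H} σ x (suc r) r

    entry-eval : ∀ {k} {e : Tuple n k} σ {i q l} → toℕ (lookup e q) ≡ l → l ≤ height n →
                 T (cond e (entry σ i q)) ⇔ Entry σ (toℕ (lookup e i)) l
    entry-eval {e = e} left {i} {q} {zero} q≡ l≤h = mk⇔ _ (λ _ → from T-∨ (inj₁ (from (isZero-eval {e = e} {q} q≡) refl)))
    entry-eval {e = e} right {i} {q} {zero} q≡ l≤h = mk⇔
      (λ t → to T-not (proj₁ (to T-∧ t)) (from (isZero-eval {e = e} {q} q≡) refl)) (λ ())
    entry-eval {e = e} left {i} {q} {suc r} q≡ l≤h = mk⇔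
      (λ t → case to disj t of λ { (inj₁ ()) ; (inj₂ c) → c }) (from disj ∘ inj₂)
      where disj = isZero-eval {e = e} {q} q≡ ∨-⇔ childMinOn-eval {e = e} left {i} {q} q≡ l≤h
    entry-eval {e = e} right {i} {q} {suc r} q≡ l≤h = mk⇔ (proj₂ ∘ to conj) (λ c → from conj ((λ ()) , c))
      where conj = ¬-⇔ (isZero-eval {e = e} {q} q≡) ∧-⇔ childMinOn-eval {e = e} right {i} {q} q≡ l≤h

    -- Level 0 has no child; the value there agrees with `broken`, which is false at 0 since `l < 0`
    -- fails.
    PathAttains : ℕ → ℕ → Set
    PathAttains x zero    = ⊤
    PathAttains x (suc r) = Attains n H (suc r) (st (suc r) x) r (st r x)

    pathAttains-eval : ∀ {k} {e : Tuple n k} {i q r} (let x = toℕ (lookup e i)) → toℕ (lookup e q) ≡ suc r → suc r ≤ height n →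
                       T (cond e (attains (var q) (apply s# (var i) (pre (var q))))) ⇔ PathAttains x (suc r)
    pathAttains-eval {e = e} {i} {q} {r} q≡ q≤h =
      subst (λ v → T _ ⇔ Attains n H (suc r) v r (st r x)) (st-st r x)
        (attains-eval {e = e} {var q} {apply s# (var i) (pre (var q))} q↦
          (start-↦ static {e = e} {t = var i} {pre (var q)} (fin (lookup e i)) (pre-↦ static {e = e} {t = var q} q↦)) q≤h (st-idem r x))
      where
      x = toℕ (lookup e i)
      q↦ : term e (var q) ↦ suc r
      q↦ = lookup e q , refl , q≡

    module _ {k} {e : Tuple n k} {i j : Fin k} (j≤h : toℕ (lookup e j) ≤ height n) where
      private
        x = toℕ (lookup e i)
        J = toℕ (lookup e j)

      broken-eval : ∀ (l z : Fin n) → toℕ z ≤ height n →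
                    T (cond (z ∷ l ∷ e) (broken (suc i) (suc j) zero)) ⇔
                    ((toℕ l < toℕ z × toℕ z ≤ J) × ¬ PathAttains x (toℕ z))
      broken-eval l z z≤h = go (toℕ z) refl
        where
        e′ = z ∷ l ∷ e
        below = ¬-⇔ (leq-⇔ (fin z) (fin l)) ∧-⇔ leq-⇔ (fin z) (fin (lookup e j))
        go : ∀ m → toℕ z ≡ m → T (cond e′ (broken (suc i) (suc j) zero)) ⇔ ((toℕ l < m × m ≤ J) × ¬ PathAttains x m)
        go zero    z≡ = mk⇔ (λ t → contradiction (subst (_≤ toℕ l) (sym z≡) z≤n) (proj₁ (to below (proj₁ (to T-∧ t)))))
                            (λ (_ , ¬⊤) → ⊥-elim (¬⊤ _))
        go (suc r) z≡ = mk⇔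
          (λ t → let ((z≰l , z≤J) , ¬a) = to conj t in (subst (toℕ l <_) z≡ (≰⇒> z≰l) , subst (_≤ J) z≡ z≤J) , ¬a)
          (λ ((l<m , m≤J) , ¬a) → from conj ((<⇒≱ (subst (toℕ l <_) (sym z≡) l<m) , subst (_≤ J) (sym z≡) m≤J) , ¬a))
          where conj = below ∧-⇔ ¬-⇔ (pathAttains-eval {e = e′} {suc (suc i)} {zero} z≡ (subst (_≤ height n) z≡ z≤h))

      minOn-eval : ∀ σ → T (cond e (minOn σ i j)) ⇔ MinOn {n} {H} σ x J
      minOn-eval σ = mk⇔
        (λ t → let (l , _ , ((l≤J , ent) , unbroken)) = to ex t in
               from path (toℕ l , l≤J , ent , λ q l<q q≤J → intact l q l<q q≤J unbroken))
        (λ m → let (l , l≤J , ent , as) = to path m; l<n = ≤-<-trans l≤J (toℕ<n (lookup e j)); z≡ = toℕ-fromℕ< l<n in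
               from ex (fromℕ< l<n , subst (_≤ height n) (sym z≡) (≤-trans l≤J j≤h) ,
                 (subst (_≤ J) (sym z≡) l≤J , subst (Entry σ x) (sym z≡) ent) ,
                 λ (z , _ , ((l<z , z≤J) , ¬a)) → ¬a (as (toℕ z) (subst (_< toℕ z) z≡ l<z) z≤J)))
        where
        Unbroken : Fin n → Set
        Unbroken l = ¬ (∃[ z ] toℕ z ≤ height n × ((toℕ l < toℕ z × toℕ z ≤ J) × ¬ PathAttains x (toℕ z)))
        ex = exists-⇔ {e = e} {chain σ i j} λ l l≤h →
          (leq-⇔ (fin l) (fin (lookup e j)) ∧-⇔ entry-eval {e = l ∷ e} σ {suc i} {zero} refl l≤h) ∧-⇔
          ¬-⇔ (exists-⇔ {e = l ∷ e} {broken (suc i) (suc j) zero} (broken-eval l))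
        -- Passing from the absence of a broken level to attainment at each level needs
        -- decidability, which the evaluation of the condition supplies.
        intact : ∀ l q → toℕ l < q → q ≤ J → Unbroken l → PathAttains x q
        intact l zero    l<q q≤J unbroken = _
        intact l (suc r) l<q q≤J unbroken =
          go (decide (pathAttains-eval {e = z ∷ l ∷ e} {suc (suc i)} {zero} z≡ (≤-trans q≤J j≤h)))
          where
          q<n : suc r < n
          q<n = ≤-<-trans q≤J (toℕ<n (lookup e j))
          z = fromℕ< q<n
          z≡ = toℕ-fromℕ< q<n
          go : Dec (PathAttains x (suc r)) → PathAttains x (suc r)
          go (yes a) = a
          go (no ¬a) = contradiction (z , subst (_≤ height n) (sym z≡) (≤-trans q≤J j≤h) ,
            (subst (toℕ l <_) (sym z≡) l<q , subst (_≤ J) (sym z≡) q≤J) , subst (λ q → ¬ PathAttains x q) (sym z≡) ¬a) unbroken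
        path : MinOn {n} {H} σ x J ⇔ (∃[ l ] l ≤ J × Entry σ x l × (∀ q → l < q → q ≤ J → PathAttains x q))
        path = unroll (base σ) (λ r → suc-step σ r) J
          where
          base : ∀ σ → MinOn {n} {H} σ x 0 ⇔ Entry σ x 0
          base left  = mk⇔ _ λ _ → x , ≤-refl , (toℕ<n (lookup e i) , refl) ,
            λ z (_ , eq) → ≤-reflexive (cong H (trans (sym (st-zero x)) (trans (sym eq) (st-zero z))))
          base right = mk⇔ (λ (y , x<y , (_ , eq) , _) → <-irrefl (trans (sym (st-zero x)) (trans (sym eq) (st-zero y))) x<y) (λ ())
          suc-step : ∀ σ r → MinOn {n} {H} σ x (suc r) ⇔ (Entry σ x (suc r) ⊎ (PathAttains x (suc r) × MinOn {n} {H} σ x r))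
          suc-step left  = MinOn-suc {n} {H} left x
          suc-step right = MinOn-suc {n} {H} right x

-- Changes and update rules

pick : Fin 2 → Bool → Bool → Bool
pick zero       a b = a
pick (suc zero) a b = b

-- The effect of change δ on a position that carries ⟨ iff a and ⟩ iff b.
inserted deleted rewritten : Fin 3 → Fin 2 → Bool → Bool → Bool
inserted zero    σ a b = false
inserted (suc τ) σ a b = if does (τ ≟ σ) then not a ∧ not b else false
deleted zero    σ a b = pick σ a b
deleted (suc τ) σ a b = false
rewritten δ σ a b = (pick σ a b ∨ inserted δ σ a b) ∧ not (deleted δ σ a b)

raised lowered : Fin 3 → Bool → Bool → Bool
raised  δ a b = inserted δ opening a b ∨ deleted δ closing a b
lowered δ a b = inserted δ closing a b ∨ deleted δ opening a b

shift : Bool → Bool → Shift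
shift true  _     = inc
shift false true  = dec
shift false false = same

letterShift : Fin 3 → Fin 2 → Bool → Bool → Shift
letterShift δ σ a b = shift (inserted δ σ a b) (deleted δ σ a b)

bit-shifted : ∀ δ σ a b → Shifted (letterShift δ σ a b) (bit (pick σ a b)) (bit (rewritten δ σ a b))
bit-shifted zero σ a b with pick σ a b
... | true  = refl
... | false = refl
bit-shifted (suc τ) σ a b with does (τ ≟ σ)
bit-shifted (suc τ) σ a b | false with pick σ a b
... | true  = refl
... | false = refl
bit-shifted (suc τ) zero       true  b     | true = refl
bit-shifted (suc τ) zero       false true  | true = refl
bit-shifted (suc τ) zero       false false | true = refl
bit-shifted (suc τ) (suc zero) true  true  | true = refl
bit-shifted (suc τ) (suc zero) true  false | true = refl
bit-shifted (suc τ) (suc zero) false true  | true = refl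
bit-shifted (suc τ) (suc zero) false false | true = refl

-- Shifts of the counts of ⟨ and ⟩, and the resulting shift of the level.
data Combined : Shift → Shift → Shift → Set where
  nothing-changes : Combined same same same
  opening-gained  : Combined inc same inc
  closing-lost    : Combined same dec inc
  closing-gained  : Combined same inc dec
  opening-lost    : Combined dec same dec

-- A change moves at most one of the two counts. Resetting a position that carries both letters
-- would move both, which the hypothesis excludes.
combined : ∀ δ a b → ¬ (T a × T b) →
  Combined (letterShift δ opening a b) (letterShift δ closing a b) (shift (raised δ a b) (lowered δ a b))
combined δ                true  true  ¬ab = ⊥-elim (¬ab _)
combined zero             true  false ¬ab = opening-lost
combined zero             false true  ¬ab = closing-lost
combined zero             false false ¬ab = nothing-changes
combined (suc zero)       true  false ¬ab = nothing-changes
combined (suc zero)       false true  ¬ab = nothing-changes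
combined (suc zero)       false false ¬ab = opening-gained
combined (suc (suc zero)) true  false ¬ab = nothing-changes
combined (suc (suc zero)) false true  ¬ab = nothing-changes
combined (suc (suc zero)) false false ¬ab = closing-gained

count-shifted : ∀ {d x} {r r′ : ℕ → Bool} → (∀ y → y ≢ x → r′ y ≡ r y) → Shifted d (bit (r x)) (bit (r′ x)) →
                ShiftedAfter d x (count r) (count r′)
count-shifted {d} {x} {r} {r′} off on = before , after
  where
  before : ∀ y → y ≤ x → count r′ y ≡ count r y
  before zero    y≤x = refl
  before (suc y) y<x = cong₂ _+_ (cong bit (off y (<⇒≢ y<x))) (before y (<⇒≤ y<x))
  add : ∀ d {a a′} b → Shifted d a a′ → Shifted d (a + b) (a′ + b)
  add same b refl = refl
  add inc  b refl = refl
  add dec  b refl = refl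
  addʳ : ∀ d b {a a′} → Shifted d a a′ → Shifted d (b + a) (b + a′)
  addʳ d b {a} {a′} s = subst₂ (Shifted d) (+-comm a b) (+-comm a′ b) (add d b s)
  after : ∀ y → x < y → Shifted d (count r y) (count r′ y)
  after (suc y) (s≤s x≤y) with m≤n⇒m<n∨m≡n x≤y
  ... | inj₁ x<y  = subst (λ b → Shifted d (count r (suc y)) (bit b + count r′ y)) (sym (off y (<⇒≢ x<y ∘ sym)))
                      (addʳ d (bit (r y)) (after y x<y))
  ... | inj₂ refl = subst (λ c → Shifted d (count r (suc y)) (bit (r′ y) + c)) (sym (before y ≤-refl)) (add d (count r y) on)

-- The bounds on the counts keep the truncated subtraction in `level` exact.
level-shifted : ∀ {n d₀ d₁ d x ρ ρ′} → Combined d₀ d₁ d →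
  (∀ y → count (ρ closing) y ≤ n) → (∀ y → count (ρ′ closing) y ≤ n) →
  ShiftedAfter d₀ x (count (ρ opening)) (count (ρ′ opening)) →
  ShiftedAfter d₁ x (count (ρ closing)) (count (ρ′ closing)) →
  ShiftedAfter d x (level n ρ) (level n ρ′)
level-shifted {n} {d₀} {d₁} {d} {x} {ρ} {ρ′} comb c≤ c′≤ (before₀ , after₀) (before₁ , after₁) =
  (λ y y≤x → cong₂ _∸_ (cong (n +_) (before₀ y y≤x)) (before₁ y y≤x)) ,
  (λ y x<y → shifted comb (c≤ y) (c′≤ y) (after₀ y x<y) (after₁ y x<y))
  where
  more : ∀ {o c} → c ≤ n → n + suc o ∸ c ≡ suc (n + o ∸ c)
  more {o} {c} c≤n = trans (cong (_∸ c) (+-suc n o)) (+-∸-assoc 1 (≤-trans c≤n (m≤m+n n o)))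
  less : ∀ {o c} → suc c ≤ n → n + o ∸ c ≡ suc (n + o ∸ suc c)
  less {o} {c} c<n = +-∸-assoc 1 (≤-trans c<n (m≤m+n n o))
  shifted : ∀ {d₀ d₁ d o o′ c c′} → Combined d₀ d₁ d → c ≤ n → c′ ≤ n → Shifted d₀ o o′ → Shifted d₁ c c′ →
            Shifted d (n + o ∸ c) (n + o′ ∸ c′)
  shifted nothing-changes c≤n c′≤n refl refl = refl
  shifted opening-gained  c≤n c′≤n refl refl = more c≤n
  shifted closing-lost    c≤n c′≤n refl refl = less c≤n
  shifted closing-gained  c≤n c′≤n refl refl = less c′≤n
  shifted opening-lost    c≤n c′≤n refl refl = more c≤n

module _ {d x C C′ a b m} (shifted : ShiftedAfter d x C C′) (between : Between C a b m) where
  private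
    before = proj₁ shifted
    after  = proj₂ shifted

  between-hit : C′ a ≤ C′ b → a ≤ x → x < b → ∃[ m′ ] Shifted d m m′ × Between C′ a b m′
  between-hit C′a≤C′b a≤x x<b = go d (after b x<b)
    where
    C′a = before a a≤x
    go : ∀ d → Shifted d (C b) (C′ b) → ∃[ m′ ] Shifted d m m′ × Between C′ a b m′
    go same eq = m , refl , trans (cong (m +_) C′a) (trans between (sym eq))
    go inc  eq = suc m , refl , trans (cong (suc m +_) C′a) (trans (cong suc between) (sym eq))
    -- Monotonicity of `C′` guarantees that the old count was positive.
    go dec  eq = C′ b ∸ C′ a , +-cancelʳ-≡ (C a) _ _ (trans between (trans eq (cong suc
                   (sym (trans (cong (C′ b ∸ C′ a +_) (sym C′a)) (m∸n+n≡m C′a≤C′b)))))) , m∸n+n≡m C′a≤C′b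

  between-below : a ≤ x → b ≤ x → Between C′ a b m
  between-below a≤x b≤x = trans (cong (m +_) (before a a≤x)) (trans between (sym (before b b≤x)))

  between-above : x < a → x < b → Between C′ a b m
  between-above x<a x<b = go d (after a x<a) (after b x<b)
    where
    go : ∀ d → Shifted d (C a) (C′ a) → Shifted d (C b) (C′ b) → Between C′ a b m
    go same a≡ b≡ = trans (cong (m +_) a≡) (trans between (sym b≡))
    go inc  a≡ b≡ = trans (cong (m +_) a≡) (trans (+-suc m (C a)) (trans (cong suc between) (sym b≡)))
    go dec  a≡ b≡ = suc-injective (trans (sym (+-suc m (C′ a))) (trans (cong (m +_) (sym a≡)) (trans between b≡)))

between-bound : ∀ r {a b m} → a ≤ b → Between (count r) a b m → m + a ≤ b
between-bound r {a} {b} {m} a≤b between = +-cancelˡ-≤ (count r a) _ _ (begin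
  count r a + (m + a)    ≡⟨ sym (+-assoc (count r a) m a) ⟩
  count r a + m + a      ≡⟨ cong (_+ a) (trans (+-comm (count r a) m) between) ⟩
  count r b + a          ≤⟨ count-lipschitz r a≤b ⟩
  count r a + b          ∎)
  where open ≤-Reasoning

-- A drop by `m` takes at least `m` positions. Applied to the new heights, this makes the successor
-- taken by the update defined.
drop<n : ∀ {n} ρ {j s m} → s < n → Drop n (level n ρ) j s m → m < n
drop<n {n} ρ {j} {s} {m} s<n (y , (blk@(y<n , _) , _) , eq) = ≤-<-trans (≤-trans (m≤m+n m s) m+s≤y) y<n
  where
  o = count (ρ opening)
  c = count (ρ closing)
  open ≤-Reasoning
  m+s≤y : m + s ≤ y
  m+s≤y = +-cancelˡ-≤ (o y + c s) _ _ (begin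
    o y + c s + (m + s)      ≡⟨ rearrange (o y) (c s) m s ⟩
    m + (o y + c s) + s      ≡⟨ cong (_+ s) (drop-count ρ s<n y<n eq) ⟩
    o s + c y + s            ≡⟨ +-assoc (o s) (c y) s ⟩
    o s + (c y + s)          ≤⟨ +-mono-≤ (count-mono (ρ opening) (Block⇒≤ blk)) (count-lipschitz (ρ closing) (Block⇒≤ blk)) ⟩
    o y + (c s + y)          ≡⟨ sym (+-assoc (o y) (c s) y) ⟩
    o y + c s + y            ∎)
    where
    rearrange : ∀ a b m s → a + b + (m + s) ≡ m + (a + b) + s
    rearrange = solve-∀

-- Cells of an auxiliary symbol and their writers

T-does : ∀ {P : Set} (P? : Dec P) → T (does P?) → P
T-does (yes p) _ = p

does-T : ∀ {P : Set} (P? : Dec P) → P → T (does P?)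
does-T (yes _) _ = _
does-T (no ¬p) p = ¬p p

agreed-constant : ∀ {n} {x v : Maybe (Fin n)} {xs} → x ≡ v → All (_≡ v) xs → agreed (x ∷ xs) ≡ v
agreed-constant {v = v} {xs} refl eqs =
  cong (λ b → if b then v else nothing) (to T-≡ (all⁻ _ (All.map (does-T (Maybeₚ.≡-dec _≟_ _ v)) eqs)))

any-constant : ∀ {A : Set} {f : A → Bool} {v} x xs → (∀ y → y ∈ x ∷ xs → f y ≡ v) → any f (x ∷ xs) ≡ v
any-constant {f = f} {v} x xs eqs with f x | eqs x (here refl)
... | true  | refl = refl
... | false | refl = rest xs (λ y y∈ → eqs y (there y∈))
  where
  rest : ∀ xs → (∀ y → y ∈ xs → f y ≡ false) → any f xs ≡ false
  rest []       _    = refl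
  rest (x ∷ xs) eqs rewrite eqs x (here refl) = rest xs (λ y y∈ → eqs y (there y∈))

∈-tuples : ∀ {n ℓ} {g : Bound} {gs : Vec Bound ℓ} {x : Fin n} {b̄} →
           toℕ x ≤ value g n → b̄ ∈ tuples n gs → (x ∷ b̄) ∈ tuples n (g ∷ gs)
∈-tuples {n} {g = g} {x = x} x≤ b̄∈ = ∈-concatMap⁺ _ (lose (from (range-⇔ g x) x≤) (∈-map⁺ (x ∷_) b̄∈))

module Update {n} (M : Machines noSignatures n) (𝒜 : Structure auxSchema n) (I : ∀ i → Machines.St M i) where

  module _ {May p a Ret} (r : UpdateRule auxSchema noSignatures May p a Ret) (p̄ : Tuple n p) (c̄ : Tuple n a) where
    open UpdateRule r

    Writes : Tuple n #x → Set
    Writes b̄ = target rules M 𝒜 I r p̄ b̄ ≡ just c̄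

    Unwritten : Set
    Unwritten = ∀ b̄ → b̄ ∈ tuples n constraint → ¬ Writes b̄

    writer : ∀ {b̄} → b̄ ∈ writers rules M 𝒜 I r p̄ c̄ → Writes b̄
    writer b̄∈ = T-does (Maybeₚ.≡-dec _≟ᵗ_ _ _) (proj₂ (∈-filter⁻ (T? ∘ _) {xs = tuples n constraint} b̄∈))

    unwritten : writers rules M 𝒜 I r p̄ c̄ ≡ [] → Unwritten
    unwritten eq b̄ b̄∈ w = case subst (b̄ ∈_) eq (∈-filter⁺ (T? ∘ _) b̄∈ (does-T (Maybeₚ.≡-dec _≟ᵗ_ _ _) w)) of λ ()

  -- Several parameters may write the same cell, as every `c` does for `q = 0`. It suffices that all
  -- of them compute the same value.
  updatedFun-elim : ∀ {May p a} (r : UpdateRule auxSchema noSignatures May p a Term)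
    {p̄ : Tuple n p} {old : Tuple n a → Maybe (Fin n)} {c̄ v} (Q : Maybe (Fin n) → Set) →
    (∀ b̄ → Writes r p̄ c̄ b̄ →
       Sem.run rules M 𝒜 I (UpdateRule.locals r) (λ s → Sem.evalTerm rules M 𝒜 I (UpdateRule.locals r) s (p̄ ++ᵛ b̄))
         (afterInitial rules M 𝒜 I r p̄) (p̄ ++ᵛ b̄) (UpdateRule.main r) ≡ v) →
    Q v → (Unwritten r p̄ c̄ → Q (old c̄)) → Q (updatedFun rules M 𝒜 I r p̄ old c̄)
  updatedFun-elim r {p̄} {old} {c̄} {v} Q values qv qold with writers rules M 𝒜 I r p̄ c̄ in eq
  ... | []     = qold (unwritten r p̄ c̄ eq)
  ... | b̄ ∷ bs = subst Q (sym (agreed-constant (values b̄ (wr (here refl)))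
                   (Allₚ.map⁺ (All.tabulate λ {b̄} b̄∈ → values b̄ (wr (there b̄∈)))))) qv
    where
    wr : ∀ {b̄′} → b̄′ ∈ b̄ ∷ bs → Writes r p̄ c̄ b̄′
    wr b̄∈ = writer r p̄ c̄ (subst (_ ∈_) (sym eq) b̄∈)

  updatedRel-elim : ∀ {May p a} (r : UpdateRule auxSchema noSignatures May p a Cond)
    {p̄ : Tuple n p} {old : Tuple n a → Bool} {c̄ v} (Q : Bool → Set) →
    (∀ b̄ → Writes r p̄ c̄ b̄ →
       Sem.run rules M 𝒜 I (UpdateRule.locals r) (λ s → Sem.evalCond rules M 𝒜 I (UpdateRule.locals r) s (p̄ ++ᵛ b̄))
         (afterInitial rules M 𝒜 I r p̄) (p̄ ++ᵛ b̄) (UpdateRule.main r) ≡ v) →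
    Q v → (Unwritten r p̄ c̄ → Q (old c̄)) → Q (updatedRel rules M 𝒜 I r p̄ old c̄)
  updatedRel-elim r {p̄} {old} {c̄} {v} Q values qv qold with writers rules M 𝒜 I r p̄ c̄ in eq
  ... | []     = qold (unwritten r p̄ c̄ eq)
  ... | b̄ ∷ bs = subst Q (sym (any-constant b̄ bs λ b̄′ b̄∈ → values b̄′ (writer r p̄ c̄ (subst (b̄′ ∈_) (sym eq) b̄∈)))) qv

-- Updates preserve the invariant

pair : ∀ {n} → Maybe (Fin n) → Maybe (Fin n) → Maybe (Tuple n 2)
pair x y = zipWith _∷_ x (zipWith _∷_ y (just []))

pair-inv : ∀ {n} {x y : Maybe (Fin n)} {a b} → pair x y ≡ just (a ∷ b ∷ []) → x ≡ just a × y ≡ just b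
pair-inv {x = just _} {just _} refl = refl , refl

module Preservation {n} (M : Machines noSignatures n) {𝒜 : Structure auxSchema n} (I : ∀ i → Machines.St M i)
  {ρ ρ′ : Fin 2 → ℕ → Bool} (inv : Invariant 𝒜 ρ) (δ : Fin 3) (i : Fin n)
  (off : ∀ σ y → y ≢ toℕ i → ρ′ σ y ≡ ρ σ y)
  (on : ∀ σ → ρ′ σ (toℕ i) ≡ rewritten δ σ (ρ opening (toℕ i)) (ρ closing (toℕ i)))
  (exclusive : ¬ (T (ρ opening (toℕ i)) × T (ρ closing (toℕ i))))
  (closed≤ : ∀ y → count (ρ closing) y ≤ n) (closed′≤ : ∀ y → count (ρ′ closing) y ≤ n) where

  open Evaluation {n} {𝒜} M I
  open Update M 𝒜 I
  open Invariant inv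
  open Rules rules using (updRel; updFun)

  private
    x  = toℕ i
    a  = ρ opening x
    b  = ρ closing x
    H  = level n ρ
    H′ = level n ρ′
    𝒜′ = updatedAux rules M 𝒜 I δ (i ∷ [])

  pick-ρ : ∀ σ → ρ σ x ≡ pick σ a b
  pick-ρ zero       = refl
  pick-ρ (suc zero) = refl

  counts-shifted : ∀ σ → ShiftedAfter (letterShift δ σ a b) x (count (ρ σ)) (count (ρ′ σ))
  counts-shifted σ = count-shifted (off σ)
    (subst₂ (λ p q → Shifted (letterShift δ σ a b) (bit p) (bit q)) (sym (pick-ρ σ)) (sym (on σ)) (bit-shifted δ σ a b))

  levels-shifted : ShiftedAfter (shift (raised δ a b) (lowered δ a b)) x H H′
  levels-shifted = level-shifted {ρ = ρ} {ρ′} (combined δ a b exclusive) closed≤ closed′≤ (counts-shifted opening) (counts-shifted closing)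

  module _ {k} {e : Tuple n k} {t : Term V k} (t↦ : term e t ↦ x) where

    letter≡ : ∀ σ → cond e (letter σ t) ≡ ρ σ x
    letter≡ σ = letter-eval inv {e = e} {σ} {t} t↦

    inserts≡ : ∀ δ σ → cond e (inserts δ σ t) ≡ inserted δ σ a b
    inserts≡ zero    σ = refl
    inserts≡ (suc τ) σ with does (τ ≟ σ)
    ... | true  = cong₂ (λ p q → not p ∧ not q) (letter≡ opening) (letter≡ closing)
    ... | false = refl

    deletes≡ : ∀ δ σ → cond e (deletes δ σ t) ≡ deleted δ σ a b
    deletes≡ zero    σ = trans (letter≡ σ) (pick-ρ σ)
    deletes≡ (suc τ) σ = refl

    raises≡ : cond e (raises δ t) ≡ raised δ a b
    raises≡ = cong₂ _∨_ (inserts≡ δ opening) (deletes≡ δ closing)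

    lowers≡ : cond e (lowers δ t) ≡ lowered δ a b
    lowers≡ = cong₂ _∨_ (inserts≡ δ closing) (deletes≡ δ opening)

  adjust-↦ : ∀ {k} {e : Tuple n k} {up down t u d m m′} → cond e up ≡ u → cond e down ≡ d → term e t ↦ m →
             Shifted (shift u d) m m′ → m′ < n → term e (adjust up down t) ↦ m′
  adjust-↦ {e = e} {t = t} {true}  {d}     u≡ d≡ t↦ refl m′<n rewrite u≡ = post-↦ static {e = e} {t} t↦ m′<n
  adjust-↦ {e = e} {t = t} {false} {true}  u≡ d≡ t↦ refl m′<n rewrite u≡ | d≡ = pre-↦ static {e = e} {t} t↦
  adjust-↦ {e = e} {t = t} {false} {false} u≡ d≡ t↦ refl m′<n rewrite u≡ | d≡ = t↦

  static-kept : ∀ f → (∀ c̄ → fun 𝒜′ f c̄ ≡ updatedFun rules M 𝒜 I (staticRule {λ i → Rules.owner rules δ i ≡ just (inj₂ f)} f) (i ∷ []) (fun 𝒜 f) c̄) →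
                ∀ c̄ → fun 𝒜′ f c̄ ≡ fun 𝒜 f c̄
  static-kept f eq c̄ = trans (eq c̄) (updatedFun-elim (staticRule f) {i ∷ []} {fun 𝒜 f} {c̄} {fun 𝒜 f c̄} (_≡ fun 𝒜 f c̄)
    (λ { [] w → cong (fun 𝒜 f) (Maybeₚ.just-injective w) }) refl (λ _ → refl))

  static′ : Static 𝒜′
  static′ = record
    { start-spec = λ x j → subst (_↦ _) (sym (static-kept s# (λ _ → refl) _)) (Static.start-spec static x j)
    ; len-spec   = λ j d l → subst (_↦ _) (sym (static-kept ˡ# (λ _ → refl) _)) (Static.len-spec static j d l)
    ; post-spec  = λ x d l → subst (_↦ _) (sym (static-kept ⁺# (λ _ → refl) _)) (Static.post-spec static x d l)
    ; pre-spec   = λ x d l → subst (_↦ _) (sym (static-kept ⁻# (λ _ → refl) _)) (Static.pre-spec static x d l)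
    }

  letter′ : ∀ σ y → rel 𝒜′ σ (y ∷ []) ≡ ρ′ σ (toℕ y)
  letter′ σ y = go (i ≟ y)
   where
   go : Dec (i ≡ y) → rel 𝒜′ σ (y ∷ []) ≡ ρ′ σ (toℕ y)
   go (yes refl) = updatedRel-elim (updRel δ σ) {i ∷ []} {rel 𝒜 σ} {i ∷ []} {rewritten δ σ a b} (_≡ ρ′ σ x)
        (λ { [] _ → cong₂ (λ p q → p ∧ not q)
               (cong₂ _∨_ (trans (letter≡ {e = i ∷ []} {var zero} (fin i) σ) (pick-ρ σ)) (inserts≡ {e = i ∷ []} {var zero} (fin i) δ σ))
               (deletes≡ {e = i ∷ []} {var zero} (fin i) δ σ) })
        (sym (on σ)) (λ unwritten → contradiction refl (unwritten [] (here refl)))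
   go (no i≢y) = updatedRel-elim (updRel δ σ) {i ∷ []} {rel 𝒜 σ} {y ∷ []} {rel 𝒜 σ (y ∷ [])} (_≡ ρ′ σ (toℕ y))
         (λ { [] w → case Maybeₚ.just-injective w of λ { refl → contradiction refl i≢y } })
         kept (λ _ → kept)
     where
     kept : rel 𝒜 σ (y ∷ []) ≡ ρ′ σ (toℕ y)
     kept = trans (letter-spec σ y) (sym (off σ (toℕ y) (λ eq → i≢y (sym (toℕ-injective eq)))))

  dropTerm-↦ : ∀ j → toℕ j ≤ height n → ∃[ m ] term (i ∷ j ∷ []) (dropTerm δ) ↦ m × Drop n H′ (toℕ j) (st (toℕ j) x) m
  dropTerm-↦ j j≤h = go (raised δ a b) (lowered δ a b) refl refl
    where
    e : Tuple n 2
    e = i ∷ j ∷ []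
    J = toℕ j
    Updated : Maybe (Fin n) → Set
    Updated y = ∃[ m ] y ↦ m × Drop n H′ J (st J x) m
    old = apply μ# (var (suc zero)) (apply s# (var zero) (var (suc zero)))
    old-spec = drop-↦ inv {e = e} {var (suc zero)} {apply s# (var zero) (var (suc zero))} (fin j)
                 (start-↦ static {e = e} {t = var zero} {var (suc zero)} (fin i) (fin j)) j≤h (st-idem J x)
    m = proj₁ old-spec
    m↦ : term e old ↦ m
    m↦ = proj₁ (proj₂ old-spec)
    dropped : Drop n H J (st J x) m
    dropped = proj₂ (proj₂ old-spec)
    leftmost = minOn-eval inv {e = e} {zero} {suc zero} j≤h left
    rightmost = minOn-eval inv {e = e} {zero} {suc zero} j≤h right
    s<n : st J x < n
    s<n = ≤-<-trans (st≤ J x) (toℕ<n i)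
    switch : ∀ {c d} → cond e c ≡ d → ∀ {t u} → Updated (if d then term e t else term e u) → Updated (term e (ite c t u))
    switch refl q = q
    go : ∀ r l → raised δ a b ≡ r → lowered δ a b ≡ l → Updated (term e (dropTerm δ))
    go r l r≡ l≡ = switch {raises δ (var zero)} (trans (raises≡ {e = e} {var zero} (fin i)) r≡)
        {ite (minOn left zero (suc zero)) old (pre old)} {lower} (cases r l r≡ l≡)
      where
      lower = ite (lowers δ (var zero)) (ite (minOn right zero (suc zero)) (post old) old) old
      shifted : ∀ {r l} → raised δ a b ≡ r → lowered δ a b ≡ l → ShiftedAfter (shift r l) x H H′
      shifted refl refl = levels-shifted
      cases : ∀ r l → raised δ a b ≡ r → lowered δ a b ≡ l →
              Updated (if r then term e (ite (minOn left zero (suc zero)) old (pre old)) else term e lower)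
      cases true l r≡ l≡ = ite-elim {e = e} (minOn left zero (suc zero)) old (pre old) Updated leftmost
        (λ hit → m , m↦ , drop-inc-left (shifted r≡ l≡) hit dropped)
        (λ miss → let (m′ , m≡ , dropped′) = drop-inc-right (toℕ<n i) (shifted r≡ l≡) miss dropped in
                  m′ , pre-↦ static {e = e} {t = old} (subst (term e old ↦_) m≡ m↦) , dropped′)
      cases false l r≡ l≡ = switch {lowers δ (var zero)} (trans (lowers≡ {e = e} {var zero} (fin i)) l≡)
          {ite (minOn right zero (suc zero)) (post old) old} {old} (lower-cases l l≡)
        where
        lower-cases : ∀ l → lowered δ a b ≡ l → Updated (if l then term e (ite (minOn right zero (suc zero)) (post old) old) else term e old)
        lower-cases true l≡ = ite-elim {e = e} (minOn right zero (suc zero)) (post old) old Updated rightmost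
          (λ hit → let dropped′ = drop-dec-right (shifted r≡ l≡) hit dropped in
                   suc m , post-↦ static {e = e} {t = old} m↦ (drop<n ρ′ s<n dropped′) , dropped′)
          (λ miss → m , m↦ , drop-dec-left (shifted r≡ l≡) miss dropped)
        lower-cases false l≡ = m , m↦ , drop-same (shifted r≡ l≡) dropped

  -- The rule writes the blocks around `i`, one for each level. Every other block is off the path,
  -- where the old drop remains correct.
  drop′ : ∀ j s → toℕ j ≤ height n → st (toℕ j) (toℕ s) ≡ toℕ s →
          ∃[ m ] fun 𝒜′ μ# (j ∷ s ∷ []) ↦ m × Drop n H′ (toℕ j) (toℕ s) m
  drop′ j s j≤h fix with st (toℕ j) x Nat.≟ toℕ s
  ... | yes on-path = updatedFun-elim (updFun δ μ#) {i ∷ []} {fun 𝒜 μ#} {j ∷ s ∷ []} {term (i ∷ j ∷ []) (dropTerm δ)} Updated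
        (λ { (j₁ ∷ []) w → case proj₁ (pair-inv {x = just j₁} {term (i ∷ j₁ ∷ []) (apply s# (var zero) (var (suc zero)))} w) of λ { refl → refl } })
        (subst (λ s → ∃[ m ] term (i ∷ j ∷ []) (dropTerm δ) ↦ m × Drop n H′ (toℕ j) s m) on-path (dropTerm-↦ j j≤h))
        (λ unwritten → contradiction
          (cong (pair (just j))
            (↦-fin (start-↦ static {e = i ∷ j ∷ []} {t = var zero} {var (suc zero)} (fin i) (fin j)) (sym on-path)))
          (unwritten (j ∷ []) (∈-tuples {g = levels} {[]} j≤h (here refl))))
    where
    Updated : Maybe (Fin n) → Set
    Updated y = ∃[ m ] y ↦ m × Drop n H′ (toℕ j) (toℕ s) m
  ... | no off-path = updatedFun-elim (updFun δ μ#) {i ∷ []} {fun 𝒜 μ#} {j ∷ s ∷ []} {fun 𝒜 μ# (j ∷ s ∷ [])} Updated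
        (λ { (j₁ ∷ []) w → case pair-inv {x = just j₁} {term (i ∷ j₁ ∷ []) (apply s# (var zero) (var (suc zero)))} w of λ { (refl , s≡) →
           contradiction (sym (↦-unique (_ , s≡ , refl) (start-↦ static {e = i ∷ j₁ ∷ []} {t = var zero} {var (suc zero)} (fin i) (fin j₁)))) off-path } })
        kept (λ _ → kept)
    where
    Updated : Maybe (Fin n) → Set
    Updated y = ∃[ m ] y ↦ m × Drop n H′ (toℕ j) (toℕ s) m
    kept : Updated (fun 𝒜 μ# (j ∷ s ∷ []))
    kept with drop-spec j s j≤h fix
    ... | m , m↦ , dropped = m , m↦ , drop-off-path levels-shifted fix off-path dropped

  module _ {q u c : Fin n} {t : Term V 3} (t≡ : term (i ∷ q ∷ c ∷ []) t ≡ just u) where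
    private
      e : Tuple n 3
      e = i ∷ q ∷ c ∷ []
      t↦ : term e t ↦ toℕ u
      t↦ = u , t≡ , refl

    count≡ : ∀ σ → term e (apply (κ# σ) (var (suc zero)) t) ≡ fun 𝒜 (κ# σ) (q ∷ u ∷ [])
    count≡ σ = apply≡ {e = e} {κ# σ} {var (suc zero)} {t} refl t≡

    countTerm-hit : ∀ σ {P m m′} → T (cond e (affected t)) ⇔ P → P → fun 𝒜 (κ# σ) (q ∷ u ∷ []) ↦ m →
                    Shifted (letterShift δ σ a b) m m′ → m′ < n → term e (countTerm δ σ t) ↦ m′
    countTerm-hit σ {m = m} {m′} affected⇔ hit m↦ shifted m′<n =
      ite-elim {e = e} (affected t) (adjust (inserts δ σ (var zero)) (deletes δ σ (var zero)) old) old (_↦ m′) affected⇔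
        (λ _ → adjust-↦ {e = e} {inserts δ σ (var zero)} {deletes δ σ (var zero)} {old}
                 (inserts≡ {e = e} {var zero} (fin i) δ σ) (deletes≡ {e = e} {var zero} (fin i) δ σ)
                 (subst (_↦ m) (sym (count≡ σ)) m↦) shifted m′<n)
        (λ miss → contradiction hit miss)
      where
      old : Term V 3
      old = apply (κ# σ) (var (suc zero)) t

    countTerm-miss : ∀ σ {P} → T (cond e (affected t)) ⇔ P → ¬ P → term e (countTerm δ σ t) ≡ fun 𝒜 (κ# σ) (q ∷ u ∷ [])
    countTerm-miss σ affected⇔ miss =
      ite-elim {e = e} (affected t) (adjust (inserts δ σ (var zero)) (deletes δ σ (var zero)) old) old
        (_≡ fun 𝒜 (κ# σ) (q ∷ u ∷ [])) affected⇔ (λ hit → contradiction hit miss) (λ _ → count≡ σ)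
      where
      old : Term V 3
      old = apply (κ# σ) (var (suc zero)) t

    private
      isZero-q : ∀ {l} → toℕ q ≡ l → T (cond e (isZeroᶜ (var (suc zero)))) ⇔ (l ≡ 0)
      isZero-q = isZero-eval inv {e = e} {suc zero}

    -- Both kinds of counters count letters in an interval, `[1, n)` here and `[st (suc r) u, u)` in
    -- `affected-suc`. With membership of `i` as the condition, `Cell` treats them alike.
    affected-zero : toℕ q ≡ 0 → T (cond e (affected t)) ⇔ (1 ≤ x × x < n)
    affected-zero q≡ = mk⇔
      (λ t → case to T-∨ t of λ
        { (inj₁ s) → n≢0⇒n>0 (proj₂ (to (isZero-q q≡ ∧-⇔ nonzero) s)) , toℕ<n i
        ; (inj₂ s) → contradiction (from (isZero-q q≡) refl) (to T-not (proj₁ (to T-∧ s))) })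
      (λ (1≤x , _) → from T-∨ (inj₁ (from (isZero-q q≡ ∧-⇔ nonzero) (refl , λ x≡0 → <-irrefl (sym x≡0) 1≤x))))
      where
      nonzero : T (cond e (¬′ isZeroᶜ (var zero))) ⇔ (x ≢ 0)
      nonzero = ¬-⇔ (isZero-eval inv {e = e} {zero} refl)

    affected-suc : ∀ {r} → toℕ q ≡ suc r → T (cond e (affected t)) ⇔ (st (suc r) (toℕ u) ≤ x × x < toℕ u)
    affected-suc {r} q≡ = mk⇔
      (λ t → case to T-∨ t of λ
        { (inj₁ s) → case to (isZero-q q≡) (proj₁ (to T-∧ s)) of λ ()
        ; (inj₂ s) → let (_ , st≡ , u≰x) = to conj s in subst (_≤ x) (sym st≡) (st≤ (suc r) x) , ≰⇒> u≰x })
      (λ (A≤x , x<u) → from T-∨ (inj₂ (from conj ((λ ()) , sym (st-squeeze (suc r) refl A≤x (<⇒≤ x<u)) , <⇒≱ x<u))))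
      where
      q↦ : term e (var (suc zero)) ↦ suc r
      q↦ = q , refl , q≡
      conj = ¬-⇔ (isZero-q q≡) ∧-⇔
        equal-⇔ (start-↦ static {e = e} {t = t} {var (suc zero)} t↦ q↦)
                (start-↦ static {e = e} {t = var zero} {var (suc zero)} (fin i) q↦) ∧-⇔
        ¬-⇔ (leq-⇔ t↦ (fin i))

  module _ (q c : Fin n) where
    private
      e : Tuple n 3
      e = i ∷ q ∷ c ∷ []
      u : Term V 3
      u = child (var zero) (var (suc zero)) (var (suc (suc zero)))

    zero-cell : toℕ q ≡ 0 → term e cell ≡ just q
    zero-cell q≡ = ite-elim {e = e} (isZeroᶜ (var (suc zero))) (var (suc zero)) u (_≡ just q)
      (isZero-eval inv {e = e} {suc zero} q≡) (λ _ → refl) (λ ≢ → contradiction refl ≢)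

    child-cell : ∀ {r} → toℕ q ≡ suc r → suc r ≤ height n → st (suc r) x + toℕ c * len r < n →
                 term e cell ↦ st (suc r) x + toℕ c * len r
    child-cell {r} q≡ q≤h u<n = ite-elim {e = e} (isZeroᶜ (var (suc zero))) (var (suc zero)) u (_↦ (st (suc r) x + toℕ c * len r))
      (isZero-eval inv {e = e} {suc zero} q≡) (λ ())
      (λ _ → case child-↦ static {e = e} {var zero} {var (suc zero)} {var (suc (suc zero))} (fin i) (q , refl , q≡) q≤h (fin c) of λ
        { (inj₁ u↦) → u↦ ; (inj₂ (_ , u≮n)) → contradiction u<n u≮n })

  -- The cell (q , u) of the counter for σ, which counts the positions in [A, B).
  module Cell (σ : Fin 2) (q u : Fin n) {A B m} (m↦ : fun 𝒜 (κ# σ) (q ∷ u ∷ []) ↦ m) (between : Between (count (ρ σ)) A B m)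
    (A≤B : A ≤ B) (small : ∀ {m} → m + A ≤ B → m < n)
    (affected⇔ : ∀ c → term (i ∷ q ∷ c ∷ []) cell ≡ just u → T (cond (i ∷ q ∷ c ∷ []) (affected cell)) ⇔ (A ≤ x × x < B))
    (written : A ≤ x → x < B → ¬ Unwritten (updFun δ (κ# σ)) (i ∷ []) (q ∷ u ∷ [])) where

    Updated : Maybe (Fin n) → Set
    Updated y = ∃[ m ] y ↦ m × Between (count (ρ′ σ)) A B m

    written-value : (v : Maybe (Fin n)) → (∀ c → term (i ∷ q ∷ c ∷ []) cell ≡ just u → term (i ∷ q ∷ c ∷ []) (countTerm δ σ cell) ≡ v) →
            ∀ b̄ → Writes (updFun δ (κ# σ)) (i ∷ []) (q ∷ u ∷ []) b̄ →
            term ((i ∷ []) ++ᵛ b̄) (countTerm δ σ cell) ≡ v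
    written-value v eq (q₁ ∷ c ∷ []) w with pair-inv {x = just q₁} {term (i ∷ q₁ ∷ c ∷ []) cell} w
    ... | refl , cell≡ = eq c cell≡

    missed : ¬ (A ≤ x × x < B) → Between (count (ρ′ σ)) A B m → Updated (fun 𝒜′ (κ# σ) (q ∷ u ∷ []))
    missed miss between′ = updatedFun-elim (updFun δ (κ# σ)) {i ∷ []} {fun 𝒜 (κ# σ)} {q ∷ u ∷ []} {fun 𝒜 (κ# σ) (q ∷ u ∷ [])} Updated
      (written-value _ λ c cell≡ → countTerm-miss {q} {u} {c} {cell} cell≡ σ (affected⇔ c cell≡) miss)
      (m , m↦ , between′) (λ _ → m , m↦ , between′)

    updated : Updated (fun 𝒜′ (κ# σ) (q ∷ u ∷ []))
    updated = go (A ≤? x) (x <? B)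
      where
      go : Dec (A ≤ x) → Dec (x < B) → Updated (fun 𝒜′ (κ# σ) (q ∷ u ∷ []))
      go (no A≰x) _ = missed (A≰x ∘ proj₁) (between-above (counts-shifted σ) between (≰⇒> A≰x) (<-≤-trans (≰⇒> A≰x) A≤B))
      go (yes A≤x) (no x≮B) = missed (x≮B ∘ proj₂) (between-below (counts-shifted σ) between A≤x (≮⇒≥ x≮B))
      go (yes A≤x) (yes x<B) = let (m′ , shifted , between′) = between-hit (counts-shifted σ) between (count-mono (ρ′ σ) A≤B) A≤x x<B
                                   m′<n = small (between-bound (ρ′ σ) A≤B between′) in
        updatedFun-elim (updFun δ (κ# σ)) {i ∷ []} {fun 𝒜 (κ# σ)} {q ∷ u ∷ []} {just (fromℕ< m′<n)} Updated
          (written-value _ λ c cell≡ → ↦-fin (countTerm-hit {q} {u} {c} {cell} cell≡ σ (affected⇔ c cell≡) (A≤x , x<B) m↦ shifted m′<n) (toℕ-fromℕ< m′<n))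
          (m′ , (_ , refl , toℕ-fromℕ< m′<n) , between′)
          (λ unwritten → contradiction unwritten (written A≤x x<B))

  target≡ : ∀ {q c u} → term (i ∷ q ∷ c ∷ []) cell ≡ just u →
            pair (just q) (term (i ∷ q ∷ c ∷ []) cell) ≡ just (q ∷ u ∷ [])
  target≡ {q} cell≡ = cong (pair (just q)) cell≡

  count′ : ∀ σ q u {r} → toℕ q ≡ suc r → toℕ q ≤ height n → st r (toℕ u) ≡ toℕ u →
           ∃[ m ] fun 𝒜′ (κ# σ) (q ∷ u ∷ []) ↦ m × Between (count (ρ′ σ)) (st (toℕ q) (toℕ u)) (toℕ u) m
  count′ σ q u {r} q≡ q≤h fix with count-spec σ q u q≡ q≤h fix
  ... | m , m↦ , between = Cell.updated σ q u m↦ between (st≤ (toℕ q) (toℕ u)) (λ {m} le → ≤-<-trans (≤-trans (m≤m+n m _) le) (toℕ<n u))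
        (λ c cell≡ → subst (λ l → T (cond (i ∷ q ∷ c ∷ []) (affected cell)) ⇔ (st l (toℕ u) ≤ x × x < toℕ u)) (sym q≡) (affected-suc {q} {u} {c} {cell} cell≡ q≡))
        written
    where
    q≤h′ : suc r ≤ height n
    q≤h′ = subst (_≤ height n) q≡ q≤h
    written : st (toℕ q) (toℕ u) ≤ x → x < toℕ u → ¬ Unwritten (updFun δ (κ# σ)) (i ∷ []) (q ∷ u ∷ [])
    -- Every affected cell has a writer: `u` is a child of the block of level `q` around `i`, and
    -- its index is within the bound.
    written A≤x x<u unwritten with child-offset r fix
    ... | d , d≤q , v+d≡u = unwritten (q ∷ c ∷ []) (∈-tuples {g = levels} {levels ∷ []} q≤h (∈-tuples {g = levels} {[]} (subst (_≤ height n) (sym c≡) d≤h) (here refl)))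
          (target≡ {q} {c} {u} (↦-fin (child-cell q c q≡ q≤h′ (subst (_< n) (sym u≡) (toℕ<n u))) (sym u≡)))
      where
      d≤h = ≤-trans d≤q q≤h′
      d<n : d < n
      d<n = ≤-<-trans d≤h (height<n (≤-<-trans z≤n (toℕ<n i)))
      c = fromℕ< d<n
      c≡ = toℕ-fromℕ< d<n
      u≡ : st (suc r) x + toℕ c * len r ≡ toℕ u
      u≡ = trans (cong₂ (λ v d → v + d * len r)
             (st-squeeze (suc r) refl (subst (λ l → st l (toℕ u) ≤ x) q≡ A≤x) (<⇒≤ x<u)) c≡) v+d≡u

  total′ : ∀ σ z → toℕ z ≡ 0 → ∃[ m ] fun 𝒜′ (κ# σ) (z ∷ z ∷ []) ↦ m × Between (count (ρ′ σ)) 1 n m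
  total′ σ z z≡ with total-spec σ z z≡
  ... | m , m↦ , between = Cell.updated σ z z m↦ between (≤-<-trans z≤n (toℕ<n i)) (λ {m} le → subst (_≤ n) (+-comm m 1) le)
        (λ c cell≡ → affected-zero {z} {z} {c} {cell} cell≡ z≡)
        (λ _ _ unwritten → unwritten (z ∷ z ∷ []) (∈-tuples {g = levels} {levels ∷ []} z≤h (∈-tuples {g = levels} {[]} z≤h (here refl)))
          (target≡ {z} {z} {z} (zero-cell z z z≡)))
    where
    z≤h : toℕ z ≤ height n
    z≤h = subst (_≤ height n) (sym z≡) z≤n

  preserved : Invariant 𝒜′ ρ′
  preserved = record
    { static = static′ ; letter-spec = letter′ ; drop-spec = drop′ ; count-spec = count′ ; total-spec = total′ }

-- Initial state, queries and input words

module _ {n : ℕ} {ρ : Fin 2 → ℕ → Bool} (blank : ∀ σ y → ρ σ y ≡ false) where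
  private
    𝒜₀ : Structure auxSchema n
    𝒜₀ = initialAux rules emptyStructure

    ℐ : Structure (wordSchema 2) n
    ℐ = emptyStructure

    count-blank : ∀ σ y → count (ρ σ) y ≡ 0
    count-blank σ zero    = refl
    count-blank σ (suc y) rewrite blank σ y = count-blank σ y

    level-blank : ∀ y → level n ρ y ≡ n
    level-blank y rewrite count-blank opening y | count-blank closing y = +-identityʳ n

    zero-↦ : ∀ (x y : Fin n) → only (filterᵇ (λ z → sat ℐ (z ∷ x ∷ y ∷ []) (isZero (var zero))) (allFin n)) ↦ 0
    zero-↦ x y = only-↦ (λ z → zero-⇔ (fin z)) (≤-<-trans z≤n (toℕ<n x))

    between-blank : ∀ σ a b → Between (count (ρ σ)) a b 0
    between-blank σ a b = trans (count-blank σ a) (sym (count-blank σ b))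

  initial-invariant : Invariant 𝒜₀ ρ
  initial-invariant = record
    { static = record
      { start-spec = λ x j → only-↦ (λ z → isStart-⇔ ℐ (z ∷ x ∷ j ∷ []) (suc (suc zero)) (suc zero) zero) (≤-<-trans (st≤ (toℕ j) (toℕ x)) (toℕ<n x))
      ; len-spec   = λ j d l<n → only-↦ (λ z → isLen-⇔ ℐ (z ∷ j ∷ d ∷ []) (suc zero) zero) l<n
      ; post-spec  = λ x d x<n → only-↦ (λ z → covers-⇔ ℐ (z ∷ x ∷ d ∷ []) (suc zero) zero) x<n
      ; pre-spec   = λ x d {m} x≡ → only-↦
          (λ z → let c = covers-⇔ ℐ (z ∷ x ∷ d ∷ []) zero (suc zero) in
                 mk⇔ (λ t → suc-injective (trans (sym (to c t)) x≡)) (λ z≡ → from c (trans x≡ (cong suc (sym z≡)))))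
          (<-trans (n<1+n m) (subst (_< n) x≡ (toℕ<n x)))
      }
    ; letter-spec = λ σ x → sym (blank σ (toℕ x))
    ; drop-spec   = λ j s _ fix → 0 , zero-↦ j s , toℕ s , ((toℕ<n s , fix) ,
        λ z _ → ≤-reflexive (trans (level-blank (toℕ s)) (sym (level-blank z)))) , +-identityʳ _
    ; count-spec  = λ { zero q u _ _ _ → 0 , zero-↦ q u , between-blank zero (st (toℕ q) (toℕ u)) (toℕ u)
                      ; (suc zero) q u _ _ _ → 0 , zero-↦ q u , between-blank (suc zero) (st (toℕ q) (toℕ u)) (toℕ u) }
    ; total-spec  = λ { zero z _ → 0 , zero-↦ z z , between-blank zero 1 n
                      ; (suc zero) z _ → 0 , zero-↦ z z , between-blank (suc zero) 1 n }
    }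

-- Evaluation of the query

module _ {n} {M : Machines noSignatures n} {𝒜 : Structure auxSchema n} {I : ∀ i → Machines.St M i} {ρ} (inv : Invariant 𝒜 ρ)
  (exclusive : ∀ y → ¬ (T (ρ opening y) × T (ρ closing y))) where

  open Evaluation {n} {𝒜} M I
  open Invariant inv
  private
    H = level n ρ
    o = count (ρ opening)
    c = count (ρ closing)

  module _ {k} {e : Tuple n k} {z t : Fin k} (z≡ : toℕ (lookup e z) ≡ 0) (t≡ : toℕ (lookup e t) ≡ height n) where
    private
      h = height n
      0<n : 0 < n
      0<n = ≤-<-trans z≤n (toℕ<n (lookup e z))
      z↦ : term e (var z) ↦ 0
      z↦ = lookup e z , refl , z≡
      root = drop-↦ inv {e = e} {var t} {var z} (lookup e t , refl , t≡) z↦ ≤-refl (st-small h (≤-<-trans z≤n (j<len h)))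
      m = proj₁ root
      letter≡ : ∀ σ → cond e (letter σ (var z)) ≡ ρ σ 0
      letter≡ σ = letter-eval inv {e = e} {σ} {var z} z↦
      total : ∀ σ → ∃[ m ] term e (apply (κ# σ) (var z) (var z)) ↦ m × Between (count (ρ σ)) 1 n m
      total σ = total-spec σ (lookup e z) z≡

      -- The root block contains all positions and starts at height `n`, so a zero drop says that no
      -- height falls below it. Prefixes of length `n` are left to the totals.
      root-nonNegative : m ≡ 0 ⇔ (∀ y → y < n → c y ≤ o y)
      root-nonNegative with proj₂ (proj₂ root)
      ... | y₀ , ((y₀<n , st≡) , min) , eq = mk⇔
        (λ m≡0 y y<n → +-cancelˡ-≤ n _ _ (begin
          n + c y      ≡⟨ cong (_+ c y) (sym (trans (sym (+-identityʳ (H y₀))) (trans (cong (H y₀ +_) (sym m≡0)) (trans eq H0)))) ⟩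
          H y₀ + c y   ≤⟨ +-monoˡ-≤ (c y) (min y (y<n , st-small h (<-≤-trans y<n (n≤len-height n)))) ⟩
          H y + c y    ≡⟨ level-eq ρ (<⇒≤ y<n) ⟩
          n + o y      ∎))
        (λ c≤o → n≤0⇒n≡0 (+-cancelˡ-≤ (H y₀) _ _ (begin
          H y₀ + m     ≡⟨ trans eq H0 ⟩
          n            ≤⟨ +-cancelʳ-≤ (c y₀) _ _ (≤-trans (+-monoʳ-≤ n (c≤o y₀ y₀<n)) (≤-reflexive (sym (level-eq ρ (<⇒≤ y₀<n))))) ⟩
          H y₀         ≡⟨ sym (+-identityʳ _) ⟩
          H y₀ + 0     ∎)))
        where
        open ≤-Reasoning
        H0 : H 0 ≡ n
        H0 = +-identityʳ n

      Totals : Set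
      Totals = (T (ρ opening 0) × (proj₁ (total closing) ≢ 0 × suc (proj₁ (total opening)) ≡ proj₁ (total closing))) ⊎
               (¬ T (ρ opening 0) × proj₁ (total opening) ≡ proj₁ (total closing))

      letter-⇔ : ∀ σ → T (cond e (letter σ (var z))) ⇔ T (ρ σ 0)
      letter-⇔ σ = mk⇔ (subst T (letter≡ σ)) (subst T (sym (letter≡ σ)))

      totalᵗ : Fin 2 → Term V k
      totalᵗ σ = apply (κ# σ) (var z) (var z)

      pre-⇔ : T (cond e (¬′ isZeroᶜ (totalᵗ closing) ∧′ totalᵗ opening ≐ pre (totalᵗ closing))) ⇔
              (proj₁ (total closing) ≢ 0 × suc (proj₁ (total opening)) ≡ proj₁ (total closing))
      pre-⇔ = go (proj₁ (total closing)) (proj₁ (proj₂ (total closing)))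
        where
        go : ∀ c → term e (totalᵗ closing) ↦ c →
             T (cond e (¬′ isZeroᶜ (totalᵗ closing) ∧′ totalᵗ opening ≐ pre (totalᵗ closing))) ⇔ (c ≢ 0 × suc (proj₁ (total opening)) ≡ c)
        go zero    ↦c = mk⇔ (λ t → contradiction (from (zero-⇔ ↦c) refl) (to T-not (proj₁ (to T-∧ t)))) (λ (≢ , _) → contradiction refl ≢)
        go (suc c) ↦c = mk⇔ (λ t → (λ ()) , cong suc (proj₂ (to conj t))) (λ (_ , eq) → from conj ((λ ()) , suc-injective eq))
          where
          conj = ¬-⇔ (zero-⇔ ↦c) ∧-⇔ equal-⇔ (proj₁ (proj₂ (total opening))) (pre-↦ static {e = e} {t = totalᵗ closing} ↦c)

      good-⇔ : T (cond e (good z t)) ⇔ (m ≡ 0 × (¬ T (ρ closing 0) × Totals))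
      good-⇔ = equal-⇔ (proj₁ (proj₂ root)) z↦ ∧-⇔ (¬-⇔ (letter-⇔ closing) ∧-⇔
        ((letter-⇔ opening ∧-⇔ pre-⇔) ∨-⇔ (¬-⇔ (letter-⇔ opening) ∧-⇔ equal-⇔ (proj₁ (proj₂ (total opening))) (proj₁ (proj₂ (total closing))))))

      T⇒≡ : ∀ {b} → T b → b ≡ true
      T⇒≡ {true} _ = refl
      ¬T⇒≡ : ∀ {b} → ¬ T b → b ≡ false
      ¬T⇒≡ {true}  ¬t = contradiction _ ¬t
      ¬T⇒≡ {false} _  = refl

      summed : ∀ σ → proj₁ (total σ) + (bit (ρ σ 0) + 0) ≡ count (ρ σ) n
      summed σ = proj₂ (proj₂ (total σ))

      totals-⇔ : ¬ T (ρ closing 0) → Totals ⇔ (c n ≡ o n)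
      totals-⇔ ¬closing = mk⇔ sound (complete (T? (ρ opening 0)))
        where
        cn≡ : c n ≡ proj₁ (total closing)
        cn≡ = trans (sym (summed closing)) (trans (cong (λ b → proj₁ (total closing) + (bit b + 0)) (¬T⇒≡ ¬closing)) (+-identityʳ _))
        on≡ : ∀ {b} → ρ opening 0 ≡ b → o n ≡ bit b + proj₁ (total opening)
        on≡ {b} eq = trans (sym (summed opening)) (trans (cong (λ b → proj₁ (total opening) + (bit b + 0)) eq)
                       (trans (cong (proj₁ (total opening) +_) (+-identityʳ (bit b))) (+-comm (proj₁ (total opening)) (bit b))))
        sound : Totals → c n ≡ o n
        sound (inj₁ (op , _ , eq)) = trans cn≡ (trans (sym eq) (sym (on≡ (T⇒≡ op))))
        sound (inj₂ (¬op , eq))    = trans cn≡ (trans (sym eq) (sym (on≡ (¬T⇒≡ ¬op))))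
        complete : Dec (T (ρ opening 0)) → c n ≡ o n → Totals
        complete (yes op) eq = let suc≡ = sym (trans (sym cn≡) (trans eq (on≡ (T⇒≡ op)))) in
          inj₁ (op , (λ ≡0 → case trans suc≡ ≡0 of λ ()) , suc≡)
        complete (no ¬op) eq = inj₂ (¬op , sym (trans (sym cn≡) (trans eq (on≡ (¬T⇒≡ ¬op)))))

    good-eval : T (cond e (good z t)) ⇔ NonNegative 0 ρ n
    good-eval = mk⇔ sound complete
      where
      sound : T (cond e (good z t)) → NonNegative 0 ρ n
      sound g with to good-⇔ g
      ... | m≡0 , ¬closing , totals = below , to (totals-⇔ ¬closing) totals
        where
        below : ∀ y → y ≤ n → c y ≤ o y
        below y y≤n with m≤n⇒m<n∨m≡n y≤n
        ... | inj₁ y<n  = to root-nonNegative m≡0 y y<n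
        ... | inj₂ refl = ≤-reflexive (to (totals-⇔ ¬closing) totals)
      complete : NonNegative 0 ρ n → T (cond e (good z t))
      complete (c≤o , c≡o) = from good-⇔ (from root-nonNegative (λ y y<n → c≤o y (<⇒≤ y<n)) , ¬closing , from (totals-⇔ ¬closing) c≡o)
        where
        forced : ∀ {p q} → T q → bit q + 0 ≤ bit p + 0 → T p
        forced {true}          _ _ = _
        forced {false} {true} _ ()
        -- A ⟩ at position 0 would force a ⟨ at the same position, by the inequality at `y = 1`.
        ¬closing : ¬ T (ρ closing 0)
        ¬closing cl = exclusive 0 (forced cl (c≤o 1 0<n) , cl)

  accepts-eval : T (cond [] accepts) ⇔ NonNegative 0 ρ n
  accepts-eval = mk⇔ (sound (0 <? n)) complete
    where
    zero∧root : Cond V 1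
    zero∧root = isZeroᶜ (var zero) ∧′ exists levels (¬′ exists levels (¬′ (var zero ≼ var (suc zero))) ∧′ ¬′ good (suc zero) zero)
    inner : Cond V 2
    inner = ¬′ exists levels (¬′ (var zero ≼ var (suc zero))) ∧′ ¬′ good (suc zero) zero
    Reject : Fin n → Fin n → Set
    Reject z t = T (cond (t ∷ z ∷ []) inner)
    outer : T (cond [] (exists levels zero∧root)) ⇔ (∃[ z ] toℕ z ≤ height n × (toℕ z ≡ 0 × ∃[ t ] toℕ t ≤ height n × Reject z t))
    outer = exists-⇔ {e = []} {zero∧root} λ z _ →
      zero-⇔ (fin z) ∧-⇔ exists-⇔ {e = z ∷ []} {inner} λ t _ → mk⇔ id id
    top : ∀ (z t : Fin n) → T (cond (t ∷ z ∷ []) (exists levels (¬′ (var zero ≼ var (suc zero))))) ⇔ (∃[ y ] toℕ y ≤ height n × ¬ (toℕ y ≤ toℕ t))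
    top z t = exists-⇔ {e = t ∷ z ∷ []} {¬′ (var zero ≼ var (suc zero))} λ y _ → ¬-⇔ (leq-⇔ (fin y) (fin t))
    sound : Dec (0 < n) → T (cond [] accepts) → NonNegative 0 ρ n
    sound (no 0≮n) _ with n≤0⇒n≡0 (≮⇒≥ 0≮n)
    ... | refl = (λ { zero z≤n → z≤n }) , refl
    sound (yes 0<n) acc = go (decide (good-eval {e = t ∷ z ∷ []} {suc zero} {zero} z≡ t≡))
      where
      z = fromℕ< 0<n
      z≡ = toℕ-fromℕ< 0<n
      t = fromℕ< (height<n 0<n)
      t≡ = toℕ-fromℕ< (height<n 0<n)
      go : Dec (NonNegative 0 ρ n) → NonNegative 0 ρ n
      go (yes p) = p
      go (no ¬p) = contradiction
        (from outer (z , subst (_≤ height n) (sym z≡) z≤n , z≡ , t , ≤-reflexive t≡ ,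
          from T-∧ (from T-not (λ ex → let (y , y≤h , y≰t) = to (top z t) ex in y≰t (≤-trans y≤h (≤-reflexive (sym t≡)))) ,
                    from T-not (¬p ∘ to (good-eval {e = t ∷ z ∷ []} {suc zero} {zero} z≡ t≡)))))
        (to T-not acc)
    complete : NonNegative 0 ρ n → T (cond [] accepts)
    complete p = from T-not λ ex → let (z , _ , z≡ , t , t≤h , rej) = to outer ex in reject z t z≡ t≤h (to T-∧ rej)
      where
      reject : ∀ (z t : Fin n) → toℕ z ≡ 0 → toℕ t ≤ height n →
               ¬ (T (not (cond (t ∷ z ∷ []) (exists levels (¬′ (var zero ≼ var (suc zero)))))) × T (not (cond (t ∷ z ∷ []) (good (suc zero) zero))))
      reject z t z≡ t≤h (no-higher , bad) = to T-not bad (from (good-eval {e = t ∷ z ∷ []} {suc zero} {zero} z≡ (≤-antisym t≤h h≤t)) p)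
        where
        h<n = height<n (≤-<-trans z≤n (toℕ<n z))
        h≤t : height n ≤ toℕ t
        h≤t = ≮⇒≥ λ t<h → to T-not no-higher (from (top z t)
          (fromℕ< h<n , ≤-reflexive (toℕ-fromℕ< h<n) , λ h≤t → <⇒≱ t<h (subst (_≤ toℕ t) (toℕ-fromℕ< h<n) h≤t)))

-- Input words as total predicates on positions

carries : ∀ {n} → Structure (wordSchema 2) n → Fin 2 → ℕ → Bool
carries {n} 𝓌 σ y with y <? n
... | yes y<n = rel 𝓌 σ (fromℕ< y<n ∷ [])
... | no _    = false

carries-toℕ : ∀ {n} (𝓌 : Structure (wordSchema 2) n) σ x → carries 𝓌 σ (toℕ x) ≡ rel 𝓌 σ (x ∷ [])
carries-toℕ {n} 𝓌 σ x with toℕ x <? n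
... | yes p = cong (λ x → rel 𝓌 σ (x ∷ [])) (fromℕ<-toℕ x p)
... | no ¬p = contradiction (toℕ<n x) ¬p

carries-outside : ∀ {n} (𝓌 : Structure (wordSchema 2) n) σ {y} → n ≤ y → carries 𝓌 σ y ≡ false
carries-outside {n} 𝓌 σ {y} n≤y with y <? n
... | yes y<n = contradiction n≤y (<⇒≱ y<n)
... | no _    = refl

-- Stated for all `y` because shifts of heights are stated on all of ℕ; from `n` on nothing is
-- counted.
count-carries≤ : ∀ {n} (𝓌 : Structure (wordSchema 2) n) σ y → count (carries 𝓌 σ) y ≤ n
count-carries≤ 𝓌 σ zero = z≤n
count-carries≤ {n} 𝓌 σ (suc y) = go (suc y ≤? n)
  where
  go : Dec (y < n) → count (carries 𝓌 σ) (suc y) ≤ n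
  go (yes y<n) = ≤-trans (≤-reflexive (sym (+-identityʳ _))) (≤-trans (count-lipschitz (carries 𝓌 σ) {0} {suc y} z≤n) y<n)
  go (no  y≮n) = subst (λ b → bit b + count (carries 𝓌 σ) y ≤ n) (sym (carries-outside 𝓌 σ (≮⇒≥ y≮n))) (count-carries≤ 𝓌 σ y)

-- Fails in arbitrary structures, where `letters` can spell two letters at one position, but is
-- preserved by every change.
Exclusive : ∀ {n} → Structure (wordSchema 2) n → Set
Exclusive {n} 𝓌 = ∀ (x : Fin n) → ¬ (T (rel 𝓌 opening (x ∷ [])) × T (rel 𝓌 closing (x ∷ [])))

exclusive-carries : ∀ {n} (𝓌 : Structure (wordSchema 2) n) → Exclusive 𝓌 → ∀ y → ¬ (T (carries 𝓌 opening y) × T (carries 𝓌 closing y))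
exclusive-carries {n} 𝓌 excl y with y <? n
... | yes y<n = excl (fromℕ< y<n)
... | no _    = proj₁

letters-spell : ∀ {n} (𝓌 : Structure (wordSchema 2) n) → Exclusive 𝓌 → ∀ x →
                Spells (letters 𝓌 x) (carries 𝓌 opening (toℕ x)) (carries 𝓌 closing (toℕ x))
letters-spell 𝓌 excl x rewrite carries-toℕ 𝓌 opening x | carries-toℕ 𝓌 closing x
  with rel 𝓌 opening (x ∷ []) | excl x
... | true | ¬both with rel 𝓌 closing (x ∷ [])
...   | true  = ⊥-elim (¬both _)
...   | false = single-opening
letters-spell 𝓌 excl x | false | _ with rel 𝓌 closing (x ∷ [])
...   | true  = single-closing
...   | false = nought

changed : ∀ {n} → Fin 3 → Fin n → Structure (wordSchema 2) n → Structure (wordSchema 2) n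
changed δ i = change (Member D₁) δ (i ∷ [])

module _ {n} (𝓌 : Structure (wordSchema 2) n) (i : Fin n) where

  setRel-on : ∀ τ σ → rel (setRel τ (i ∷ []) true 𝓌) σ (i ∷ []) ≡ (rel 𝓌 σ (i ∷ []) ∨ does (τ ≟ σ))
  setRel-on τ σ with τ ≟ σ
  ... | no _ = sym (∨-identityʳ _)
  ... | yes refl = trans (cong (λ d → if d then true else rel 𝓌 τ (i ∷ [])) (dec-true ((i ∷ []) ≟ᵗ (i ∷ [])) refl)) (sym (∨-zeroʳ _))

  setRel-off : ∀ τ σ {x} → x ≢ i → rel (setRel τ (i ∷ []) true 𝓌) σ (x ∷ []) ≡ rel 𝓌 σ (x ∷ [])
  setRel-off τ σ {x} x≢i with τ ≟ σ
  ... | no _ = refl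
  ... | yes refl = cong (λ d → if d then true else rel 𝓌 τ (x ∷ [])) (dec-false ((i ∷ []) ≟ᵗ (x ∷ [])) λ { refl → x≢i refl })

  letters-opening : rel 𝓌 opening (i ∷ []) ≡ true → ∃[ σ ] ∃[ σs ] letters 𝓌 i ≡ σ ∷ σs
  letters-opening eq with rel 𝓌 opening (i ∷ [])
  letters-opening refl | true = _ , _ , refl

  letters-closing : rel 𝓌 opening (i ∷ []) ≡ false → rel 𝓌 closing (i ∷ []) ≡ true → ∃[ σ ] ∃[ σs ] letters 𝓌 i ≡ σ ∷ σs
  letters-closing a≡ b≡ with rel 𝓌 opening (i ∷ [])
  letters-closing refl b≡ | false with rel 𝓌 closing (i ∷ [])
  letters-closing refl refl | false | true = _ , _ , refl

  letters-none : rel 𝓌 opening (i ∷ []) ≡ false → rel 𝓌 closing (i ∷ []) ≡ false → letters 𝓌 i ≡ []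
  letters-none a≡ b≡ with rel 𝓌 opening (i ∷ [])
  letters-none refl b≡ | false with rel 𝓌 closing (i ∷ [])
  letters-none refl refl | false | false = refl

  setLetter-occupied : ∀ τ → ∃[ σ ] ∃[ σs ] letters 𝓌 i ≡ σ ∷ σs → setLetter τ i 𝓌 ≡ 𝓌
  setLetter-occupied τ (_ , _ , eq) with letters 𝓌 i
  setLetter-occupied τ (_ , _ , refl) | _ ∷ _ = refl

  setLetter-free : ∀ τ → letters 𝓌 i ≡ [] → setLetter τ i 𝓌 ≡ setRel τ (i ∷ []) true 𝓌
  setLetter-free τ eq with letters 𝓌 i
  setLetter-free τ refl | [] = refl

  changed-on : ∀ δ σ → rel (changed δ i 𝓌) σ (i ∷ []) ≡ rewritten δ σ (rel 𝓌 opening (i ∷ [])) (rel 𝓌 closing (i ∷ []))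
  changed-on zero σ = trans (cong (λ d → not d ∧ rel 𝓌 σ (i ∷ [])) (dec-true ((i ∷ []) ≟ᵗ (i ∷ [])) refl)) (by-letter σ)
    where
    erased : ∀ p → false ≡ (p ∨ false) ∧ not p
    erased true  = refl
    erased false = refl
    by-letter : ∀ σ → false ≡ rewritten zero σ (rel 𝓌 opening (i ∷ [])) (rel 𝓌 closing (i ∷ []))
    by-letter zero       = erased (rel 𝓌 opening (i ∷ []))
    by-letter (suc zero) = erased (rel 𝓌 closing (i ∷ []))
  changed-on (suc τ) σ = go _ _ refl refl
    where
    blocked : ∀ p d → p ≡ (p ∨ (if d then false else false)) ∧ true
    blocked true  d     = refl
    blocked false true  = refl
    blocked false false = refl
    free : ∀ d → d ≡ (false ∨ (if d then true else false)) ∧ true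
    free true  = refl
    free false = refl
    go : ∀ a b → rel 𝓌 opening (i ∷ []) ≡ a → rel 𝓌 closing (i ∷ []) ≡ b →
         rel (setLetter τ i 𝓌) σ (i ∷ []) ≡ rewritten (suc τ) σ a b
    go true b a≡ b≡ = trans (cong (λ 𝓌 → rel 𝓌 σ (i ∷ [])) (setLetter-occupied τ (letters-opening a≡))) (by-letter σ)
      where
      by-letter : ∀ σ → rel 𝓌 σ (i ∷ []) ≡ rewritten (suc τ) σ true b
      by-letter zero       = trans a≡ (blocked true (does (τ ≟ zero)))
      by-letter (suc zero) = trans b≡ (blocked b (does (τ ≟ suc zero)))
    go false true a≡ b≡ = trans (cong (λ 𝓌 → rel 𝓌 σ (i ∷ [])) (setLetter-occupied τ (letters-closing a≡ b≡))) (by-letter σ)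
      where
      by-letter : ∀ σ → rel 𝓌 σ (i ∷ []) ≡ rewritten (suc τ) σ false true
      by-letter zero       = trans a≡ (blocked false (does (τ ≟ zero)))
      by-letter (suc zero) = trans b≡ (blocked true (does (τ ≟ suc zero)))
    go false false a≡ b≡ = trans (cong (λ 𝓌 → rel 𝓌 σ (i ∷ [])) (setLetter-free τ (letters-none a≡ b≡)))
        (trans (setRel-on τ σ) (by-letter σ))
      where
      by-letter : ∀ σ → (rel 𝓌 σ (i ∷ []) ∨ does (τ ≟ σ)) ≡ rewritten (suc τ) σ false false
      by-letter zero       = trans (cong (_∨ does (τ ≟ zero)) a≡) (free (does (τ ≟ zero)))
      by-letter (suc zero) = trans (cong (_∨ does (τ ≟ suc zero)) b≡) (free (does (τ ≟ suc zero)))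

  changed-off : ∀ δ σ {x} → x ≢ i → rel (changed δ i 𝓌) σ (x ∷ []) ≡ rel 𝓌 σ (x ∷ [])
  changed-off zero σ {x} x≢i =
    cong (λ d → not d ∧ rel 𝓌 σ (x ∷ [])) (dec-false ((x ∷ []) ≟ᵗ (i ∷ [])) λ { refl → x≢i refl })
  changed-off (suc τ) σ x≢i with letters 𝓌 i
  ... | []    = setRel-off τ σ x≢i
  ... | _ ∷ _ = refl

rewritten-exclusive : ∀ δ a b → ¬ (T a × T b) → ¬ (T (rewritten δ opening a b) × T (rewritten δ closing a b))
rewritten-exclusive δ                true  true  ¬ab _ = ¬ab _
rewritten-exclusive zero             true  false ¬ab = proj₁
rewritten-exclusive zero             false b     ¬ab = proj₁
rewritten-exclusive (suc zero)       true  false ¬ab = proj₂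
rewritten-exclusive (suc zero)       false true  ¬ab = proj₁
rewritten-exclusive (suc zero)       false false ¬ab = proj₂
rewritten-exclusive (suc (suc zero)) true  false ¬ab = proj₂
rewritten-exclusive (suc (suc zero)) false true  ¬ab = proj₁
rewritten-exclusive (suc (suc zero)) false false ¬ab = proj₁

changed-exclusive : ∀ {n} δ i (𝓌 : Structure (wordSchema 2) n) → Exclusive 𝓌 → Exclusive (changed δ i 𝓌)
changed-exclusive δ i 𝓌 excl x = go (x ≟ i)
  where
  go : Dec (x ≡ i) → ¬ (T (rel (changed δ i 𝓌) opening (x ∷ [])) × T (rel (changed δ i 𝓌) closing (x ∷ [])))
  go (yes refl) (op , cl) = rewritten-exclusive δ _ _ (excl i)
    (subst T (changed-on 𝓌 i δ opening) op , subst T (changed-on 𝓌 i δ closing) cl)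
  go (no x≢i) (op , cl) = excl x (subst T (changed-off 𝓌 i δ opening x≢i) op , subst T (changed-off 𝓌 i δ closing x≢i) cl)

carries-on : ∀ {n} (𝓌 : Structure (wordSchema 2) n) i δ σ →
             carries (changed δ i 𝓌) σ (toℕ i) ≡ rewritten δ σ (carries 𝓌 opening (toℕ i)) (carries 𝓌 closing (toℕ i))
carries-on 𝓌 i δ σ = trans (carries-toℕ (changed δ i 𝓌) σ i) (trans (changed-on 𝓌 i δ σ)
  (cong₂ (rewritten δ σ) (sym (carries-toℕ 𝓌 opening i)) (sym (carries-toℕ 𝓌 closing i))))

carries-off : ∀ {n} (𝓌 : Structure (wordSchema 2) n) i δ σ y → y ≢ toℕ i → carries (changed δ i 𝓌) σ y ≡ carries 𝓌 σ y
carries-off {n} 𝓌 i δ σ y y≢i with y <? n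
... | yes y<n = changed-off 𝓌 i δ σ (λ eq → y≢i (trans (sym (toℕ-fromℕ< y<n)) (cong toℕ eq)))
... | no _    = refl

carries-empty : ∀ {n} σ y → carries {n} emptyStructure σ y ≡ false
carries-empty {n} σ y with y <? n
... | yes _ = refl
... | no _  = refl

-- Correctness after every sequence of changes

Consistent : ∀ {n} → State member-D₁ n → Structure (wordSchema 2) n → Set
Consistent (𝒜 , _) 𝓌 = Invariant 𝒜 (carries 𝓌) × Exclusive 𝓌

consistent-step : ∀ {n} (s : State member-D₁ n) 𝓌 δ (p̄ : Tuple n 1) → Consistent s 𝓌 →
                  Consistent (update member-D₁ δ p̄ s) (change (Member D₁) δ p̄ 𝓌)
consistent-step (𝒜 , I) 𝓌 δ (i ∷ []) (inv , excl) =
  Preservation.preserved _ I inv δ i (carries-off 𝓌 i δ) (carries-on 𝓌 i δ)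
    (exclusive-carries 𝓌 excl (toℕ i)) (count-carries≤ 𝓌 closing) (count-carries≤ (changed δ i 𝓌) closing) ,
  changed-exclusive δ i 𝓌 excl

consistent : ∀ {n} (α : Changes (Member D₁) n) (s : State member-D₁ n) 𝓌 → Consistent s 𝓌 →
             Consistent (foldl (λ s (δ , p̄) → update member-D₁ δ p̄ s) s α)
                        (foldl (λ 𝓌 (δ , p̄) → change (Member D₁) δ p̄ 𝓌) 𝓌 α)
consistent []            s 𝓌 con = con
consistent ((δ , p̄) ∷ α) s 𝓌 con = consistent α _ _ (consistent-step s 𝓌 δ p̄ con)

member-D₁-correct : AnswersCorrectly member-D₁
member-D₁-correct {n} α = (λ { q [] → mk⇔ (from (D₁⇔Balanced _) ∘ from word-⇔ ∘ to query-⇔) (from query-⇔ ∘ to word-⇔ ∘ to (D₁⇔Balanced _)) }) , λ ()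
  where
  𝓌 = inputAfter (Member D₁) {n} α
  final : Consistent (stateAfter member-D₁ α) 𝓌
  final = consistent α _ _ (initial-invariant (carries-empty {n}) , λ x → proj₁)
  query-⇔ = accepts-eval {M = machines noPrograms n} {I = proj₂ (stateAfter member-D₁ α)} (proj₁ final) (exclusive-carries 𝓌 (proj₂ final))
  word-⇔ : Balanced 0 (word 𝓌) ⇔ NonNegative 0 (carries 𝓌) n
  word-⇔ = Balanced-⇔ id (letters 𝓌) (carries 𝓌) (letters-spell 𝓌 (proj₂ final)) 0

theorem6p5 : DynFO-with-work-𝒪 (Member D₁) (λ n → ⌊log₂ n ⌋ ^ 3)
theorem6p5 = member-D₁ , (member-D₁-correct , λ ()) , member-D₁-work
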